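{- For a prime $q$, an integer $k\ge 1$, $j\in\mathbb{F}_q^*$ and a positive integer $N$, let $E_k(N;j,q)$ denote the number of quadruples $(b_1,b_2,b_3,b_4)\in\mathbb{F}_q^4$ such that $$b_1+b_2=b_3+b_4\quad\text{and}\quad b_i^k\in\{j,2j,\ldots,Nj\}\subseteq\mathbb{F}_q,\qquad i=1,2,3,4.$$ Then for a fixed $k\ge 3$ and any positive integers $Q\ge N\ge 1$, we have $$ \frac{\log Q}{Q}\sum_{\substack{Q/2\le q<Q\\ q\ \text{prime}}}\ \max_{j\in\mathbb{F}_q^*}E_k(N;j,q)\ll N^2+N^4Q^{ -1+o(1)}. $$
   Context: $\mathbb{F}_q$ is the field of $q$ elements, $q$ prime; integers are viewed in $\mathbb{F}_q$ by reduction modulo $q$, so $\{j,2j,\ldots,Nj\}$ is a subset of $\mathbb{F}_q$. $U\ll V$ means $|U|\le cV$ for some positive constant $c$, which may depend on $k$. For a quantity $V>1$, $V^{o(1)}$ (as $V\to\infty$) denotes a function $U$ of $V$ satisfying $|U|\le V^{\varepsilon}$ for every $\varepsilon>0$, provided $V$ is large enough in terms of $\varepsilon$ (and the fixed $k$); the bound is uniform over all $N\le Q$. -}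

module Defs where

import Algebra.Definitions.RawSemiring
open import Data.Fin.Base using (Fin; toℕ)
import Data.Fin.Properties as Fin
open import Data.Integer.Base as ℤ using (+_)
open import Data.List.Base using (List; []; _∷_; map; filter; length; upTo; allFin; cartesianProduct)
open import Data.List.Extrema.Nat using (max)
import Data.List.Membership.DecPropositional as DecMembership
open import Data.List.Membership.Propositional using (_∈_)
open import Data.List.Relation.Unary.All using (All; all?)
open import Data.Nat.Base as ℕ using (ℕ; zero; suc; NonZero)
open import Data.Nat.DivMod using (_mod_)
open import Data.Nat.Primality using (Prime; prime?)
open import Data.Nat.ListAction using (sum)
import Data.Nat.Properties as ℕ
open import Data.Product.Base using (_×_; _,_; ∃-syntax)
open import Data.Rational.Base as ℚ using (ℚ; 0ℚ; 1ℚ; ∣_∣; ↥_; ↧ₙ_)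
open import Relation.Binary.PropositionalEquality using (_≡_)
open import Relation.Nullary.Decidable using (Dec; ¬?; _×-dec_)

open Algebra.Definitions.RawSemiring ℚ.+-*-rawSemiring public
  using () renaming (_^_ to _^ℚ_)

-- The ring of integers modulo q is Fin q, each class being represented by
-- its least non-negative element; it is 𝔽_q when q is prime.  An inhabitant
-- of Fin q supplies the proof that q ≠ 0 required by _mod_.

reduce : ∀ {q} → Fin q → ℕ → Fin q
reduce {q} a n = (n mod q) {{Fin.nonZeroIndex a}}

infixl 6 _⊕_
_⊕_ : ∀ {q} → Fin q → Fin q → Fin q
a ⊕ b = reduce a (toℕ a ℕ.+ toℕ b)

infixr 8 _^ᶠ_
_^ᶠ_ : ∀ {q} → Fin q → ℕ → Fin q
a ^ᶠ k = reduce a (toℕ a ℕ.^ k)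

-- {j, 2j, …, Nj}
multiples : ∀ {q} → ℕ → Fin q → List (Fin q)
multiples N j = map (λ n → reduce j (suc n ℕ.* toℕ j)) (upTo N)

Quadruple : ℕ → Set
Quadruple q = Fin q × Fin q × Fin q × Fin q

quadruples : ∀ q → List (Quadruple q)
quadruples q = cartesianProduct F (cartesianProduct F (cartesianProduct F F))
  where F = allFin q

Counted : ∀ {q} (k N : ℕ) (j : Fin q) → Quadruple q → Set
Counted k N j (b₁ , b₂ , b₃ , b₄) =
  b₁ ⊕ b₂ ≡ b₃ ⊕ b₄ ×
  All (λ b → b ^ᶠ k ∈ multiples N j) (b₁ ∷ b₂ ∷ b₃ ∷ b₄ ∷ [])

counted? : ∀ {q} (k N : ℕ) (j : Fin q) (b : Quadruple q) → Dec (Counted k N j b)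
counted? k N j (b₁ , b₂ , b₃ , b₄) =
  (b₁ ⊕ b₂ Fin.≟ b₃ ⊕ b₄) ×-dec
  all? (λ b → b ^ᶠ k ∈? multiples N j) (b₁ ∷ b₂ ∷ b₃ ∷ b₄ ∷ [])
  where open DecMembership Fin._≟_ using (_∈?_)

E : (k N : ℕ) {q : ℕ} → Fin q → ℕ
E k N {q} j = length (filter (counted? k N j) (quadruples q))

units : ∀ q → List (Fin q)
units q = filter (λ j → ¬? (toℕ j ℕ.≟ 0)) (allFin q)

-- For prime q the list of units is non-empty and E is ℕ-valued, so the base
-- value 0 does not affect the maximum.
maxE : (k N q : ℕ) → ℕ
maxE k N q = max 0 (map (E k N) (units q))

-- The primes q with Q/2 ≤ q < Q.
dyadicPrimes : ℕ → List ℕ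
dyadicPrimes Q = filter (λ q → (Q ℕ.≤? 2 ℕ.* q) ×-dec prime? q) (upTo Q)

sumMaxE : (k N Q : ℕ) → ℕ
sumMaxE k N Q = sum (map (maxE k N) (dyadicPrimes Q))

fromℕ : ℕ → ℚ
fromℕ n = + n ℚ./ 1

recip : (n : ℕ) .{{_ : NonZero n}} → ℚ
recip n = + 1 ℚ./ n

-- Partial sums of log Q = - log (1 - x) = Σ_{m ≥ 1} x^m / m, where
-- x = 1 - 1/Q ∈ [0, 1).
logPartialSum : (Q : ℕ) .{{_ : NonZero Q}} → ℕ → ℚ
logPartialSum Q zero    = 0ℚ
logPartialSum Q (suc n) =
  logPartialSum Q n ℚ.+ recip (suc n) ℚ.* (1ℚ ℚ.- recip Q) ^ℚ suc n

-- The lower Dedekind cut of the natural logarithm: the terms of the series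
-- are non-negative, so log Q is the supremum of the partial sums, and r lies
-- strictly below log Q exactly when it lies strictly below one of them.  For
-- rationals x ≥ 0 and y, the real inequality (log Q) x ≤ y is thus the
-- inequality r x ≤ y for all rationals r with r <log Q.
infix 4 _<log_
_<log_ : ℚ → (Q : ℕ) .{{_ : NonZero Q}} → Set
r <log Q = ∃[ n ] r ℚ.< logPartialSum Q n

-- U(V) = V^{o(1)} as V → ∞.  For ε = a/b > 0 in lowest terms, |U(V)| ≤ V^ε is
-- expressed as |U(V)|^b ≤ V^a.  Rational ε suffice since V^ε increases with ε
-- for V > 1.
IsPowerO1 : (ℕ → ℚ) → Set
IsPowerO1 U = ∀ (ε : ℚ) → 0ℚ ℚ.< ε → ∃[ V₀ ] ∀ V → V₀ ℕ.≤ V →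
  ∣ U V ∣ ^ℚ ↧ₙ ε ℚ.≤ fromℕ V ^ℚ ℤ.∣ ↥ ε ∣

{-# OPTIONS --safe #-}
module Submission where

-- The relations b₁ + b₂ = b₃ + b₄, bᵢᵏ = j nᵢ in 𝔽_q are homogeneous.  After
-- normalising by one of the bᵢ, they say that a homomorphism from
-- A = ℤ[X,Y]/(X^k - M, Y^k - M′) to 𝔽_q kills an element y of A, where A and y
-- depend only on n = (n₁,…,n₄).  If y is not a zero divisor, the ideal y A has
-- index N^{O(1)} in A, so only O(1) primes q ≥ Q/2 are possible for this n.
--
-- Let p ∤ k be a prime dividing n₁n₂n₃n₄ exactly once or twice.  Either p
-- divides a single nᵢ, to an exponent e ≤ 2 < k, or p divides exactly two of
-- them, once each.  Both times y can be written as c₁ p^e U^k - c₂ W^k with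
-- 0 < e < k and p ∤ c₁ c₂ M M′.  By Frobenius A/pA is reduced, so in
-- c₁ p^e (Ua)^k = c₂ (Wa)^k both Ua and Wa are divisible by p, and infinite
-- descent gives Ua = Wa = 0.  Hence y is not a zero divisor, unless the nᵢ are
-- equal in pairs.
--
-- Without such a prime, k³n₁n₂n₃n₄ is cube-full, which happens for only
-- N^{4/3 + o(1)} quadruples n; O(N²) quadruples consist of equal pairs.  These
-- exceptional n may occur for every prime q, and Chebyshev's bound for the
-- number of q gives the term N².  The other n contribute O(N⁴) in total.

open import Algebra.Bundles using (AbelianGroup; CommutativeRing)
import Algebra.Properties.CommutativeSemiring.Binomial as Binomial
import Algebra.Properties.CommutativeSemiring.Exp as CommutativeExp
import Algebra.Properties.Monoid.Mult as Mult
import Algebra.Properties.Semiring.Exp as Exp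
import Algebra.Properties.Semiring.Sum as Sum
open import Algebra.Structures using (IsCommutativeRing)
open import Data.Fin.Base as Fin using (Fin; toℕ; fromℕ<; combine; remQuot; finToFun; funToFin)
import Data.Fin.Properties as Fin
open import Data.Integer.Base as ℤ using (ℤ; +_; -[1+_]; +[1+_]; 0ℤ; 1ℤ; -1ℤ; ∣_∣)
open import Data.Integer.Divisibility.Signed as ℤ∣ using (divides)
import Data.Integer.Properties as ℤ
import Data.Integer.Tactic.RingSolver as ℤSolver
open import Algebra.Properties.Group (AbelianGroup.group ℤ.+-0-abelianGroup) using (∙-cancelʳ)
open import Data.List.Base using (List; []; _∷_; _++_; map; filter; length; upTo; allFin; concatMap; cartesianProduct; cartesianProductWith)
open import Data.List.Extrema.Nat using (argmax-sel)
import Data.List.Membership.DecPropositional as DecMembership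
open import Data.List.Membership.Propositional using (_∈_; lose)
open import Data.List.Membership.Propositional.Properties
open import Data.List.Properties using (length-++; length-map; length-upTo; length-filter)
open import Data.List.Relation.Unary.All as All using (All; []; _∷_; all?)
import Data.List.Relation.Unary.All.Properties as All
open import Data.List.Relation.Unary.AllPairs as AllPairs using (AllPairs; []; _∷_)
import Data.List.Relation.Unary.AllPairs.Properties as AllPairs
open import Data.List.Relation.Unary.Any as Any using (here; there)
open import Data.List.Relation.Unary.Unique.Propositional using (Unique)
import Data.List.Relation.Unary.Unique.Propositional.Properties as Unique
open import Data.Nat.Base as ℕ using (ℕ; zero; suc; NonZero; z≤n; s≤s; _!)
open import Data.Nat.Coprimality as Coprimality using (Coprime; coprime-divisor; coprime-Bézout)
open import Data.Nat.DivMod as ℕ using (_/_; _%_; _mod_; m/n*n≡m)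
open import Data.Nat.Divisibility as ℕ∣ using (_∣_; _∤_; divides; _∣?_)
open import Data.Nat.GCD as GCD using (gcd; module Bézout)
open import Data.Nat.Induction using (<-rec)
open import Data.Nat.ListAction using (product)
open import Data.Nat.ListAction.Properties using (product≢0)
open import Data.Nat.Primality
import Data.Nat.Properties as ℕ
import Data.Nat.Tactic.RingSolver as ℕSolver
open import Data.Product.Base using (_×_; _,_; proj₁; proj₂; ∃-syntax; uncurry)
import Data.Product.Properties as Product
import Data.Rational.Base as ℚ
import Data.Rational.Properties as ℚ
import Data.Rational.Solver as ℚSolver
open import Data.Rational.Unnormalised.Base as ℚᵘ using (mkℚᵘ; *≡*)
import Data.Rational.Unnormalised.Properties as ℚᵘ
open import Data.Sum.Base as Sum⊎ using (_⊎_; inj₁; inj₂; [_,_]′)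
open import Function.Base using (_∘_; _$_; id)
open import Function.Definitions using (Injective)
open import Level using (0ℓ)
open import Relation.Binary.Bundles using (Setoid)
open import Relation.Binary.PropositionalEquality as ≡ using (_≡_; _≢_; _≗_; refl; sym; trans; cong; cong₂; subst; module ≡-Reasoning)
import Relation.Binary.Reasoning.Setoid as SetoidReasoning
open import Relation.Nullary using (¬_; contradiction; yes; no; Dec)
open import Relation.Nullary.Decidable using (¬?; _×-dec_; _→-dec_)
open import Relation.Unary using (Decidable)

open import Defs

-- Congruences and primes

-- Cube-full products leave room to spare, but exponent 2 requires 2 < k, hence k ≥ 3.
--
-- X^k - M may be reducible, so A may have zero divisors and y ≠ 0 would not bound the index.
-- Divisibility by the single prime p replaces any study of the factorisation. The index is bounded
-- by pigeonhole instead of a determinant: if m is the product of the possible primes q, then every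
-- integer in y A is a multiple of m, and the elements y a + n, with n and the coefficients of a in
-- [0, m), would be too many for their size if m were large.
--
-- A is realised through its action on doubly indexed integer sequences, so that equality in A and
-- in A/dA becomes equality and congruence of integers.
--
-- Chebyshev's bound cancels log Q in the term N²; in the term N⁴/Q the logarithm survives and is
-- all of Q^o(1).

module Congruence where

  open import Data.Integer.Base using (_+_; _*_; _-_; -_; _^_)

  infix 4 _≡_[mod_]

  record _≡_[mod_] (x y d : ℤ) : Set where
    constructor mod-diff
    field difference : d ℤ∣.∣ x - y

  open _≡_[mod_] public

  module _ {d : ℤ} where

    mod-reflexive : ∀ {x y} → x ≡ y → x ≡ y [mod d ]
    mod-reflexive {x} refl = mod-diff (divides 0ℤ (ℤ.+-inverseʳ x))

    mod-refl : ∀ {x} → x ≡ x [mod d ]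
    mod-refl = mod-reflexive refl

    mod-sym : ∀ {x y} → x ≡ y [mod d ] → y ≡ x [mod d ]
    mod-sym {x} {y} (mod-diff d∣) =
      mod-diff (subst (d ℤ∣.∣_) (lemma x y) (ℤ∣.∣m⇒∣-m d∣))
      where
      lemma : ∀ x y → - (x - y) ≡ y - x
      lemma = ℤSolver.solve-∀

    mod-trans : ∀ {x y z} → x ≡ y [mod d ] → y ≡ z [mod d ] → x ≡ z [mod d ]
    mod-trans {x} {y} {z} (mod-diff p) (mod-diff q) =
      mod-diff (subst (d ℤ∣.∣_) (ℤ.+-minus-telescope x y z) (ℤ∣.∣m∣n⇒∣m+n p q))

    mod-+ : ∀ {x x′ y y′} → x ≡ x′ [mod d ] → y ≡ y′ [mod d ] →
            x + y ≡ x′ + y′ [mod d ]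
    mod-+ {x} {x′} {y} {y′} (mod-diff p) (mod-diff q) =
      mod-diff (subst (d ℤ∣.∣_) (lemma x x′ y y′) (ℤ∣.∣m∣n⇒∣m+n p q))
      where
      lemma : ∀ x x′ y y′ → (x - x′) + (y - y′) ≡ (x + y) - (x′ + y′)
      lemma = ℤSolver.solve-∀

    mod-* : ∀ {x x′ y y′} → x ≡ x′ [mod d ] → y ≡ y′ [mod d ] →
            x * y ≡ x′ * y′ [mod d ]
    mod-* {x} {x′} {y} {y′} (mod-diff p) (mod-diff q) =
      mod-diff (subst (d ℤ∣.∣_) (lemma x x′ y y′)
        (ℤ∣.∣m∣n⇒∣m+n (ℤ∣.∣m⇒∣m*n y p) (ℤ∣.∣n⇒∣m*n x′ q)))
      where
      lemma : ∀ x x′ y y′ → (x - x′) * y + x′ * (y - y′) ≡ x * y - x′ * y′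
      lemma = ℤSolver.solve-∀

    mod-^ : ∀ {x y} n → x ≡ y [mod d ] → x ^ n ≡ y ^ n [mod d ]
    mod-^ zero    p = mod-refl
    mod-^ (suc n) p = mod-* p (mod-^ n p)

    mod-0⇒∣ : ∀ {x} → x ≡ 0ℤ [mod d ] → d ℤ∣.∣ x
    mod-0⇒∣ {x} (mod-diff p) = subst (d ℤ∣.∣_) (ℤ.+-identityʳ x) p

    ∣⇒mod-0 : ∀ {x} → d ℤ∣.∣ x → x ≡ 0ℤ [mod d ]
    ∣⇒mod-0 {x} p = mod-diff (subst (d ℤ∣.∣_) (sym (ℤ.+-identityʳ x)) p)

    mod-setoid : Setoid 0ℓ 0ℓ
    mod-setoid = record
      { Carrier = ℤ ; _≈_ = _≡_[mod d ]
      ; isEquivalence = record { refl = mod-refl ; sym = mod-sym ; trans = mod-trans } }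

  mod-0⇒≡ : ∀ {x y} → x ≡ y [mod 0ℤ ] → x ≡ y
  mod-0⇒≡ {x} {y} (mod-diff p) = ℤ.i-j≡0⇒i≡j x y (ℤ∣.0∣⇒≡0 p)

open Congruence

prime∤1 : ∀ {p} → Prime p → ¬ p ∣ 1
prime∤1 pp p∣1 = ℕ.<⇒≢ (ℕ.nonTrivial⇒n>1 _ {{prime⇒nonTrivial pp}}) (≡.sym (ℕ∣.∣1⇒≡1 p∣1))

prime∤! : ∀ {p n} → Prime p → n ℕ.< p → ¬ p ∣ n !
prime∤! {n = zero}  pp _   p∣  = prime∤1 pp p∣
prime∤! {n = suc n} pp n<p p∣n! with euclidsLemma (suc n) (n !) pp p∣n!
... | inj₁ p∣1+n = ℕ∣.>⇒∤ n<p p∣1+n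
... | inj₂ p∣n!′ = prime∤! pp (ℕ.<-trans (ℕ.n<1+n n) n<p) p∣n!′

module BinomialCoefficients where

  open import Data.Nat.Combinatorics using (_C_; nCk≡n!/k![n-k]!; k![n∸k]!∣n!)

  nCk*k![n∸k]!≡n! : ∀ {n k} → k ℕ.≤ n → (n C k) ℕ.* (k ! ℕ.* (n ℕ.∸ k) !) ≡ n !
  nCk*k![n∸k]!≡n! {n} {k} k≤n = ≡.trans
    (cong (ℕ._* (k ! ℕ.* (n ℕ.∸ k) !)) (nCk≡n!/k![n-k]! k≤n))
    (m/n*n≡m {{_}} (k![n∸k]!∣n! k≤n))

  prime∣C : ∀ {p k} → Prime p → 0 ℕ.< k → k ℕ.< p → p ∣ p C k
  prime∣C {p@(suc p-1)} {k} pp 0<k k<p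
    with euclidsLemma (p C k) (k ! ℕ.* (p ℕ.∸ k) !) pp
           (subst (p ∣_) (≡.sym (nCk*k![n∸k]!≡n! (ℕ.<⇒≤ k<p))) (ℕ∣.m∣m*n (p-1 !)))
  ... | inj₁ p∣C = p∣C
  ... | inj₂ p∣k![p∸k]! with euclidsLemma (k !) ((p ℕ.∸ k) !) pp p∣k![p∸k]!
  ...   | inj₁ p∣k! = contradiction p∣k! (prime∤! pp k<p)
  ...   | inj₂ p∣[p∸k]! = contradiction p∣[p∸k]! (prime∤! pp (ℕ.∸-monoʳ-< 0<k (ℕ.<⇒≤ k<p)))
  prime∣C {zero} _ _ ()

open BinomialCoefficients

prime⇒2≤ : ∀ {p} → Prime p → 2 ℕ.≤ p
prime⇒2≤ p-prime = ℕ.nonTrivial⇒n>1 _ {{prime⇒nonTrivial p-prime}}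

prime∤⇒coprime : ∀ {p n} → Prime p → p ∤ n → Coprime n p
prime∤⇒coprime p-prime p∤n (d∣n , d∣p) with prime⇒irreducible p-prime d∣p
... | inj₁ d≡1  = d≡1
... | inj₂ refl = contradiction d∣n p∤n

coprime-divisor-^ : ∀ {m n} i {x} → Coprime m n → m ∣ n ℕ.^ i ℕ.* x → m ∣ x
coprime-divisor-^ zero {x} m⊥n m∣ = subst (_ ∣_) (ℕ.*-identityˡ x) m∣
coprime-divisor-^ {m} {n} (suc i) {x} m⊥n m∣ = coprime-divisor-^ i m⊥n
  (coprime-divisor m⊥n (subst (m ∣_) (ℕ.*-assoc n (n ℕ.^ i) x) m∣))

%-≡⇒∣-∸ : ∀ {m n} w .{{_ : NonZero w}} → m % w ≡ n % w → w ∣ n ℕ.∸ m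
%-≡⇒∣-∸ {m} {n} w m%w≡n%w = ℕ∣.divides (n / w ℕ.∸ m / w) (begin
  n ℕ.∸ m
    ≡⟨ cong₂ ℕ._∸_ (ℕ.m≡m%n+[m/n]*n n w) (ℕ.m≡m%n+[m/n]*n m w) ⟩
  (n % w ℕ.+ n / w ℕ.* w) ℕ.∸ (m % w ℕ.+ m / w ℕ.* w)
    ≡⟨ cong (λ r → (r ℕ.+ n / w ℕ.* w) ℕ.∸ (m % w ℕ.+ m / w ℕ.* w)) (sym m%w≡n%w) ⟩
  (m % w ℕ.+ n / w ℕ.* w) ℕ.∸ (m % w ℕ.+ m / w ℕ.* w)
    ≡⟨ ℕ.[m+n]∸[m+o]≡n∸o (m % w) _ _ ⟩
  n / w ℕ.* w ℕ.∸ m / w ℕ.* w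
    ≡⟨ ℕ.*-distribʳ-∸ w (n / w) (m / w) ⟨
  (n / w ℕ.∸ m / w) ℕ.* w ∎)
  where open ≡.≡-Reasoning

-- Pigeonhole: two of the w + 1 powers n^0, ..., n^w agree modulo w, and the smaller one cancels by
-- coprimality. The form `suc f` excludes the trivial exponent 0.
coprime⇒^≡1 : ∀ {n} w .{{_ : NonZero w}} .{{_ : NonZero n}} → Coprime w n →
              ∃[ f ] ∃[ t ] n ℕ.^ suc f ≡ 1 ℕ.+ t ℕ.* w
coprime⇒^≡1 {n} w w⊥n with i , j , i<j , eq ← Fin.pigeonhole (ℕ.n<1+n w) (λ i → (n ℕ.^ toℕ i) mod w) =
  f , ℕ∣._∣_.quotient w∣ , (begin
    n ℕ.^ suc f                  ≡⟨ ℕ.m+[n∸m]≡n (ℕ.>-nonZero⁻¹ _ {{ℕ.m^n≢0 n (suc f)}}) ⟨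
    1 ℕ.+ (n ℕ.^ suc f ℕ.∸ 1)    ≡⟨ cong suc (ℕ∣._∣_.equality w∣) ⟩
    1 ℕ.+ ℕ∣._∣_.quotient w∣ ℕ.* w ∎)
  where
  open ≡.≡-Reasoning
  f = toℕ j ℕ.∸ suc (toℕ i)

  j≡i+1+f : toℕ j ≡ toℕ i ℕ.+ suc f
  j≡i+1+f = sym (trans (ℕ.+-suc (toℕ i) f) (ℕ.m+[n∸m]≡n i<j))

  w∣ : w ∣ n ℕ.^ suc f ℕ.∸ 1
  w∣ = coprime-divisor-^ (toℕ i) w⊥n (subst (w ∣_) (begin
    n ℕ.^ toℕ j ℕ.∸ n ℕ.^ toℕ i
      ≡⟨ cong₂ ℕ._∸_ (trans (cong (n ℕ.^_) j≡i+1+f) (ℕ.^-distribˡ-+-* n (toℕ i) (suc f))) (sym (ℕ.*-identityʳ (n ℕ.^ toℕ i))) ⟩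
    n ℕ.^ toℕ i ℕ.* n ℕ.^ suc f ℕ.∸ n ℕ.^ toℕ i ℕ.* 1
      ≡⟨ ℕ.*-distribˡ-∸ (n ℕ.^ toℕ i) _ 1 ⟨
    n ℕ.^ toℕ i ℕ.* (n ℕ.^ suc f ℕ.∸ 1) ∎)
    (%-≡⇒∣-∸ w (trans (sym (Fin.toℕ-fromℕ< _)) (trans (cong toℕ eq) (Fin.toℕ-fromℕ< _)))))

euclidsLemmaℤ : ∀ {p} a b → Prime p → + p ℤ∣.∣ a ℤ.* b → + p ℤ∣.∣ a ⊎ + p ℤ∣.∣ b
euclidsLemmaℤ {p} a b p-prime p∣ab
  with euclidsLemma ∣ a ∣ ∣ b ∣ p-prime (subst (p ∣_) (ℤ.abs-* a b) (ℤ∣.∣⇒∣ᵤ p∣ab))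
... | inj₁ p∣a = inj₁ (ℤ∣.∣ᵤ⇒∣ p∣a)
... | inj₂ p∣b = inj₂ (ℤ∣.∣ᵤ⇒∣ p∣b)

pos-^ : ∀ m n → + (m ℕ.^ n) ≡ (+ m) ℤ.^ n
pos-^ m zero    = refl
pos-^ m (suc n) = trans (ℤ.pos-* m (m ℕ.^ n)) (cong (+ m ℤ.*_) (pos-^ m n))

n<m^n : ∀ {m} n → 2 ℕ.≤ m → n ℕ.< m ℕ.^ n
n<m^n zero    2≤m = s≤s z≤n
n<m^n {m} (suc n) 2≤m = ℕ.≤-trans
  (ℕ.≤-trans (ℕ.+-mono-≤ {1} {m ℕ.^ n} (ℕ.≤-trans (s≤s z≤n) (n<m^n n 2≤m)) (n<m^n n 2≤m))
    (ℕ.≤-reflexive (cong (m ℕ.^ n ℕ.+_) (sym (ℕ.+-identityʳ _)))))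
  (ℕ.*-monoˡ-≤ (m ℕ.^ n) 2≤m)

-- Trades a negative constant for a natural number modulo p; natural numbers are sums of ones, which
-- is what additivity of Frobenius can handle.
negative-mod : ∀ c p .{{_ : NonZero p}} → -[1+ c ] ≡ + (suc c ℕ.* ℕ.pred p) [mod + p ]
negative-mod c p = mod-diff (divides (-[1+ c ]) (begin
  -[1+ c ] ℤ.- (+ (suc c ℕ.* ℕ.pred p))
    ≡⟨ cong (λ x → -[1+ c ] ℤ.- x) (ℤ.pos-* (suc c) (ℕ.pred p)) ⟩
  -[1+ c ] ℤ.- (+ suc c) ℤ.* (+ ℕ.pred p)
    ≡⟨ lemma (+ suc c) (+ ℕ.pred p) ⟩
  -[1+ c ] ℤ.* (1ℤ ℤ.+ + ℕ.pred p)
    ≡⟨ cong (λ x → -[1+ c ] ℤ.* (+ x)) (ℕ.suc-pred p) ⟩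
  -[1+ c ] ℤ.* (+ p) ∎))
  where
  open ≡.≡-Reasoning
  lemma : ∀ a b → ℤ.- a ℤ.- a ℤ.* b ≡ ℤ.- a ℤ.* (1ℤ ℤ.+ b)
  lemma = ℤSolver.solve-∀

-- Divisors, cube-full numbers and primes in dyadic intervals

module Counting where

  unique-⊆⇒length≤ : ∀ {a} {A : Set a} {xs ys : List A} → Unique xs →
                     (∀ {x} → x ∈ xs → x ∈ ys) → length xs ℕ.≤ length ys
  unique-⊆⇒length≤ {xs = []} _ _ = z≤n
  unique-⊆⇒length≤ {xs = x ∷ xs} {ys} (x∉xs ∷ uniq) xs⊆ys
    with us , vs , refl ← ∈-∃++ (xs⊆ys (here refl)) = begin
      suc (length xs)                  ≤⟨ s≤s (unique-⊆⇒length≤ uniq xs⊆us++vs) ⟩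
      suc (length (us ++ vs))          ≡⟨ cong suc (length-++ us) ⟩
      suc (length us ℕ.+ length vs)    ≡⟨ ℕ.+-suc (length us) (length vs) ⟨
      length us ℕ.+ suc (length vs)    ≡⟨ length-++ us ⟨
      length (us ++ x ∷ vs)            ∎
      where
      open ℕ.≤-Reasoning
      xs⊆us++vs : ∀ {y} → y ∈ xs → y ∈ us ++ vs
      xs⊆us++vs y∈xs with ∈-++⁻ us (xs⊆ys (there y∈xs))
      ... | inj₁ y∈us          = ∈-++⁺ˡ y∈us
      ... | inj₂ (here refl)   = contradiction refl (All.lookup x∉xs y∈xs)
      ... | inj₂ (there y∈vs)  = ∈-++⁺ʳ us y∈vs

  length-cartesianProductWith : ∀ {a b c} {A : Set a} {B : Set b} {C : Set c} (f : A → B → C) xs ys →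
                                length (cartesianProductWith f xs ys) ≡ length xs ℕ.* length ys
  length-cartesianProductWith f []       ys = refl
  length-cartesianProductWith f (x ∷ xs) ys = trans (length-++ (map (f x) ys))
    (cong₂ ℕ._+_ (length-map (f x) ys) (length-cartesianProductWith f xs ys))

open Counting

-- The divisor function is n^o(1)

module Divisors where

  open import Data.Nat.Base using (_+_; _*_; _^_; _≤_; _<_; _∸_)

  ^-distribʳ-* : ∀ a b n → (a * b) ^ n ≡ a ^ n * b ^ n
  ^-distribʳ-* a b zero    = refl
  ^-distribʳ-* a b (suc n) = trans (cong (a * b *_) (^-distribʳ-* a b n)) (lemma a b (a ^ n) (b ^ n))
    where
    lemma : ∀ a b c d → a * b * (c * d) ≡ a * c * (b * d)
    lemma = ℕSolver.solve-∀

  -- Bernoulli's 1 + m ≤ 2^m for m = ⌊e/K⌋.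
  polynomial≤exponential : ∀ K .{{_ : NonZero K}} e → suc e ^ K ≤ K ^ K * 2 ^ e
  polynomial≤exponential K e = begin
    suc e ^ K                        ≤⟨ ℕ.^-monoˡ-≤ K 1+e≤ ⟩
    (K * 2 ^ (e / K)) ^ K            ≡⟨ ^-distribʳ-* K (2 ^ (e / K)) K ⟩
    K ^ K * (2 ^ (e / K)) ^ K        ≡⟨ cong (K ^ K *_) (ℕ.^-*-assoc 2 (e / K) K) ⟩
    K ^ K * 2 ^ (e / K * K)          ≤⟨ ℕ.*-monoʳ-≤ (K ^ K) (ℕ.^-monoʳ-≤ 2 (ℕ.m/n*n≤m e K)) ⟩
    K ^ K * 2 ^ e                    ∎
    where
    open ℕ.≤-Reasoning
    1+e≤ : suc e ≤ K * 2 ^ (e / K)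
    1+e≤ = begin
      suc e                          ≡⟨ cong suc (ℕ.m≡m%n+[m/n]*n e K) ⟩
      suc (e % K) + e / K * K        ≤⟨ ℕ.+-monoˡ-≤ (e / K * K) (ℕ.m%n<n e K) ⟩
      suc (e / K) * K                ≤⟨ ℕ.*-monoˡ-≤ K (n<m^n (e / K) ℕ.≤-refl) ⟩
      2 ^ (e / K) * K                ≡⟨ ℕ.*-comm _ K ⟩
      K * 2 ^ (e / K)                ∎

  extract-power : ∀ p n .{{_ : NonZero n}} → 2 ≤ p → ∃[ e ] ∃[ m ] n ≡ p ^ e * m × p ∤ m × NonZero m
  extract-power p n 2≤p = <-rec P step n
    where
    P : ℕ → Set
    P n = .{{_ : NonZero n}} → ∃[ e ] ∃[ m ] n ≡ p ^ e * m × p ∤ m × NonZero m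

    step : ∀ n → (∀ {m} → m < n → P m) → P n
    step n rec with p ∣? n
    ... | no p∤n = 0 , n , sym (ℕ.+-identityʳ n) , p∤n , ℕ.≢-nonZero (ℕ.≢-nonZero⁻¹ n)
    ... | yes (divides zero n≡0) = contradiction n≡0 (ℕ.≢-nonZero⁻¹ n)
    ... | yes (divides q@(suc _) refl) with e , m , q≡ , p∤m , m≢0 ← rec {q} (ℕ.m<m*n q p 2≤p) =
      suc e , m , trans (cong (_* p) q≡) (lemma (p ^ e) m p) , p∤m , m≢0
      where
      lemma : ∀ a b p → a * b * p ≡ p * a * b
      lemma = ℕSolver.solve-∀

  divisors : ℕ → List ℕ
  divisors n = filter (_∣? n) (upTo (suc n))

  divisors-unique : ∀ n → Unique (divisors n)
  divisors-unique n = Unique.filter⁺ (_∣? n) (Unique.upTo⁺ (suc n))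

  ∈-divisors⁺ : ∀ {d n} .{{_ : NonZero n}} → d ∣ n → d ∈ divisors n
  ∈-divisors⁺ {n = n} d∣n = ∈-filter⁺ (_∣? n) (∈-upTo⁺ (s≤s (ℕ∣.∣⇒≤ d∣n))) d∣n

  ∈-divisors⁻ : ∀ {d n} → d ∈ divisors n → d ∣ n
  ∈-divisors⁻ {n = n} d∈ = proj₂ (∈-filter⁻ (_∣? n) {xs = upTo (suc n)} d∈)

  τ : ℕ → ℕ
  τ n = length (divisors n)

  -- With g = gcd(d, x), the cofactor d/g is coprime to x/g and divides (x/g) y. No coprimality of x
  -- and y is needed, so τ is submultiplicative on all pairs.
  ∣*⇒factors : ∀ {d} x {y} .{{_ : NonZero x}} → d ∣ x * y → ∃[ g ] ∃[ h ] (g ∣ x) × (h ∣ y) × d ≡ g * h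
  ∣*⇒factors {d} x {y} d∣xy = g , d / g , GCD.gcd[m,n]∣n d x , h∣y , sym (ℕ.m*[n/m]≡n (GCD.gcd[m,n]∣m d x))
    where
    g = gcd d x
    instance
      g≢0 : NonZero g
      g≢0 = ℕ.≢-nonZero (GCD.gcd[m,n]≢0 d x (inj₂ (ℕ.≢-nonZero⁻¹ x)))
    h∣ : d / g ∣ x / g * y
    h∣ = ℕ∣.*-cancelˡ-∣ g (subst₂′ (sym (ℕ.m*[n/m]≡n (GCD.gcd[m,n]∣m d x)))
      (trans (cong (_* y) (sym (ℕ.m*[n/m]≡n (GCD.gcd[m,n]∣n d x)))) (ℕ.*-assoc g (x / g) y)) d∣xy)
      where
      subst₂′ : ∀ {a b c e} → a ≡ b → c ≡ e → a ∣ c → b ∣ e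
      subst₂′ refl refl p = p
    h∣y : d / g ∣ y
    h∣y = coprime-divisor (Coprimality.coprime-/gcd d x) h∣

  τ-* : ∀ x y .{{_ : NonZero x}} .{{_ : NonZero y}} → τ (x * y) ≤ τ x * τ y
  τ-* x y = ℕ.≤-trans
    (unique-⊆⇒length≤ (divisors-unique (x * y)) cover)
    (ℕ.≤-reflexive (length-cartesianProductWith _*_ (divisors x) (divisors y)))
    where
    cover : ∀ {d} → d ∈ divisors (x * y) → d ∈ cartesianProductWith _*_ (divisors x) (divisors y)
    cover {d} d∈ with g , h , g∣x , h∣y , refl ← ∣*⇒factors {d} x (∈-divisors⁻ d∈) =
      ∈-cartesianProductWith⁺ _*_ (∈-divisors⁺ g∣x) (∈-divisors⁺ h∣y)

  ∣prime^⇒ : ∀ {p d} e → Prime p → d ∣ p ^ e → ∃[ i ] i ≤ e × d ≡ p ^ i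
  ∣prime^⇒ zero _ d∣1 = 0 , z≤n , ℕ∣.∣1⇒≡1 d∣1
  ∣prime^⇒ {p} {d} (suc e) p-prime d∣ with p ∣? d
  ... | no p∤d with i , i≤e , d≡ ← ∣prime^⇒ e p-prime (coprime-divisor (prime∤⇒coprime p-prime p∤d) d∣) =
    i , ℕ.m≤n⇒m≤1+n i≤e , d≡
  ... | yes (divides q refl) with i , i≤e , refl ← ∣prime^⇒ {p} {q} e p-prime
          (ℕ∣.*-cancelˡ-∣ p {{prime⇒nonZero p-prime}} (subst (_∣ p ^ suc e) (ℕ.*-comm q p) d∣)) =
    suc i , s≤s i≤e , ℕ.*-comm (p ^ i) p

  τ-prime^ : ∀ {p} e → Prime p → τ (p ^ e) ≤ suc e
  τ-prime^ {p} e p-prime = ℕ.≤-trans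
    (unique-⊆⇒length≤ (divisors-unique (p ^ e)) cover)
    (ℕ.≤-reflexive (trans (length-map (p ^_) (upTo (suc e))) (length-upTo (suc e))))
    where
    cover : ∀ {d} → d ∈ divisors (p ^ e) → d ∈ map (p ^_) (upTo (suc e))
    cover d∈ with i , i≤e , refl ← ∣prime^⇒ e p-prime (∈-divisors⁻ d∈) =
      ∈-map⁺ (p ^_) (∈-upTo⁺ (s≤s i≤e))

  prime-factor : ∀ n → 2 ≤ n → ∃[ p ] Prime p × p ∣ n
  prime-factor n 2≤n = go n 0 0-rough (ℕ.+-identityʳ n)
    where
    go : ∀ fuel m → m Rough n → fuel + m ≡ n → ∃[ p ] Prime p × p ∣ n
    go zero m rough refl = n , rough∧∣⇒prime {{ℕ.n>1⇒nonTrivial 2≤n}} rough ℕ∣.∣-refl , ℕ∣.∣-refl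
    go (suc fuel) 0 rough eq = go fuel 1 1-rough (trans (ℕ.+-suc fuel 0) eq)
    go (suc fuel) 1 rough eq = go fuel 2 2-rough (trans (ℕ.+-suc fuel 1) eq)
    go (suc fuel) m@(suc (suc _)) rough eq with m ∣? n
    ... | yes m∣n = m , rough∧∣⇒prime rough m∣n , m∣n
    ... | no m∤n = go fuel (suc m) (∤⇒rough-suc m∤n rough) (trans (ℕ.+-suc fuel m) eq)

  module _ (K : ℕ) .{{_ : NonZero K}} where

    private
      T c : ℕ
      T = 2 ^ K
      c = K ^ K

      instance
        c≢0 : NonZero c
        c≢0 = ℕ.m^n≢0 K K

      2^e*K≤T^e : ∀ e → suc e ^ K ≤ T ^ e
      2^e*K≤T^e e = ℕ.≤-trans (ℕ.^-monoˡ-≤ K (n<m^n e ℕ.≤-refl)) (ℕ.≤-reflexive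
        (trans (ℕ.^-*-assoc 2 e K) (trans (cong (2 ^_) (ℕ.*-comm e K)) (sym (ℕ.^-*-assoc 2 K e)))))

      τ-split : ∀ {p} e m .{{_ : NonZero m}} → Prime p → τ (p ^ e * m) ^ K ≤ suc e ^ K * τ m ^ K
      τ-split {p} e m p-prime = ℕ.≤-trans
        (ℕ.^-monoˡ-≤ K (ℕ.≤-trans (τ-* (p ^ e) m {{ℕ.m^n≢0 p e {{prime⇒nonZero p-prime}}}}) (ℕ.*-monoˡ-≤ (τ m) (τ-prime^ e p-prime))))
        (ℕ.≤-reflexive (^-distribʳ-* (suc e) (τ m) K))

      -- Primes p ≥ T = 2^K cost no constant at all: (e+1)^K ≤ 2^(eK) = T^e ≤ p^e.
      rough-bound : ∀ n → T Rough n → .{{_ : NonZero n}} → τ n ^ K ≤ n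
      rough-bound = <-rec P step
        where
        P : ℕ → Set
        P n = T Rough n → .{{_ : NonZero n}} → τ n ^ K ≤ n
        step : ∀ n → (∀ {m} → m < n → P m) → P n
        step 1 _ _ = ℕ.≤-reflexive (ℕ.^-zeroˡ K)
        step n@(suc (suc _)) rec rough
          with p , p-prime , p∣n ← prime-factor n (s≤s (s≤s z≤n))
          with extract-power p n (prime⇒2≤ p-prime)
        ... | zero , m , n≡ , p∤m , _ = contradiction (subst (p ∣_) (trans n≡ (ℕ.+-identityʳ m)) p∣n) p∤m
        ... | suc e , m , n≡ , p∤m , m≢0 = subst (λ n → τ n ^ K ≤ n) (sym n≡) (begin
          τ (p ^ suc e * m) ^ K     ≤⟨ τ-split (suc e) m {{m≢0}} p-prime ⟩
          suc (suc e) ^ K * τ m ^ K ≤⟨ ℕ.*-mono-≤ (ℕ.≤-trans (2^e*K≤T^e (suc e)) (ℕ.^-monoˡ-≤ (suc e) T≤p)) (rec m<n (rough∧∣⇒rough rough m∣n) {{m≢0}}) ⟩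
          p ^ suc e * m             ∎)
          where
          open ℕ.≤-Reasoning
          T≤p : T ≤ p
          T≤p = ℕ.≮⇒≥ λ p<T → rough (record { divisor-< = p<T ; divisor-∣ = p∣n ; nontrivial = prime⇒nonTrivial p-prime })
          m∣n : m ∣ n
          m∣n = divides (p ^ suc e) n≡
          m<n : m < n
          m<n = subst (m <_) (sym n≡) (ℕ.≤-trans (ℕ.m<m*n m (p ^ suc e) {{m≢0}}
            (ℕ.≤-trans (prime⇒2≤ p-prime) (ℕ.m≤m*n p (p ^ e) {{ℕ.m^n≢0 p e {{prime⇒nonZero p-prime}}}})))
            (ℕ.≤-reflexive (ℕ.*-comm m _)))

      -- Here j counts the candidates t, ..., T - 1 still to be removed from n. A prime divisor
      -- among them costs at most the factor c = K^K, by `polynomial≤exponential`; after the last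
      -- one, `rough-bound` takes over.
      bound : ∀ j t → j + t ≡ T → ∀ n .{{_ : NonZero n}} → t Rough n → τ n ^ K ≤ c ^ j * n
      bound zero t refl n rough = ℕ.≤-trans (rough-bound n rough) (ℕ.≤-reflexive (sym (ℕ.+-identityʳ n)))
      bound (suc j) t eq n rough with t ∣? n
      ... | no t∤n = ℕ.≤-trans (bound j (suc t) (trans (ℕ.+-suc j t) eq) n (∤⇒rough-suc t∤n rough))
                      (ℕ.*-monoˡ-≤ n (ℕ.m≤n*m (c ^ j) c))
      bound (suc j) 0 eq n rough | yes 0∣n = contradiction (ℕ∣.0∣⇒≡0 0∣n) (ℕ.≢-nonZero⁻¹ n)
      bound (suc j) 1 eq n rough | yes _   = ℕ.≤-trans (bound j 2 (trans (ℕ.+-suc j 1) eq) n 2-rough)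
                                               (ℕ.*-monoˡ-≤ n (ℕ.m≤n*m (c ^ j) c))
      bound (suc j) p@(suc (suc _)) eq n rough | yes p∣n
        with e , m , n≡ , p∤m , m≢0 ← extract-power p n (s≤s (s≤s z≤n)) = subst (λ n → τ n ^ K ≤ c ^ suc j * n) (sym n≡) (begin
          τ (p ^ e * m) ^ K              ≤⟨ τ-split e m {{m≢0}} (rough∧∣⇒prime rough p∣n) ⟩
          suc e ^ K * τ m ^ K            ≤⟨ ℕ.*-mono-≤ (ℕ.≤-trans (polynomial≤exponential K e) (ℕ.*-monoʳ-≤ c (ℕ.^-monoˡ-≤ e {2} (s≤s (s≤s z≤n)))))
                                              (bound j (suc p) (trans (ℕ.+-suc j p) eq) m {{m≢0}} (∤⇒rough-suc p∤m (rough∧∣⇒rough rough (divides (p ^ e) n≡)))) ⟩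
          c * p ^ e * (c ^ j * m)        ≡⟨ lemma c (p ^ e) (c ^ j) m ⟩
          c ^ suc j * (p ^ e * m)        ∎)
        where
        open ℕ.≤-Reasoning
        lemma : ∀ c q d m → c * q * (d * m) ≡ c * d * (q * m)
        lemma = ℕSolver.solve-∀

    -- This is τ(n) ≪ n^(1/K), raised to the power K to stay within ℕ.
    divisor-bound : ∃[ κ ] NonZero κ × (∀ n .{{_ : NonZero n}} → τ n ^ K ≤ κ * n)
    divisor-bound = c ^ T , ℕ.m^n≢0 c T , λ n → bound T 0 (ℕ.+-identityʳ T) n 0-rough

open Divisors

-- Cube-full products and Chebyshev's bound

module Arithmetic where

  open import Data.Nat.Combinatorics using (_C_; nCk+nC[k+1]≡[n+1]C[k+1]; nCn≡1; nCk≡nC[n∸k]; k>n⇒nCk≡0)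
  open import Data.Nat.Base using (_+_; _*_; _^_; _≤_; _<_; _∸_)

  ^-monoʳ-∣ : ∀ m {i j} → i ≤ j → m ^ i ∣ m ^ j
  ^-monoʳ-∣ m {i} {j} i≤j = divides (m ^ (j ∸ i)) (trans (cong (m ^_) (sym (ℕ.m∸n+n≡m i≤j))) (ℕ.^-distribˡ-+-* m (j ∸ i) i))

  CubeFull : ℕ → Set
  CubeFull n = ∀ {p} → Prime p → p ∣ n → p ^ 3 ∣ n

  prime∣^⇒∣ : ∀ {p m} n → Prime p → p ∣ m ^ n → p ∣ m
  prime∣^⇒∣ zero p-prime p∣1 = contradiction p∣1 (prime∤1 p-prime)
  prime∣^⇒∣ {m = m} (suc n) p-prime p∣ = [ id , prime∣^⇒∣ n p-prime ]′ (euclidsLemma m (m ^ n) p-prime p∣)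

  prime≢⇒∤^ : ∀ {p q} n → Prime p → Prime q → q ≢ p → p ∤ q ^ n
  prime≢⇒∤^ n p-prime q-prime q≢p p∣q^n with prime⇒irreducible q-prime (prime∣^⇒∣ n p-prime p∣q^n)
  ... | inj₁ refl = contradiction ℕ∣.∣-refl (prime∤1 p-prime)
  ... | inj₂ p≡q  = q≢p (sym p≡q)

  p^3∣p^e*m⇒3≤e : ∀ {p m} e → Prime p → p ∤ m → p ^ 3 ∣ p ^ e * m → 3 ≤ e
  p^3∣p^e*m⇒3≤e {p} {m} e p-prime p∤m p^3∣ = ℕ.≮⇒≥ λ e<3 → p∤m (p∣m (ℕ.m<n⇒0<n∸m e<3) (cancelled e<3))
    where
    cancelled : e < 3 → p ^ (3 ∸ e) ∣ m
    cancelled e<3 = ℕ∣.*-cancelˡ-∣ (p ^ e) {{ℕ.m^n≢0 p e {{prime⇒nonZero p-prime}}}}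
      (subst (_∣ p ^ e * m) (trans (cong (p ^_) (sym (ℕ.m+[n∸m]≡n (ℕ.<⇒≤ e<3)))) (ℕ.^-distribˡ-+-* p e (3 ∸ e))) p^3∣)
    p∣m : ∀ {i} → 0 < i → p ^ i ∣ m → p ∣ m
    p∣m {suc i} _ = ℕ∣.∣-trans (ℕ∣.m∣m*n (p ^ i))

  cofactor< : ∀ {n p m} e → n ≡ p ^ e * m → Prime p → p ∤ m → NonZero m → p ∣ n → m < n
  cofactor< {n} {p} {m} zero n≡ p-prime p∤m m≢0 p∣n = contradiction (subst (p ∣_) (trans n≡ (ℕ.+-identityʳ m)) p∣n) p∤m
  cofactor< {n} {p} {m} (suc e) n≡ p-prime p∤m m≢0 p∣n = subst (m <_) (trans (ℕ.*-comm m _) (sym n≡))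
    (ℕ.m<m*n m (p ^ suc e) {{m≢0}} (ℕ.≤-trans (prime⇒2≤ p-prime) (ℕ.m≤m*n p (p ^ e) {{ℕ.m^n≢0 p e {{prime⇒nonZero p-prime}}}})))

  cofactor-cubeFull : ∀ {n p m} e → n ≡ p ^ e * m → Prime p → p ∤ m → CubeFull n → CubeFull m
  cofactor-cubeFull {n} {p} {m} e n≡ p-prime p∤m full {q} q-prime q∣m = coprime-divisor-^ e
    (prime∤⇒coprime p-prime (prime≢⇒∤^ 3 p-prime q-prime λ { refl → p∤m q∣m }))
    (subst (q ^ 3 ∣_) n≡ (full q-prime (ℕ∣.∣-trans q∣m (divides (p ^ e) n≡))))

  -- a is the product of p^⌊e/3⌋ over the exact prime powers p^e of n. Since e ≥ 3, e ≤ 3⌊e/3⌋ + 2 ≤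
  -- 5⌊e/3⌋, with equality for e = 5, whence the exponent 5.
  cubeFull⇒ : ∀ n .{{_ : NonZero n}} → CubeFull n → ∃[ a ] NonZero a × a ^ 3 ≤ n × n ∣ a ^ 5
  cubeFull⇒ n = <-rec P step n
    where
    P : ℕ → Set
    P n = .{{_ : NonZero n}} → CubeFull n → ∃[ a ] NonZero a × a ^ 3 ≤ n × n ∣ a ^ 5

    step : ∀ n → (∀ {m} → m < n → P m) → P n
    step 1 _ _ = 1 , _ , ℕ.≤-refl , ℕ∣.∣-refl
    step n@(suc (suc _)) rec full
      with p , p-prime , p∣n ← prime-factor n (s≤s (s≤s z≤n))
      with e , m , n≡ , p∤m , m≢0 ← extract-power p n (prime⇒2≤ p-prime)
      with a , a≢0 , a^3≤m , m∣a^5 ← rec {m} (cofactor< e n≡ p-prime p∤m m≢0 p∣n) {{m≢0}} (cofactor-cubeFull e n≡ p-prime p∤m full) =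
        p ^ f * a , ℕ.m*n≢0 (p ^ f) a {{ℕ.m^n≢0 p f {{prime⇒nonZero p-prime}}}} {{a≢0}} ,
        (begin
          (p ^ f * a) ^ 3       ≡⟨ trans (^-distribʳ-* (p ^ f) a 3) (cong (_* a ^ 3) (ℕ.^-*-assoc p f 3)) ⟩
          p ^ (f * 3) * a ^ 3   ≤⟨ ℕ.*-mono-≤ (ℕ.^-monoʳ-≤ p {{prime⇒nonZero p-prime}} (ℕ.m/n*n≤m e 3)) a^3≤m ⟩
          p ^ e * m             ≡⟨ n≡ ⟨
          n                     ∎) ,
        subst (_∣ (p ^ f * a) ^ 5) (sym n≡) (subst (p ^ e * m ∣_) (sym (^-distribʳ-* (p ^ f) a 5))
          (ℕ∣.*-pres-∣ (subst (p ^ e ∣_) (sym (ℕ.^-*-assoc p f 5)) (^-monoʳ-∣ p e≤5f)) m∣a^5))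
      where
      open ℕ.≤-Reasoning

      f : ℕ
      f = e / 3

      3≤e : 3 ≤ e
      3≤e = p^3∣p^e*m⇒3≤e e p-prime p∤m (subst (p ^ 3 ∣_) n≡ (full p-prime p∣n))

      e≤5f : e ≤ f * 5
      e≤5f = begin
        e                  ≡⟨ ℕ.m≡m%n+[m/n]*n e 3 ⟩
        e % 3 + f * 3      ≤⟨ ℕ.+-monoˡ-≤ (f * 3) (ℕ.s≤s⁻¹ (ℕ.m%n<n e 3)) ⟩
        2 + f * 3          ≤⟨ ℕ.+-monoˡ-≤ (f * 3) (ℕ.*-monoˡ-≤ 2 (ℕ.m≥n⇒m/n>0 3≤e)) ⟩
        f * 2 + f * 3      ≡⟨ ℕ.*-distribˡ-+ f 2 3 ⟨
        f * 5              ∎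

  -- r is the integer part of the real e-th root of X; it lets N^(4/3) and square roots be handled
  -- inside ℕ.
  root : ∀ e .{{_ : NonZero e}} X → ∃[ r ] r ^ e ≤ X × (∀ a → a ^ e ≤ X → a ≤ r)
  root e@(suc e-1) X = go X a≤X
    where
    a≤X : ∀ a → a ^ e ≤ X → a ≤ X
    a≤X zero    _ = z≤n
    a≤X (suc a) le = ℕ.≤-trans (ℕ.m≤m*n (suc a) (suc a ^ e-1) {{ℕ.m^n≢0 (suc a) e-1}}) le
    go : ∀ b → (∀ a → a ^ e ≤ X → a ≤ b) → ∃[ r ] r ^ e ≤ X × (∀ a → a ^ e ≤ X → a ≤ r)
    go b ub with b ^ e ℕ.≤? X
    ... | yes b^e≤X = b , b^e≤X , ub
    go zero    ub | no 0≰X = contradiction z≤n 0≰X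
    go (suc b) ub | no b≰X = go b λ a a^e≤X → ℕ.s≤s⁻¹ (ℕ.≤∧≢⇒< (ub a a^e≤X) λ { refl → b≰X a^e≤X })

  ^-cancelˡ-≤ : ∀ n {a b} .{{_ : NonZero n}} → a ^ n ≤ b ^ n → a ≤ b
  ^-cancelˡ-≤ n a^n≤b^n = ℕ.≮⇒≥ λ b<a → ℕ.<⇒≱ (ℕ.^-monoˡ-< n b<a) a^n≤b^n

  length-concatMap≤ : ∀ {A B : Set} (f : A → List B) xs {t} → (∀ {x} → x ∈ xs → length (f x) ≤ t) →
                      length (concatMap f xs) ≤ length xs * t
  length-concatMap≤ f []       f≤t = z≤n
  length-concatMap≤ f (x ∷ xs) {t} f≤t = begin
    length (f x ++ concatMap f xs)            ≡⟨ length-++ (f x) ⟩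
    length (f x) + length (concatMap f xs)    ≤⟨ ℕ.+-mono-≤ (f≤t (here refl)) (length-concatMap≤ f xs (f≤t ∘ there)) ⟩
    t + length xs * t                         ∎
    where open ℕ.≤-Reasoning

  τ-^ : ∀ a n .{{_ : NonZero a}} → τ (a ^ n) ≤ τ a ^ n
  τ-^ a zero    = ℕ.≤-refl
  τ-^ a (suc n) = ℕ.≤-trans (τ-* a (a ^ n)) (ℕ.*-monoʳ-≤ (τ a) (τ-^ a n))
    where
    instance
      a^n≢0 : NonZero (a ^ n)
      a^n≢0 = ℕ.m^n≢0 a n

  fourfold : ∀ {A : Set} → List A → List (A × A × A × A)
  fourfold xs = cartesianProduct xs (cartesianProduct xs (cartesianProduct xs xs))

  length-fourfold : ∀ {A : Set} (xs : List A) → length (fourfold xs) ≡ length xs ^ 4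
  length-fourfold xs = trans (length-cartesianProductWith _,_ xs _) (cong (length xs *_)
    (trans (length-cartesianProductWith _,_ xs _) (cong (length xs *_)
      (trans (length-cartesianProductWith _,_ xs xs) (cong (length xs *_) (sym (ℕ.*-identityʳ (length xs))))))))

  ∈-fourfold⁺ : ∀ {A : Set} {xs : List A} {a b c d} → a ∈ xs → b ∈ xs → c ∈ xs → d ∈ xs → (a , b , c , d) ∈ fourfold xs
  ∈-fourfold⁺ a∈ b∈ c∈ d∈ = ∈-cartesianProduct⁺ a∈ (∈-cartesianProduct⁺ b∈ (∈-cartesianProduct⁺ c∈ d∈))

  -- n₁n₂n₃n₄k³ cube-full gives nᵢ ∣ a⁵ for some a ≪ N^{4/3}, and each a⁵ has
  -- only a^{o(1)} divisors.
  module _ (k : ℕ) .{{_ : NonZero k}} where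

    abstract
      cubeFull-bound : ∃[ κ ] NonZero κ × (∀ n .{{_ : NonZero n}} → τ n ^ 40 ≤ κ * n)
      -- 40 = 2 · 4 · 5: four divisors of a^5 can be chosen in at most τ(a)^20 ways, and this number
      -- is to be O(a^(1/2)).
      cubeFull-bound = divisor-bound 40

    private
      κ : ℕ
      κ = proj₁ cubeFull-bound

      instance
        κ≢0 : NonZero κ
        κ≢0 = proj₁ (proj₂ cubeFull-bound)

      k^3≢0 : NonZero (k ^ 3)
      k^3≢0 = ℕ.m^n≢0 k 3

    cubeFullQuadruples : ∀ N → ∃[ L ] length L ≤ κ * k ^ 3 * N ^ 2 ×
      (∀ {a b c d} → .{{_ : NonZero a}} → .{{_ : NonZero b}} → .{{_ : NonZero c}} → .{{_ : NonZero d}} →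
       a ≤ N → b ≤ N → c ≤ N → d ≤ N → CubeFull (k ^ 3 * (a * (b * (c * d)))) → (a , b , c , d) ∈ L)
    cubeFullQuadruples N = L , length-L , cover
      where
      X : ℕ
      X = k ^ 3 * N ^ 4

      A T : ℕ
      A = proj₁ (root 3 X)
      T = proj₁ (root 2 (κ * A))

      L : List (ℕ × ℕ × ℕ × ℕ)
      L = concatMap (λ a → fourfold (divisors (a ^ 5))) (map suc (upTo A))

      fibre : ∀ {a} → a ∈ map suc (upTo A) → length (fourfold (divisors (a ^ 5))) ≤ T
      fibre a∈ with i , i∈ , refl ← ∈-map⁻ suc a∈ = proj₂ (proj₂ (root 2 (κ * A))) _ (begin
        length (fourfold (divisors (suc i ^ 5))) ^ 2
          ≡⟨ cong (_^ 2) (length-fourfold (divisors (suc i ^ 5))) ⟩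
        (τ (suc i ^ 5) ^ 4) ^ 2
          ≡⟨ ℕ.^-*-assoc (τ (suc i ^ 5)) 4 2 ⟩
        τ (suc i ^ 5) ^ 8
          ≤⟨ ℕ.^-monoˡ-≤ 8 (τ-^ (suc i) 5) ⟩
        (τ (suc i) ^ 5) ^ 8
          ≡⟨ ℕ.^-*-assoc (τ (suc i)) 5 8 ⟩
        τ (suc i) ^ 40
          ≤⟨ proj₂ (proj₂ cubeFull-bound) (suc i) ⟩
        κ * suc i
          ≤⟨ ℕ.*-monoʳ-≤ κ (∈-upTo⁻ i∈) ⟩
        κ * A ∎)
        where open ℕ.≤-Reasoning

      length-L : length L ≤ κ * k ^ 3 * N ^ 2
      length-L = begin
        length L                          ≤⟨ length-concatMap≤ (λ a → fourfold (divisors (a ^ 5))) (map suc (upTo A)) fibre ⟩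
        length (map suc (upTo A)) * T     ≡⟨ cong (_* T) (trans (length-map suc (upTo A)) (length-upTo A)) ⟩
        A * T                             ≤⟨ ^-cancelˡ-≤ 2 square ⟩
        κ * k ^ 3 * N ^ 2                 ∎
        where
        open ℕ.≤-Reasoning
        lemma : ∀ a c → a * (a * 1) * (c * a) ≡ c * (a * (a * (a * 1)))
        lemma = ℕSolver.solve-∀
        lemma′ : ∀ c b n → c * b * (n * (n * 1)) * (c * b * (n * (n * 1))) ≡ c * b * (c * (b * (n * (n * (n * (n * 1))))))
        lemma′ = ℕSolver.solve-∀
        -- There are A ≈ N^(4/3) values of a with at most T ≈ A^(1/2) quadruples each, and A^(3/2) ≈
        -- N² is exactly what is allowed.
        square : (A * T) ^ 2 ≤ (κ * k ^ 3 * N ^ 2) ^ 2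
        square = begin
          (A * T) ^ 2                     ≡⟨ ^-distribʳ-* A T 2 ⟩
          A ^ 2 * T ^ 2                   ≤⟨ ℕ.*-monoʳ-≤ (A ^ 2) (proj₁ (proj₂ (root 2 (κ * A)))) ⟩
          A ^ 2 * (κ * A)                 ≡⟨ lemma A κ ⟩
          κ * A ^ 3                       ≤⟨ ℕ.*-monoʳ-≤ κ (proj₁ (proj₂ (root 3 X))) ⟩
          κ * X                           ≤⟨ ℕ.m≤n*m (κ * X) (κ * k ^ 3) {{ℕ.m*n≢0 κ (k ^ 3) {{κ≢0}} {{k^3≢0}}}} ⟩
          κ * k ^ 3 * (κ * X)             ≡⟨ lemma′ κ (k ^ 3) N ⟨
          κ * k ^ 3 * N ^ 2 * (κ * k ^ 3 * N ^ 2) ≡⟨ cong (κ * k ^ 3 * N ^ 2 *_) (ℕ.*-identityʳ (κ * k ^ 3 * N ^ 2)) ⟨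
          (κ * k ^ 3 * N ^ 2) ^ 2         ∎

      cover : ∀ {a b c d} → .{{_ : NonZero a}} → .{{_ : NonZero b}} → .{{_ : NonZero c}} → .{{_ : NonZero d}} →
        a ≤ N → b ≤ N → c ≤ N → d ≤ N → CubeFull (k ^ 3 * (a * (b * (c * d)))) → (a , b , c , d) ∈ L
      cover {a} {b} {c} {d} {{a≢0}} {{b≢0}} {{c≢0}} {{d≢0}} a≤N b≤N c≤N d≤N full
        with x@(suc x-1) , _ , x^3≤ , ∣x^5 ← cubeFull⇒ _
               {{ℕ.m*n≢0 (k ^ 3) (a * (b * (c * d))) {{k^3≢0}} {{ℕ.m*n≢0 a (b * (c * d)) {{a≢0}} {{ℕ.m*n≢0 b (c * d) {{b≢0}} {{ℕ.m*n≢0 c d {{c≢0}} {{d≢0}}}}}}}}}} full =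
        ∈-concatMap⁺ (λ a → fourfold (divisors (a ^ 5)))
          (lose (∈-map⁺ suc (∈-upTo⁺ x≤A))
            (∈-fourfold⁺ (member (ℕ∣.m∣m*n (b * (c * d))))
                         (member (ℕ∣.∣n⇒∣m*n a (ℕ∣.m∣m*n (c * d))))
                         (member (ℕ∣.∣n⇒∣m*n a (ℕ∣.∣n⇒∣m*n b (ℕ∣.m∣m*n d))))
                         (member (ℕ∣.∣n⇒∣m*n a (ℕ∣.∣n⇒∣m*n b (ℕ∣.n∣m*n c))))))
        where
        x≤A : x ≤ A
        x≤A = proj₂ (proj₂ (root 3 X)) x (ℕ.≤-trans x^3≤ (ℕ.*-monoʳ-≤ (k ^ 3)
          (ℕ.*-mono-≤ a≤N (ℕ.*-mono-≤ b≤N (ℕ.*-mono-≤ c≤N (ℕ.≤-trans d≤N (ℕ.≤-reflexive (sym (ℕ.*-identityʳ N)))))))))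

        member : ∀ {y} → y ∣ a * (b * (c * d)) → y ∈ divisors (x ^ 5)
        member y∣ = ∈-divisors⁺ {{ℕ.m^n≢0 x 5}} (ℕ∣.∣-trans y∣ (ℕ∣.∣-trans (ℕ∣.n∣m*n (k ^ 3)) ∣x^5))

  product-primes∣ : ∀ {ps D} → Unique ps → All Prime ps → All (_∣ D) ps → product ps ∣ D
  product-primes∣ [] [] [] = ℕ∣.1∣ _
  product-primes∣ {p ∷ ps} (p∉ps ∷ uniq) (p-prime ∷ primes) (divides q refl ∷ ps∣) =
    subst (p * product ps ∣_) (ℕ.*-comm p q) (ℕ∣.*-monoʳ-∣ p
      (product-primes∣ uniq primes (All.tabulate λ {x} x∈ →
        [ id , (λ x∣p → [ (λ x≡1 → contradiction (subst (_∣ 1) (sym x≡1) ℕ∣.∣-refl) (prime∤1 (All.lookup primes x∈)))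
                        , (λ x≡p → contradiction (sym x≡p) (All.lookup p∉ps x∈)) ]′ (prime⇒irreducible p-prime x∣p)) ]′
        (euclidsLemma q p (All.lookup primes x∈) (All.lookup ps∣ x∈)))))

  ^length≤product : ∀ {b ps} → All (b ≤_) ps → b ^ length ps ≤ product ps
  ^length≤product []           = ℕ.≤-refl
  ^length≤product (b≤p ∷ b≤ps) = ℕ.*-mono-≤ b≤p (^length≤product b≤ps)

  nCk≤2^n : ∀ n k → n C k ≤ 2 ^ n
  nCk≤2^n zero    zero    = ℕ.≤-refl
  nCk≤2^n zero    (suc k) = ℕ.≤-trans (ℕ.≤-reflexive (k>n⇒nCk≡0 {0} {suc k} (s≤s z≤n))) z≤n
  nCk≤2^n (suc n) zero    = ℕ.≤-trans (ℕ.≤-reflexive (trans (nCk≡nC[n∸k] {0} {suc n} z≤n) (nCn≡1 (suc n)))) (ℕ.m^n>0 2 (suc n))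
  nCk≤2^n (suc n) (suc k) = begin
    suc n C suc k             ≡⟨ nCk+nC[k+1]≡[n+1]C[k+1] n k ⟨
    n C k + n C suc k         ≤⟨ ℕ.+-mono-≤ (nCk≤2^n n k) (nCk≤2^n n (suc k)) ⟩
    2 ^ n + 2 ^ n             ≡⟨ cong (_+_ (2 ^ n)) (ℕ.+-identityʳ (2 ^ n)) ⟨
    2 ^ suc n                 ∎
    where open ℕ.≤-Reasoning

  log₂ : ∀ n .{{_ : NonZero n}} → ∃[ j ] 2 ^ j ≤ n × n < 2 ^ suc j
  log₂ 1 = 0 , ℕ.≤-refl , ℕ.≤-refl
  log₂ (suc n@(suc _)) with j , 2^j≤n , n<2^1+j ← log₂ n with suc n ℕ.<? 2 ^ suc j
  ... | yes 1+n<2^1+j = j , ℕ.m≤n⇒m≤1+n 2^j≤n , 1+n<2^1+j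
  ... | no  1+n≮2^1+j = suc j , ℕ.≮⇒≥ 1+n≮2^1+j , ℕ.≤-<-trans n<2^1+j (ℕ.^-monoʳ-< 2 (s≤s (s≤s z≤n)) (ℕ.n<1+n (suc j)))

  dyadicPrimes-unique : ∀ Q → Unique (dyadicPrimes Q)
  dyadicPrimes-unique Q = Unique.filter⁺ (λ q → (Q ℕ.≤? 2 ℕ.* q) ×-dec prime? q) (Unique.upTo⁺ Q)

  ∈-dyadicPrimes⁻ : ∀ {Q q} → q ∈ dyadicPrimes Q → q < Q × Q ≤ 2 * q × Prime q
  ∈-dyadicPrimes⁻ {Q} q∈ with q∈upTo , Q≤2q , q-prime ← ∈-filter⁻ (λ q → (Q ℕ.≤? 2 ℕ.* q) ×-dec prime? q) {xs = upTo Q} q∈ =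
    ∈-upTo⁻ q∈upTo , Q≤2q , q-prime

  p∣n! : ∀ {p n} → 0 < p → p ≤ n → p ∣ n !
  p∣n! {suc p} {suc n} 0<p 1+p≤1+n with suc p ℕ.≟ suc n
  ... | yes refl = ℕ∣.m∣m*n (n !)
  ... | no  p≢n  = ℕ∣.∣n⇒∣m*n (suc n) (p∣n! 0<p (ℕ.s≤s⁻¹ (ℕ.≤∧≢⇒< 1+p≤1+n p≢n)))

  -- The primes in (t, 2t+1] divide (2t+1)! / (t!)².
  dyadicPrimes-product : ∀ Q .{{_ : NonZero Q}} → product (dyadicPrimes Q) ≤ 2 ^ (2 * Q)
  dyadicPrimes-product Q@(suc Q-1) = begin
    product (dyadicPrimes Q)      ≤⟨ ℕ∣.∣⇒≤ {{D≢0}} (product-primes∣ (dyadicPrimes-unique Q)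
                                       (All.tabulate λ q∈ → proj₂ (proj₂ (∈-dyadicPrimes⁻ {Q} q∈))) (All.tabulate q∣D)) ⟩
    D                             ≤⟨ ℕ.*-mono-≤ (ℕ.≤-trans 1+2t≤Q (ℕ.<⇒≤ (n<m^n Q ℕ.≤-refl))) (ℕ.≤-trans (nCk≤2^n (2 * t) t) (ℕ.^-monoʳ-≤ 2 (ℕ.≤-trans (ℕ.n≤1+n _) 1+2t≤Q))) ⟩
    2 ^ Q * 2 ^ Q                 ≡⟨ trans (sym (ℕ.^-distribˡ-+-* 2 Q Q)) (cong (λ n → 2 ^ (Q + n)) (sym (ℕ.+-identityʳ Q))) ⟩
    2 ^ (2 * Q)                   ∎
    where
    open ℕ.≤-Reasoning
    t D : ℕ
    t = Q-1 / 2
    D = suc (2 * t) * ((2 * t) C t)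

    t≤2t : t ≤ 2 * t
    t≤2t = ℕ.m≤n*m t 2

    2t∸t≡t : 2 * t ∸ t ≡ t
    2t∸t≡t = trans (ℕ.m+n∸m≡n t (t + 0)) (ℕ.+-identityʳ t)

    1+2t≤Q : suc (2 * t) ≤ Q
    1+2t≤Q = s≤s (ℕ.≤-trans (ℕ.≤-reflexive (ℕ.*-comm 2 t)) (ℕ.m/n*n≤m Q-1 2))

    Q-1≤1+2t : Q-1 ≤ suc (2 * t)
    Q-1≤1+2t = ℕ.≤-trans (ℕ.≤-reflexive (ℕ.m≡m%n+[m/n]*n Q-1 2))
      (ℕ.+-mono-≤ (ℕ.s≤s⁻¹ (ℕ.m%n<n Q-1 2)) (ℕ.≤-reflexive (ℕ.*-comm t 2)))

    [1+2t]!≡ : suc (2 * t) ! ≡ D * (t ! * t !)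
    [1+2t]!≡ = trans (cong (suc (2 * t) *_) (trans (sym (nCk*k![n∸k]!≡n! t≤2t))
      (cong (λ i → ((2 * t) C t) * (t ! * i !)) 2t∸t≡t))) (sym (ℕ.*-assoc (suc (2 * t)) ((2 * t) C t) (t ! * t !)))

    D≢0 : NonZero D
    D≢0 = ℕ.≢-nonZero λ D≡0 → ℕ.<⇒≢ (ℕ.1≤n! (suc (2 * t))) (sym (trans [1+2t]!≡ (cong (_* (t ! * t !)) D≡0)))

    q∣D : ∀ {q} → q ∈ dyadicPrimes Q → q ∣ D
    q∣D {q} q∈ with q<Q , Q≤2q , q-prime ← ∈-dyadicPrimes⁻ {Q} q∈ =
      [ id , (λ q∣t!t! → contradiction ([ id , id ]′ (euclidsLemma (t !) (t !) q-prime q∣t!t!)) (prime∤! q-prime t<q)) ]′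
      (euclidsLemma D (t ! * t !) q-prime (subst (q ∣_) [1+2t]!≡
        (p∣n! (ℕ.≤-trans (s≤s z≤n) (prime⇒2≤ q-prime)) (ℕ.≤-trans (ℕ.s≤s⁻¹ q<Q) Q-1≤1+2t))))
      where
      t<q : t < q
      t<q = ℕ.*-cancelˡ-< 2 t q (ℕ.≤-trans 1+2t≤Q Q≤2q)

  -- Each of these ℓ primes is at least 2^(j-1), so the bound for their product gives (j-1) ℓ ≤ 2Q;
  -- what remains is at most 3ℓ ≤ 3Q. The factor 2 + j is the majorant of log Q that is used
  -- throughout.
  length-dyadicPrimes : ∀ Q .{{_ : NonZero Q}} → (2 + proj₁ (log₂ Q)) * length (dyadicPrimes Q) ≤ 5 * Q
  length-dyadicPrimes Q with j , 2^j≤Q , _ ← log₂ Q = begin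
    (2 + j) * ℓ                ≤⟨ ℕ.*-monoˡ-≤ ℓ 2+j≤ ⟩
    ((j ∸ 1) + 3) * ℓ          ≡⟨ ℕ.*-distribʳ-+ ℓ (j ∸ 1) 3 ⟩
    (j ∸ 1) * ℓ + 3 * ℓ        ≤⟨ ℕ.+-mono-≤ exponents (ℕ.*-monoʳ-≤ 3 ℓ≤Q) ⟩
    2 * Q + 3 * Q              ≡⟨ ℕ.*-distribʳ-+ Q 2 3 ⟨
    5 * Q                      ∎
    where
    open ℕ.≤-Reasoning
    ℓ : ℕ
    ℓ = length (dyadicPrimes Q)

    2+j≤ : 2 + j ≤ (j ∸ 1) + 3
    2+j≤ = ℕ.≤-trans (ℕ.+-monoʳ-≤ 2 (ℕ.m≤n+m∸n j 1)) (ℕ.≤-reflexive (ℕ.+-comm 3 (j ∸ 1)))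

    ℓ≤Q : ℓ ≤ Q
    ℓ≤Q = ℕ.≤-trans (length-filter (λ q → (Q ℕ.≤? 2 ℕ.* q) ×-dec prime? q) (upTo Q)) (ℕ.≤-reflexive (length-upTo Q))

    half : ∀ j {q} → 2 ^ j ≤ 2 * q → 0 < q → 2 ^ (j ∸ 1) ≤ q
    half zero    _  0<q = 0<q
    half (suc j) le _   = ℕ.*-cancelˡ-≤ 2 le

    exponents : (j ∸ 1) * ℓ ≤ 2 * Q
    exponents = ℕ.≮⇒≥ λ lt → ℕ.<⇒≱ (ℕ.^-monoʳ-< 2 (s≤s (s≤s z≤n)) lt) (begin
      2 ^ ((j ∸ 1) * ℓ)         ≡⟨ ℕ.^-*-assoc 2 (j ∸ 1) ℓ ⟨
      (2 ^ (j ∸ 1)) ^ ℓ         ≤⟨ ^length≤product (All.tabulate λ {q} q∈ →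
                                     half j (ℕ.≤-trans 2^j≤Q (proj₁ (proj₂ (∈-dyadicPrimes⁻ {Q} q∈))))
                                       (ℕ.≤-trans (s≤s z≤n) (prime⇒2≤ (proj₂ (proj₂ (∈-dyadicPrimes⁻ {Q} q∈)))))) ⟩
      product (dyadicPrimes Q)  ≤⟨ dyadicPrimes-product Q ⟩
      2 ^ (2 * Q)               ∎)

open Arithmetic

-- The ring ℤ[X,Y]/(X^k - M, Y^k - M′)

module RadicalRing (k M M′ : ℕ) .{{_ : NonZero k}} where

  open import Data.Integer.Base using (_+_; _*_; _-_; -_; _^_)

  infixl 6 _⊞_
  infixl 7 _⊠_

  -- ℤ[X,Y], to be taken modulo X^k = M and Y^k = M′
  data Poly : Set where
    con     : ℤ → Poly
    X Y     : Poly
    _⊞_ _⊠_ : Poly → Poly → Poly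

  Sequence : Set
  Sequence = ℕ → ℕ → ℤ

  -- X and Y act as the two shifts.
  act : Poly → Sequence → Sequence
  act (con c) s i j = c * s i j
  act X       s i j = s (suc i) j
  act Y       s i j = s i (suc j)
  act (p ⊞ q) s i j = act p s i j + act q s i j
  act (p ⊠ q) s     = act p (act q s)

  -- The ideal (X^k - M, Y^k - M′) is the annihilator of the sequences with
  -- these two recurrences.
  record Twisted (s : Sequence) : Set where
    field
      stepX : ∀ i j → s (i ℕ.+ k) j ≡ + M * s i j
      stepY : ∀ i j → s i (j ℕ.+ k) ≡ + M′ * s i j
  open Twisted

  module _ {d : ℤ} where

    act-mod : ∀ p {s t} → (∀ i j → s i j ≡ t i j [mod d ]) →
              ∀ i j → act p s i j ≡ act p t i j [mod d ]
    act-mod (con c) s≈t i j = mod-* {x = c} mod-refl (s≈t i j)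
    act-mod X       s≈t i j = s≈t (suc i) j
    act-mod Y       s≈t i j = s≈t i (suc j)
    act-mod (p ⊞ q) s≈t i j = mod-+ (act-mod p s≈t i j) (act-mod q s≈t i j)
    act-mod (p ⊠ q) s≈t     = act-mod p (act-mod q s≈t)

  act-cong : ∀ p {s t} → (∀ i j → s i j ≡ t i j) → ∀ i j → act p s i j ≡ act p t i j
  act-cong p s≈t i j = mod-0⇒≡ (act-mod p (λ i j → mod-reflexive (s≈t i j)) i j)

  act-* : ∀ p c s i j → act p (λ i j → c * s i j) i j ≡ c * act p s i j
  act-* (con a) c s i j = lemma a c (s i j)
    where
    lemma : ∀ a c x → a * (c * x) ≡ c * (a * x)
    lemma = ℤSolver.solve-∀
  act-* X       c s i j = refl
  act-* Y       c s i j = refl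
  act-* (p ⊞ q) c s i j =
    trans (cong₂ _+_ (act-* p c s i j) (act-* q c s i j)) (sym (ℤ.*-distribˡ-+ c _ _))
  act-* (p ⊠ q) c s i j =
    trans (act-cong p (act-* q c s) i j) (act-* p c (act q s) i j)

  act-+ : ∀ p s t i j → act p (λ i j → s i j + t i j) i j ≡ act p s i j + act p t i j
  act-+ (con a) s t i j = ℤ.*-distribˡ-+ a _ _
  act-+ X       s t i j = refl
  act-+ Y       s t i j = refl
  act-+ (p ⊞ q) s t i j =
    trans (cong₂ _+_ (act-+ p s t i j) (act-+ q s t i j))
          (lemma (act p s i j) (act p t i j) (act q s i j) (act q t i j))
    where
    lemma : ∀ a b c d → a + b + (c + d) ≡ a + c + (b + d)
    lemma = ℤSolver.solve-∀
  act-+ (p ⊠ q) s t i j =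
    trans (act-cong p (act-+ q s t) i j) (act-+ p (act q s) (act q t) i j)

  act-shiftX : ∀ p s i j → act p (λ i j → s (suc i) j) i j ≡ act p s (suc i) j
  act-shiftX (con c) s i j = refl
  act-shiftX X       s i j = refl
  act-shiftX Y       s i j = refl
  act-shiftX (p ⊞ q) s i j = cong₂ _+_ (act-shiftX p s i j) (act-shiftX q s i j)
  act-shiftX (p ⊠ q) s i j =
    trans (act-cong p (act-shiftX q s) i j) (act-shiftX p (act q s) i j)

  act-shiftY : ∀ p s i j → act p (λ i j → s i (suc j)) i j ≡ act p s i (suc j)
  act-shiftY (con c) s i j = refl
  act-shiftY X       s i j = refl
  act-shiftY Y       s i j = refl
  act-shiftY (p ⊞ q) s i j = cong₂ _+_ (act-shiftY p s i j) (act-shiftY q s i j)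
  act-shiftY (p ⊠ q) s i j =
    trans (act-cong p (act-shiftY q s) i j) (act-shiftY p (act q s) i j)

  act-comm : ∀ p q s i j → act p (act q s) i j ≡ act q (act p s) i j
  act-comm (con c) q s i j = sym (act-* q c s i j)
  act-comm X       q s i j = sym (act-shiftX q s i j)
  act-comm Y       q s i j = sym (act-shiftY q s i j)
  act-comm (p ⊞ p′) q s i j =
    trans (cong₂ _+_ (act-comm p q s i j) (act-comm p′ q s i j))
          (sym (act-+ q (act p s) (act p′ s) i j))
  act-comm (p ⊠ p′) q s i j =
    trans (act-cong p (act-comm p′ q s) i j) (act-comm p q (act p′ s) i j)

  act-twisted : ∀ p {s} → Twisted s → Twisted (act p s)
  act-twisted (con c) {s} tw = record
    { stepX = λ i j → trans (cong (c *_) (stepX tw i j)) (lemma c (+ M) (s i j))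
    ; stepY = λ i j → trans (cong (c *_) (stepY tw i j)) (lemma c (+ M′) (s i j)) }
    where
    lemma : ∀ a c x → a * (c * x) ≡ c * (a * x)
    lemma = ℤSolver.solve-∀
  act-twisted X tw = record
    { stepX = λ i → stepX tw (suc i) ; stepY = λ i → stepY tw (suc i) }
  act-twisted Y tw = record
    { stepX = λ i j → stepX tw i (suc j) ; stepY = λ i j → stepY tw i (suc j) }
  act-twisted (p ⊞ q) tw = record
    { stepX = λ i j → trans (cong₂ _+_ (stepX twp i j) (stepX twq i j)) (sym (ℤ.*-distribˡ-+ (+ M) _ _))
    ; stepY = λ i j → trans (cong₂ _+_ (stepY twp i j) (stepY twq i j)) (sym (ℤ.*-distribˡ-+ (+ M′) _ _)) }
    where
    twp = act-twisted p tw
    twq = act-twisted q tw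
  act-twisted (p ⊠ q) tw = act-twisted p (act-twisted q tw)

  infix 4 _≈_[_]

  -- For d = 0 this is equality in A, since congruence modulo 0 is equality; for other d it is
  -- equality in A/dA. Both rings are thus instances of `ring d`, with the same elements.
  record _≈_[_] (p q : Poly) (d : ℤ) : Set where
    constructor equal
    field agree : ∀ {s} → Twisted s → ∀ i j → act p s i j ≡ act q s i j [mod d ]
  open _≈_[_] public

  exact : ∀ {d p q} → (∀ s i j → act p s i j ≡ act q s i j) → p ≈ q [ d ]
  exact p≡q = equal λ {s} _ i j → mod-reflexive (p≡q s i j)

  module _ (d : ℤ) where

    private
      ≈-trans : ∀ {p q r} → p ≈ q [ d ] → q ≈ r [ d ] → p ≈ r [ d ]
      ≈-trans p≈q q≈r = equal λ tw i j → mod-trans (agree p≈q tw i j) (agree q≈r tw i j)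

      ⊞-cong : ∀ {p p′ q q′} → p ≈ p′ [ d ] → q ≈ q′ [ d ] → p ⊞ q ≈ p′ ⊞ q′ [ d ]
      ⊞-cong p≈p′ q≈q′ = equal λ tw i j → mod-+ (agree p≈p′ tw i j) (agree q≈q′ tw i j)

      ⊠-cong : ∀ {p p′ q q′} → p ≈ p′ [ d ] → q ≈ q′ [ d ] → p ⊠ q ≈ p′ ⊠ q′ [ d ]
      ⊠-cong {p} {p′} {q} {q′} p≈p′ q≈q′ = equal λ tw i j →
        mod-trans (agree p≈p′ (act-twisted q tw) i j) (act-mod p′ (agree q≈q′ tw) i j)

      ⊠-comm : ∀ p q → p ⊠ q ≈ q ⊠ p [ d ]
      ⊠-comm p q = exact (act-comm p q)

      ⊠-identityˡ : ∀ p → con 1ℤ ⊠ p ≈ p [ d ]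
      ⊠-identityˡ p = exact λ s i j → ℤ.*-identityˡ _

      ⊠-distribʳ : ∀ p q r → (q ⊞ r) ⊠ p ≈ q ⊠ p ⊞ r ⊠ p [ d ]
      ⊠-distribʳ p q r = exact λ s i j → refl

      ⊠-distribˡ : ∀ p q r → p ⊠ (q ⊞ r) ≈ p ⊠ q ⊞ p ⊠ r [ d ]
      ⊠-distribˡ p q r = exact λ s → act-+ p (act q s) (act r s)

      negate : ∀ p → con -1ℤ ⊠ p ⊞ p ≈ con 0ℤ [ d ]
      negate p = exact λ s i j → lemma (act p s i j)
        where
        lemma : ∀ x → -1ℤ * x + x ≡ 0ℤ
        lemma = ℤSolver.solve-∀

    isCommutativeRing : IsCommutativeRing (_≈_[ d ]) _⊞_ _⊠_ (con -1ℤ ⊠_) (con 0ℤ) (con 1ℤ)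
    isCommutativeRing = record
      { isRing = record
        { +-isAbelianGroup = record
          { isGroup = record
            { isMonoid = record
              { isSemigroup = record
                { isMagma = record
                  { isEquivalence = record
                    { refl = exact λ s i j → refl
                    ; sym = λ p≈q → equal λ tw i j → mod-sym (agree p≈q tw i j)
                    ; trans = ≈-trans }
                  ; ∙-cong = ⊞-cong }
                ; assoc = λ p q r → exact λ s i j → ℤ.+-assoc (act p s i j) _ _ }
              ; identity = (λ p → exact λ s i j → ℤ.+-identityˡ _)
                         , (λ p → exact λ s i j → ℤ.+-identityʳ _) }
            ; inverse = negate
                      , λ p → ≈-trans (⊞-comm p (con -1ℤ ⊠ p)) (negate p)
            ; ⁻¹-cong = ⊠-cong (exact λ s i j → refl) }
          ; comm = ⊞-comm }
        ; *-cong = ⊠-cong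
        ; *-assoc = λ p q r → exact λ s i j → refl
        ; *-identity = ⊠-identityˡ , λ p → ≈-trans (⊠-comm p (con 1ℤ)) (⊠-identityˡ p)
        ; distrib = ⊠-distribˡ , ⊠-distribʳ }
      ; *-comm = ⊠-comm }
      where
      ⊞-comm : ∀ p q → p ⊞ q ≈ q ⊞ p [ d ]
      ⊞-comm p q = exact λ s i j → ℤ.+-comm (act p s i j) _

    ring : CommutativeRing 0ℓ 0ℓ
    ring = record { isCommutativeRing = isCommutativeRing }

-- The Frobenius endomorphism

module Frobenius {c ℓ} (R : CommutativeRing c ℓ) {p : ℕ} (p-prime : Prime p) where

  open CommutativeRing R hiding (refl; zero) renaming (sym to ≈-sym; trans to ≈-trans)
  open import Data.Nat.Combinatorics using (_C_; nCn≡1)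
  open Exp semiring using (_^_; ^-assocʳ; ^-congˡ) 
  open CommutativeExp commutativeSemiring using (^-distrib-*)
  open Mult +-monoid using (×-assocˡ; ×-congʳ; ×-congˡ; ×-homo-1) renaming (_×_ to _⋆_)
  open Sum semiring using (sum; sum-cong-≋; sum-init-last; sum-replicate-zero)
  open import Relation.Binary.Reasoning.Setoid setoid

  module _ (p×≈0 : ∀ x → p ⋆ x ≈ 0#) where

    ^-distrib-+ : ∀ x y → (x + y) ^ p ≈ x ^ p + y ^ p
    ^-distrib-+ x y = go p-prime p×≈0
      where
      open Binomial commutativeSemiring using (theorem; binomialTerm)

      go : ∀ {n} → Prime n → (∀ x → n ⋆ x ≈ 0#) → (x + y) ^ n ≈ x ^ n + y ^ n
      go {suc m} n-prime n×≈0 = begin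
        (x + y) ^ n                     ≈⟨ theorem n x y ⟩
        t Fin.zero + sum (t ∘ Fin.suc)        ≈⟨ +-congˡ (sum-init-last (t ∘ Fin.suc)) ⟩
        t Fin.zero + (sum (t ∘ Fin.suc ∘ Fin.inject₁) + t (Fin.fromℕ n)) ≈⟨ +-cong t₀ (+-cong middle tₙ) ⟩
        y ^ n + (0# + x ^ n)            ≈⟨ +-congˡ (+-identityˡ _) ⟩
        y ^ n + x ^ n                   ≈⟨ +-comm _ _ ⟩
        x ^ n + y ^ n                   ∎
        where
        n = suc m
        t = binomialTerm x y n

        t₀ : t Fin.zero ≈ y ^ n
        t₀ = ≈-trans (×-homo-1 _) (*-identityˡ _)

        tₙ : t (Fin.fromℕ n) ≈ x ^ n
        tₙ = last (cong suc (Fin.toℕ-fromℕ m))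
          where
          last : ∀ {i} → i ≡ n → (n C i) ⋆ (x ^ i * y ^ (n ℕ.∸ i)) ≈ x ^ n
          last refl = begin
            (n C n) ⋆ (x ^ n * y ^ (n ℕ.∸ n))  ≈⟨ ×-congˡ (nCn≡1 n) ⟩
            1 ⋆ (x ^ n * y ^ (n ℕ.∸ n))        ≈⟨ ×-homo-1 _ ⟩
            x ^ n * y ^ (n ℕ.∸ n)              ≡⟨ cong (λ e → x ^ n * y ^ e) (ℕ.n∸n≡0 n) ⟩
            x ^ n * 1#                         ≈⟨ *-identityʳ _ ⟩
            x ^ n                              ∎

        middle : sum (t ∘ Fin.suc ∘ Fin.inject₁) ≈ 0#
        middle = ≈-trans
          (sum-cong-≋ λ i → ×-zero i)
          (sum-replicate-zero m)
          where
          ×-zero : (i : Fin m) → t (Fin.suc (Fin.inject₁ i)) ≈ 0#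
          ×-zero i with divides q eq ← prime∣C n-prime (s≤s z≤n) (s≤s (subst (ℕ._< m) (sym (Fin.toℕ-inject₁ i)) (Fin.toℕ<n i))) = begin
            t (Fin.suc (Fin.inject₁ i)) ≈⟨ ×-congˡ (trans eq (ℕ.*-comm q n)) ⟩
            (n ℕ.* q) ⋆ _               ≈⟨ ×-assocˡ _ n q ⟨
            n ⋆ (q ⋆ _)                 ≈⟨ n×≈0 _ ⟩
            0# ∎

    ^-iterate-+ : ∀ f x y → (x + y) ^ (p ℕ.^ f) ≈ x ^ (p ℕ.^ f) + y ^ (p ℕ.^ f)
    ^-iterate-+ zero x y = ≈-trans (*-identityʳ _) (≈-sym (+-cong (*-identityʳ _) (*-identityʳ _)))
    ^-iterate-+ (suc f) x y = begin
      (x + y) ^ (p ℕ.* p ℕ.^ f)        ≈⟨ ^-assocʳ (x + y) p (p ℕ.^ f) ⟨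
      ((x + y) ^ p) ^ (p ℕ.^ f)        ≈⟨ ^-congˡ (p ℕ.^ f) (^-distrib-+ x y) ⟩
      (x ^ p + y ^ p) ^ (p ℕ.^ f)      ≈⟨ ^-iterate-+ f _ _ ⟩
      (x ^ p) ^ (p ℕ.^ f) + (y ^ p) ^ (p ℕ.^ f) ≈⟨ +-cong (^-assocʳ x p _) (^-assocʳ y p _) ⟩
      x ^ (p ℕ.* p ℕ.^ f) + y ^ (p ℕ.* p ℕ.^ f) ∎

module ℤSum where
  open Sum ℤ.+-*-semiring public
    using (sum; sum-cong-≗; ∑-distrib-+; *-distribˡ-sum; *-distribʳ-sum)

  kronecker : ℕ → ℕ → ℤ
  kronecker zero    zero    = 1ℤ
  kronecker zero    (suc n) = 0ℤ
  kronecker (suc m) zero    = 0ℤ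
  kronecker (suc m) (suc n) = kronecker m n

  sum-zero : ∀ n {f : Fin n → ℤ} → (∀ i → f i ≡ 0ℤ) → sum f ≡ 0ℤ
  sum-zero zero    f≡0 = refl
  sum-zero (suc n) f≡0 = cong₂ ℤ._+_ (f≡0 Fin.zero) (sum-zero n (f≡0 ∘ Fin.suc))

  sum-kronecker : ∀ {n a} (f : ℕ → ℤ) → a ℕ.< n →
                  sum {n} (λ c → f (toℕ c) ℤ.* kronecker (toℕ c) a) ≡ f a
  sum-kronecker {suc n} {zero} f _ = trans
    (cong₂ ℤ._+_ (ℤ.*-identityʳ (f 0)) (sum-zero n (λ i → ℤ.*-zeroʳ (f (suc (toℕ i))))))
    (ℤ.+-identityʳ (f 0))
  sum-kronecker {suc n} {suc a} f (s≤s a<n) = trans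
    (cong₂ ℤ._+_ (ℤ.*-zeroʳ (f 0)) (sum-kronecker (f ∘ suc) a<n))
    (ℤ.+-identityˡ (f (suc a)))

  mod-sum : ∀ {d n} {f g : Fin n → ℤ} → (∀ i → f i ≡ g i [mod d ]) → sum f ≡ sum g [mod d ]
  mod-sum {n = zero}  f≡g = mod-refl
  mod-sum {n = suc n} f≡g = mod-+ (f≡g Fin.zero) (mod-sum (f≡g ∘ Fin.suc))

  sum-kronecker-Fin : ∀ {n} (f : Fin n → ℤ) (a : Fin n) →
    sum (λ c → f c ℤ.* kronecker (toℕ a) (toℕ c)) ≡ f a
  sum-kronecker-Fin {suc n} f Fin.zero = trans
    (cong₂ ℤ._+_ (ℤ.*-identityʳ (f Fin.zero)) (sum-zero n (λ i → ℤ.*-zeroʳ (f (Fin.suc i)))))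
    (ℤ.+-identityʳ (f Fin.zero))
  sum-kronecker-Fin {suc n} f (Fin.suc a) = trans
    (cong₂ ℤ._+_ (ℤ.*-zeroʳ (f Fin.zero)) (sum-kronecker-Fin (f ∘ Fin.suc) a))
    (ℤ.+-identityˡ (f (Fin.suc a)))

  kronecker≤1 : ∀ m n → ∣ kronecker m n ∣ ℕ.≤ 1
  kronecker≤1 zero    zero    = ℕ.≤-refl
  kronecker≤1 zero    (suc n) = z≤n
  kronecker≤1 (suc m) zero    = z≤n
  kronecker≤1 (suc m) (suc n) = kronecker≤1 m n

-- A as a free abelian group on the monomials X^c Y^c′ with c, c′ < k

module Coordinates (k M M′ : ℕ) .{{_ : NonZero k}} where

  open ℤSum
  open RadicalRing k M M′
  open Twisted
  open import Data.Integer.Base using (_+_; _*_; _-_; -_; _^_)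

  -- The unique solution of both recurrences that agrees with s on [0, k) × [0, k).
  extend : Sequence → Sequence
  extend s i j = (+ M) ^ (i / k) * ((+ M′) ^ (j / k) * s (i % k) (j % k))

  private
    [i+k]/k≡1+i/k : ∀ i → (i ℕ.+ k) / k ≡ suc (i / k)
    [i+k]/k≡1+i/k i = trans (ℕ.+-distrib-/-∣ʳ i ℕ∣.∣-refl)
      (trans (cong (i / k ℕ.+_) (ℕ.n/n≡1 k)) (ℕ.+-comm (i / k) 1))

  extend-twisted : ∀ s → Twisted (extend s)
  extend-twisted s = record
    { stepX = λ i j → trans
        (cong₂ (λ a b → (+ M) ^ a * ((+ M′) ^ (j / k) * s b (j % k))) ([i+k]/k≡1+i/k i) (ℕ.[m+n]%n≡m%n i k))
        (ℤ.*-assoc (+ M) _ _)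
    ; stepY = λ i j → trans
        (cong₂ (λ a b → (+ M) ^ (i / k) * ((+ M′) ^ a * s (i % k) b)) ([i+k]/k≡1+i/k j) (ℕ.[m+n]%n≡m%n j k))
        (lemma ((+ M) ^ (i / k)) (+ M′) _ _) }
    where
    lemma : ∀ a b c d → a * (b * c * d) ≡ b * (a * (c * d))
    lemma = ℤSolver.solve-∀

  recurrence : ∀ m {t : ℕ → ℤ} → (∀ i → t (i ℕ.+ k) ≡ m * t i) →
               ∀ n r → t (r ℕ.+ n ℕ.* k) ≡ m ^ n * t r
  recurrence m {t} step zero r =
    trans (cong t (ℕ.+-identityʳ r)) (sym (ℤ.*-identityˡ (t r)))
  recurrence m {t} step (suc n) r = begin
    t (r ℕ.+ (k ℕ.+ n ℕ.* k))  ≡⟨ cong t (cong (r ℕ.+_) (ℕ.+-comm k (n ℕ.* k))) ⟩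
    t (r ℕ.+ (n ℕ.* k ℕ.+ k))  ≡⟨ cong t (ℕ.+-assoc r (n ℕ.* k) k) ⟨
    t (r ℕ.+ n ℕ.* k ℕ.+ k)    ≡⟨ step (r ℕ.+ n ℕ.* k) ⟩
    m * t (r ℕ.+ n ℕ.* k)      ≡⟨ cong (m *_) (recurrence m step n r) ⟩
    m * (m ^ n * t r)          ≡⟨ ℤ.*-assoc m (m ^ n) (t r) ⟨
    m ^ suc n * t r            ∎
    where open ≡-Reasoning

  twisted≡extend : ∀ {s} → Twisted s → ∀ i j → s i j ≡ extend s i j
  twisted≡extend {s} tw i j = begin
    s i j                                  ≡⟨ cong (λ i → s i j) (ℕ.m≡m%n+[m/n]*n i k) ⟩
    s (i % k ℕ.+ i / k ℕ.* k) j            ≡⟨ recurrence (+ M) {t = λ i → s i j} (λ i → stepX tw i j) (i / k) (i % k) ⟩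
    (+ M) ^ (i / k) * s (i % k) j            ≡⟨ cong (λ j → (+ M) ^ (i / k) * s (i % k) j) (ℕ.m≡m%n+[m/n]*n j k) ⟩
    (+ M) ^ (i / k) * s (i % k) (j % k ℕ.+ j / k ℕ.* k)
      ≡⟨ cong ((+ M) ^ (i / k) *_) (recurrence (+ M′) {t = s (i % k)} (stepY tw (i % k)) (j / k) (j % k)) ⟩
    extend s i j                           ∎
    where open ≡-Reasoning

  basis : Fin k → Fin k → Sequence
  basis c c′ = extend (λ i j → kronecker (toℕ c) i * kronecker (toℕ c′) j)

  basis-twisted : ∀ c c′ → Twisted (basis c c′)
  basis-twisted c c′ = extend-twisted (λ i j → kronecker (toℕ c) i * kronecker (toℕ c′) j)

  -- The coefficient of X^c Y^c′ in the reduced form of p: X^i Y^j sends a sequence to its value at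
  -- (i, j) when read off at (0, 0), and `basis c c′` is 1 at (c, c′) and 0 elsewhere in the square.
  coordinate : Poly → Fin k → Fin k → ℤ
  coordinate p c c′ = act p (basis c c′) 0 0

  extend≡sum : ∀ s i j →
    extend s i j ≡ sum (λ c → sum (λ c′ → s (toℕ c) (toℕ c′) * basis c c′ i j))
  extend≡sum s i j = sym (begin
    sum (λ c → sum (λ c′ → s (toℕ c) (toℕ c′) * (a * (b * (δ c * δ′ c′)))))
      ≡⟨ sum-cong-≗ (λ c → sum-cong-≗ λ c′ → lemma₁ (s (toℕ c) (toℕ c′)) a b (δ c) (δ′ c′)) ⟩
    sum (λ c → sum (λ c′ → (a * (b * δ c)) * (s (toℕ c) (toℕ c′) * δ′ c′)))
      ≡⟨ sum-cong-≗ (λ c → sym (*-distribˡ-sum (a * (b * δ c)) (λ c′ → s (toℕ c) (toℕ c′) * δ′ c′))) ⟩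
    sum (λ c → (a * (b * δ c)) * sum (λ c′ → s (toℕ c) (toℕ c′) * δ′ c′))
      ≡⟨ sum-cong-≗ (λ c → cong (a * (b * δ c) *_) (sum-kronecker (s (toℕ c)) (ℕ.m%n<n j k))) ⟩
    sum (λ c → (a * (b * δ c)) * s (toℕ c) (j % k))
      ≡⟨ sum-cong-≗ (λ c → lemma₂ a b (δ c) (s (toℕ c) (j % k))) ⟩
    sum (λ c → (a * b) * (s (toℕ c) (j % k) * δ c))
      ≡⟨ sym (*-distribˡ-sum (a * b) (λ c → s (toℕ c) (j % k) * δ c)) ⟩
    (a * b) * sum (λ c → s (toℕ c) (j % k) * δ c)
      ≡⟨ cong (a * b *_) (sum-kronecker (λ c → s c (j % k)) (ℕ.m%n<n i k)) ⟩
    (a * b) * s (i % k) (j % k)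
      ≡⟨ ℤ.*-assoc a b _ ⟩
    extend s i j ∎)
    where
    open ≡-Reasoning
    a = (+ M) ^ (i / k)
    b = (+ M′) ^ (j / k)
    δ δ′ : Fin k → ℤ
    δ c = kronecker (toℕ c) (i % k)
    δ′ c = kronecker (toℕ c) (j % k)
    lemma₁ : ∀ s a b d d′ → s * (a * (b * (d * d′))) ≡ (a * (b * d)) * (s * d′)
    lemma₁ = ℤSolver.solve-∀
    lemma₂ : ∀ a b d s → (a * (b * d)) * s ≡ (a * b) * (s * d)
    lemma₂ = ℤSolver.solve-∀

  act-zero : ∀ p i j → act p (λ _ _ → 0ℤ) i j ≡ 0ℤ
  act-zero p i j = act-* p 0ℤ (λ _ _ → 0ℤ) i j

  act-sum : ∀ {n} p (g : Fin n → ℤ) (t : Fin n → Sequence) i j →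
    act p (λ i j → sum (λ c → g c * t c i j)) i j ≡ sum (λ c → g c * act p (t c) i j)
  act-sum {zero}  p g t i j = act-zero p i j
  act-sum {suc n} p g t i j = trans
    (act-+ p _ _ i j)
    (cong₂ _+_ (act-* p (g Fin.zero) (t Fin.zero) i j)
               (act-sum p (g ∘ Fin.suc) (t ∘ Fin.suc) i j))

  act-sum′ : ∀ {n} p (t : Fin n → Sequence) i j →
    act p (λ i j → sum (λ c → t c i j)) i j ≡ sum (λ c → act p (t c) i j)
  act-sum′ {zero}  p t i j = act-zero p i j
  act-sum′ {suc n} p t i j = trans (act-+ p _ _ i j)
    (cong (_+_ (act p (t Fin.zero) i j)) (act-sum′ p (t ∘ Fin.suc) i j))

  shift : ℕ → ℕ → Sequence → Sequence
  shift a b s i j = s (i ℕ.+ a) (j ℕ.+ b)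

  act-shift : ∀ p a b s i j → act p (shift a b s) i j ≡ shift a b (act p s) i j
  act-shift (con c) a b s i j = refl
  act-shift X       a b s i j = refl
  act-shift Y       a b s i j = refl
  act-shift (p ⊞ q) a b s i j = cong₂ _+_ (act-shift p a b s i j) (act-shift q a b s i j)
  act-shift (p ⊠ q) a b s i j =
    trans (act-cong p (act-shift q a b s) i j) (act-shift p a b (act q s) i j)

  shift-twisted : ∀ a b {s} → Twisted s → Twisted (shift a b s)
  shift-twisted a b {s} tw = record
    { stepX = λ i j → trans (cong (λ n → s n (j ℕ.+ b)) (swap i a)) (stepX tw _ _)
    ; stepY = λ i j → trans (cong (s (i ℕ.+ a)) (swap j b)) (stepY tw _ _) }
    where
    swap : ∀ i a → i ℕ.+ k ℕ.+ a ≡ i ℕ.+ a ℕ.+ k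
    swap i a = trans (ℕ.+-assoc i k a) (trans (cong (i ℕ.+_) (ℕ.+-comm k a)) (sym (ℕ.+-assoc i a k)))

  -- In A, p is the combination of monomials given by its coordinates. Rather than reducing p, the
  -- shifted sequence is expanded in the `basis` sequences, and linearity of `act p` does the rest.
  act≡sum : ∀ p {s} → Twisted s → ∀ i j →
    act p s i j ≡ sum (λ c → sum (λ c′ → s (toℕ c ℕ.+ i) (toℕ c′ ℕ.+ j) * coordinate p c c′))
  act≡sum p {s} tw i j = begin
    act p s i j            ≡⟨ act-shift p i j s 0 0 ⟨
    act p (shift i j s) 0 0
      ≡⟨ act-cong p (λ a b → trans (twisted≡extend (shift-twisted i j tw) a b) (extend≡sum (shift i j s) a b)) 0 0 ⟩
    act p (λ a b → sum (λ c → sum (λ c′ → shift i j s (toℕ c) (toℕ c′) * basis c c′ a b))) 0 0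
      ≡⟨ act-sum′ p (λ c a b → sum (λ c′ → shift i j s (toℕ c) (toℕ c′) * basis c c′ a b)) 0 0 ⟩
    sum (λ c → act p (λ a b → sum (λ c′ → shift i j s (toℕ c) (toℕ c′) * basis c c′ a b)) 0 0)
      ≡⟨ sum-cong-≗ (λ c → act-sum p (λ c′ → shift i j s (toℕ c) (toℕ c′)) (basis c) 0 0) ⟩
    _ ∎
    where open ≡-Reasoning

  ≈-fromCoordinates : ∀ {d p q} → (∀ c c′ → coordinate p c c′ ≡ coordinate q c c′ [mod d ]) → p ≈ q [ d ]
  ≈-fromCoordinates {d} {p} {q} p≡q = equal λ {s} tw i j →
    mod-trans (mod-reflexive (act≡sum p tw i j)) (mod-trans
      (mod-sum λ c → mod-sum λ c′ → mod-* {x = s (toℕ c ℕ.+ i) (toℕ c′ ℕ.+ j)} mod-refl (p≡q c c′))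
      (mod-reflexive (sym (act≡sum q tw i j))))

  coordinate-cong : ∀ {d p q} → p ≈ q [ d ] → ∀ c c′ → coordinate p c c′ ≡ coordinate q c c′ [mod d ]
  coordinate-cong p≈q c c′ = agree p≈q (basis-twisted c c′) 0 0

  infixr 8 _^ᴾ_
  _^ᴾ_ : Poly → ℕ → Poly
  p ^ᴾ zero  = con 1ℤ
  p ^ᴾ suc n = p ⊠ p ^ᴾ n

  ⨁ : ∀ {n} → (Fin n → Poly) → Poly
  ⨁ {zero}  f = con 0ℤ
  ⨁ {suc n} f = f Fin.zero ⊞ ⨁ (f ∘ Fin.suc)

  term : (Fin k → Fin k → ℤ) → Fin k → Fin k → Poly
  term a c c′ = con (a c c′) ⊠ (X ^ᴾ toℕ c ⊠ Y ^ᴾ toℕ c′)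

  fromCoefficients : (Fin k → Fin k → ℤ) → Poly
  fromCoefficients a = ⨁ λ c → ⨁ (term a c)

  act-⨁ : ∀ {n} (f : Fin n → Poly) s i j → act (⨁ f) s i j ≡ sum (λ c → act (f c) s i j)
  act-⨁ {zero}  f s i j = refl
  act-⨁ {suc n} f s i j = cong (_+_ (act (f Fin.zero) s i j)) (act-⨁ (f ∘ Fin.suc) s i j)

  act-X^ : ∀ n s i j → act (X ^ᴾ n) s i j ≡ s (n ℕ.+ i) j
  act-X^ zero    s i j = ℤ.*-identityˡ (s i j)
  act-X^ (suc n) s i j = trans (act-X^ n s (suc i) j) (cong (λ m → s m j) (ℕ.+-suc n i))

  act-Y^ : ∀ n s i j → act (Y ^ᴾ n) s i j ≡ s i (n ℕ.+ j)
  act-Y^ zero    s i j = ℤ.*-identityˡ (s i j)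
  act-Y^ (suc n) s i j = trans (act-Y^ n s i (suc j)) (cong (s i) (ℕ.+-suc n j))

  act-fromCoefficients : ∀ a s i j → act (fromCoefficients a) s i j ≡
    sum (λ c → sum (λ c′ → a c c′ * s (toℕ c ℕ.+ i) (toℕ c′ ℕ.+ j)))
  act-fromCoefficients a s i j =
    trans (act-⨁ (λ c → ⨁ (term a c)) s i j) $ sum-cong-≗ λ c →
    trans (act-⨁ (term a c) s i j) $ sum-cong-≗ λ c′ →
    cong (a c c′ *_) (trans (act-X^ (toℕ c) (act (Y ^ᴾ toℕ c′) s) i j) (act-Y^ (toℕ c′) s (toℕ c ℕ.+ i) j))

  -- Freeness of A over ℤ: all coordinates of p are multiples of d, and the quotients are the
  -- coefficients of q.
  ≈-divide : ∀ {d p} → p ≈ con 0ℤ [ d ] → ∃[ q ] p ≈ con d ⊠ q [ 0ℤ ]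
  ≈-divide {d} {p} p≈0 = fromCoefficients a , equal λ {s} tw i j → mod-reflexive (begin
    act p s i j
      ≡⟨ act≡sum p tw i j ⟩
    sum (λ c → sum (λ c′ → s (toℕ c ℕ.+ i) (toℕ c′ ℕ.+ j) * coordinate p c c′))
      ≡⟨ sum-cong-≗ (λ c → sum-cong-≗ λ c′ → trans (cong (s (toℕ c ℕ.+ i) (toℕ c′ ℕ.+ j) *_) (ℤ∣._∣_.equality (d∣ c c′))) (lemma (s (toℕ c ℕ.+ i) (toℕ c′ ℕ.+ j)) (a c c′) d)) ⟩
    sum (λ c → sum (λ c′ → d * (a c c′ * s (toℕ c ℕ.+ i) (toℕ c′ ℕ.+ j))))
      ≡⟨ sum-cong-≗ (λ c → sym (*-distribˡ-sum d (λ c′ → a c c′ * s (toℕ c ℕ.+ i) (toℕ c′ ℕ.+ j)))) ⟩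
    sum (λ c → d * sum (λ c′ → a c c′ * s (toℕ c ℕ.+ i) (toℕ c′ ℕ.+ j)))
      ≡⟨ sym (*-distribˡ-sum d (λ c → sum (λ c′ → a c c′ * s (toℕ c ℕ.+ i) (toℕ c′ ℕ.+ j)))) ⟩
    d * sum (λ c → sum (λ c′ → a c c′ * s (toℕ c ℕ.+ i) (toℕ c′ ℕ.+ j)))
      ≡⟨ cong (d *_) (act-fromCoefficients a s i j) ⟨
    d * act (fromCoefficients a) s i j ∎)
    where
    open ≡-Reasoning
    d∣ : ∀ c c′ → d ℤ∣.∣ coordinate p c c′
    d∣ c c′ = mod-0⇒∣ (coordinate-cong p≈0 c c′)
    a : Fin k → Fin k → ℤ
    a c c′ = ℤ∣._∣_.quotient (d∣ c c′)
    lemma : ∀ s a d → s * (a * d) ≡ d * (a * s)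
    lemma = ℤSolver.solve-∀

-- Reducedness modulo p and zero divisors

module Reduced (k M M′ : ℕ) .{{_ : NonZero k}} {p : ℕ} (p-prime : Prime p)
               (p∤k : p ∤ k) (p∤M : p ∤ M) (p∤M′ : p ∤ M′) where

  open RadicalRing k M M′
  open Twisted
  open Coordinates k M M′

  con-^ : ∀ d c n → con c ^ᴾ n ≈ con (c ℤ.^ n) [ d ]
  con-^ d c zero    = exact λ s i j → refl
  con-^ d c (suc n) = equal λ {s} tw i j →
    mod-trans (mod-* {x = c} mod-refl (agree (con-^ d c n) tw i j))
              (mod-reflexive (sym (ℤ.*-assoc c (c ℤ.^ n) (s i j))))

  module _ (d : ℤ) where
    open CommutativeRing (ring d) using (semiring)
    open Exp semiring using (_^_)

    ^ᴾ≡^ : ∀ q n → q ^ᴾ n ≡ q ^ n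
    ^ᴾ≡^ q zero    = refl
    ^ᴾ≡^ q (suc n) = cong (q ⊠_) (^ᴾ≡^ q n)

  ⊠-^ : ∀ d q r n → (q ⊠ r) ^ᴾ n ≈ q ^ᴾ n ⊠ r ^ᴾ n [ d ]
  ⊠-^ d q r n rewrite ^ᴾ≡^ d (q ⊠ r) n | ^ᴾ≡^ d q n | ^ᴾ≡^ d r n =
    CommutativeExp.^-distrib-* (CommutativeRing.commutativeSemiring (ring d)) q r n

  private
    module R = CommutativeRing (ring (+ p))
  open R using (_≈_) renaming (setoid to R-setoid)
  open Exp R.semiring using (_^_; ^-homo-*; ^-assocʳ; ^-congˡ)
  open CommutativeExp R.commutativeSemiring using (^-distrib-*)
  open Mult R.+-monoid using () renaming (_×_ to _⋆_)
  open import Relation.Binary.Reasoning.Setoid R-setoid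
  open Frobenius (ring (+ p)) p-prime using (^-distrib-+; ^-iterate-+)

  ⋆-con : ∀ n q s i j → act (n ⋆ q) s i j ≡ + n ℤ.* act q s i j
  ⋆-con zero    q s i j = refl
  ⋆-con (suc n) q s i j = trans (cong (ℤ._+_ (act q s i j)) (⋆-con n q s i j))
    (sym (ℤ.suc-* (+ n) (act q s i j)))

  characteristic : ∀ q → p ⋆ q ≈ con 0ℤ
  characteristic q = equal λ {s} tw i j → mod-trans (mod-reflexive (⋆-con p q s i j))
    (∣⇒mod-0 (ℤ∣.∣m⇒∣m*n (act q s i j) ℤ∣.∣-refl))

  con-cong : ∀ {a b} → a ≡ b [mod + p ] → con a ≈ con b
  con-cong a≡b = equal λ {s} tw i j → mod-* {y = s i j} a≡b mod-refl

  private
    instance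
      p≢0 : NonZero p
      p≢0 = prime⇒nonZero p-prime

  1^ : ∀ n → con 1ℤ ^ n ≈ con 1ℤ
  1^ zero    = R.refl
  1^ (suc n) = R.trans (R.*-identityˡ _) (1^ n)

  module _ (n : ℕ) (n≢0 : NonZero n) (additive : ∀ x y → (x ⊞ y) ^ n ≈ x ^ n ⊞ y ^ n) where

    private
      0^ : ∀ {n} → NonZero n → con 0ℤ ^ n ≈ con 0ℤ
      0^ {suc n} _ = R.zeroˡ _

    -- A positive constant is a sum of ones, so any additive power map fixes it. The exponent is
    -- left open because n = p yields Fermat's theorem and n = L is needed for reducedness.
    pos-fixed : ∀ c → con (+ c) ^ n ≈ con (+ c)
    pos-fixed zero    = 0^ n≢0
    pos-fixed (suc c) = begin
      con (+ suc c) ^ n            ≈⟨ ^-congˡ n 1+c ⟩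
      (con 1ℤ ⊞ con (+ c)) ^ n     ≈⟨ additive (con 1ℤ) (con (+ c)) ⟩
      con 1ℤ ^ n ⊞ con (+ c) ^ n   ≈⟨ R.+-cong (1^ n) (pos-fixed c) ⟩
      con 1ℤ ⊞ con (+ c)           ≈⟨ R.sym 1+c ⟩
      con (+ suc c)                ∎
      where
      1+c : con (+ suc c) ≈ con 1ℤ ⊞ con (+ c)
      1+c = exact λ s i j → ℤ.*-distribʳ-+ (s i j) 1ℤ (+ c)

    con-fixed : ∀ c → con c ^ n ≈ con c
    con-fixed (+ c) = pos-fixed c
    con-fixed -[1+ c ] = R.trans (^-congˡ n -c) (R.trans (pos-fixed _) (R.sym -c))
      where
      -c : con -[1+ c ] ≈ con (+ (suc c ℕ.* ℕ.pred p))
      -c = con-cong (negative-mod c p)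

  mod-cancel-1 : ∀ a b {o} → o ≡ 1ℤ → a ℤ.* o ≡ b ℤ.* o [mod + p ] → a ≡ b [mod + p ]
  mod-cancel-1 a b {o} o≡1 eq = mod-trans (mod-reflexive (sym (identity a)))
    (mod-trans eq (mod-reflexive (identity b)))
    where
    identity : ∀ a → a ℤ.* o ≡ a
    identity a = trans (cong (a ℤ.*_) o≡1) (ℤ.*-identityʳ a)

  -- Fermat's little theorem, read off from Frobenius on constants. The sequence `one` has value 1
  -- at (0, 0), which turns the identity modulo p in the ring into a congruence of integers.
  fermat′ : ∀ m → (+ m) ℤ.^ p ≡ + m [mod + p ]
  fermat′ m = mod-cancel-1 ((+ m) ℤ.^ p) (+ m) one≡1
    (mod-trans (mod-sym (agree (con-^ (+ p) (+ m) p) one-twisted 0 0)) (agree fixed one-twisted 0 0))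
    where
    one : Sequence
    one = extend (λ _ _ → 1ℤ)
    one-twisted : Twisted one
    one-twisted = extend-twisted (λ _ _ → 1ℤ)
    one≡1 : one 0 0 ≡ 1ℤ
    one≡1 = cong (λ e → (+ M) ℤ.^ e ℤ.* ((+ M′) ℤ.^ e ℤ.* 1ℤ)) (ℕ.0/n≡0 k)
    fixed : con (+ m) ^ᴾ p ≈ con (+ m)
    fixed = R.trans (R.reflexive (^ᴾ≡^ (+ p) (con (+ m)) p))
      (con-fixed p p≢0 (^-distrib-+ characteristic) (+ m))

  fermat : ∀ {m} → p ∤ m → (+ m) ℤ.^ ℕ.pred p ≡ 1ℤ [mod + p ]
  fermat {m} p∤m = [ (λ p∣m → contradiction (ℤ∣.∣⇒∣ᵤ p∣m) p∤m) , mod-diff ]′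
    (euclidsLemmaℤ (+ m) (m^[p-1] ℤ.- 1ℤ) p-prime
      (subst (+ p ℤ∣.∣_) (lemma (+ m) m^[p-1])
        (difference {m^[p-1]′} (subst (λ x → x ≡ + m [mod + p ]) (cong ((+ m) ℤ.^_) (sym (ℕ.suc-pred p))) (fermat′ m)))))
    where
    m^[p-1] m^[p-1]′ : ℤ
    m^[p-1] = (+ m) ℤ.^ ℕ.pred p
    m^[p-1]′ = (+ m) ℤ.^ suc (ℕ.pred p)
    lemma : ∀ a b → a ℤ.* b ℤ.- a ≡ a ℤ.* (b ℤ.- 1ℤ)
    lemma = ℤSolver.solve-∀

  private
    w = k ℕ.* ℕ.pred p

    2≤p : 2 ℕ.≤ p
    2≤p = prime⇒2≤ p-prime

    instance
      pred-p≢0 : NonZero (ℕ.pred p)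
      pred-p≢0 = ℕ.>-nonZero (ℕ.pred-mono-≤ 2≤p)

      w≢0 : NonZero w
      w≢0 = ℕ.m*n≢0 k (ℕ.pred p)

    w⊥p : Coprime w p
    w⊥p = prime∤⇒coprime p-prime λ p∣w →
      [ p∤k , ℕ∣.>⇒∤ (ℕ.≤-reflexive (ℕ.suc-pred p)) ]′ (euclidsLemma k (ℕ.pred p) p-prime p∣w)

    exponent : ∃[ f ] ∃[ t ] p ℕ.^ suc f ≡ 1 ℕ.+ t ℕ.* w
    exponent = coprime⇒^≡1 w w⊥p

    f = proj₁ exponent
    t = proj₁ (proj₂ exponent)
    L = p ℕ.^ suc f

    L≡ : L ≡ suc (k ℕ.* (ℕ.pred p ℕ.* t))
    L≡ = trans (proj₂ (proj₂ exponent)) (cong suc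
      (trans (ℕ.*-comm t w) (ℕ.*-assoc k (ℕ.pred p) t)))

    -- x^(L-1) = (x^k)^((p-1)t) = (m^(p-1))^t, which is 1 modulo p by Fermat. This is where p ∤ M
    -- and p ∤ M′ enter.
    generator-fixed : ∀ {x m} → p ∤ m → x ^ᴾ k ≈ con (+ m) → x ^ L ≈ x
    generator-fixed {x} {m} p∤m x^k≈m = begin
      x ^ L                            ≡⟨ cong (x ^_) L≡ ⟩
      x ⊠ x ^ (k ℕ.* (ℕ.pred p ℕ.* t)) ≈⟨ R.*-congˡ {x} (^-assocʳ x k _) ⟨
      x ⊠ (x ^ k) ^ (ℕ.pred p ℕ.* t)   ≡⟨ cong (λ y → x ⊠ y ^ (ℕ.pred p ℕ.* t)) (sym (^ᴾ≡^ (+ p) x k)) ⟩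
      x ⊠ (x ^ᴾ k) ^ (ℕ.pred p ℕ.* t)  ≈⟨ R.*-congˡ {x} (^-congˡ (ℕ.pred p ℕ.* t) x^k≈m) ⟩
      x ⊠ con (+ m) ^ (ℕ.pred p ℕ.* t) ≈⟨ R.*-congˡ {x} (^-assocʳ (con (+ m)) (ℕ.pred p) t) ⟨
      x ⊠ (con (+ m) ^ ℕ.pred p) ^ t   ≈⟨ R.*-congˡ {x} (^-congˡ t m^[p-1]≈1) ⟩
      x ⊠ con 1ℤ ^ t                   ≈⟨ R.*-congˡ {x} (1^ t) ⟩
      x ⊠ con 1ℤ                       ≈⟨ R.*-identityʳ x ⟩
      x                                ∎
      where
      m^[p-1]≈1 : con (+ m) ^ ℕ.pred p ≈ con 1ℤ
      m^[p-1]≈1 = R.trans (R.reflexive (sym (^ᴾ≡^ (+ p) (con (+ m)) (ℕ.pred p))))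
        (R.trans (con-^ (+ p) (+ m) (ℕ.pred p)) (con-cong (fermat p∤m)))

  X^k≈M : ∀ {d} → X ^ᴾ k ≈ con (+ M) [ d ]
  X^k≈M = equal λ {s} tw i j → mod-reflexive
    (trans (act-X^ k s i j) (trans (cong (λ n → s n j) (ℕ.+-comm k i)) (stepX tw i j)))

  Y^k≈M′ : ∀ {d} → Y ^ᴾ k ≈ con (+ M′) [ d ]
  Y^k≈M′ = equal λ {s} tw i j → mod-reflexive
    (trans (act-Y^ k s i j) (trans (cong (s i) (ℕ.+-comm k j)) (stepY tw i j)))

  private
    L-fixed : ∀ q → q ^ L ≈ q
    L-fixed (con c) = con-fixed L (ℕ.m^n≢0 p (suc f)) (^-iterate-+ characteristic (suc f)) c
    L-fixed X = generator-fixed p∤M X^k≈M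
    L-fixed Y = generator-fixed p∤M′ Y^k≈M′
    L-fixed (q ⊞ r) = R.trans (^-iterate-+ characteristic (suc f) q r) (R.+-cong (L-fixed q) (L-fixed r))
    L-fixed (q ⊠ r) = R.trans (^-distrib-* q r L) (R.*-cong (L-fixed q) (L-fixed r))

    -- Allows q^k to be split off from q^L. The case t = 0 would mean p^(f+1) = 1.
    k≤L : k ℕ.≤ L
    k≤L with t | proj₂ (proj₂ exponent)
    ... | zero  | L≡1 = contradiction (ℕ.m^n≡1⇒n≡0∨m≡1 p (suc f) L≡1)
                          λ { (inj₂ refl) → ℕ.<-irrefl refl 2≤p }
    ... | suc t | L≡′ = ℕ.≤-trans (ℕ.m≤m*n k (ℕ.pred p))
        (ℕ.≤-trans (ℕ.m≤m+n w (t ℕ.* w)) (ℕ.≤-trans (ℕ.n≤1+n _) (ℕ.≤-reflexive (sym L≡′))))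

  -- q ↦ q^p is additive modulo p, so q ↦ q^L is a ring endomorphism for
  -- L = p^(f+1).  As k(p-1) divides L-1, it fixes the generators.
  reduced : ∀ q → q ^ᴾ k ≈ con 0ℤ [ + p ] → q ≈ con 0ℤ [ + p ]
  reduced q q^k≈0 = begin
    q                        ≈⟨ R.sym (L-fixed q) ⟩
    q ^ L                    ≡⟨ cong (q ^_) (sym (ℕ.m+[n∸m]≡n k≤L)) ⟩
    q ^ (k ℕ.+ (L ℕ.∸ k))    ≈⟨ ^-homo-* q k (L ℕ.∸ k) ⟩
    q ^ k ⊠ q ^ (L ℕ.∸ k)    ≡⟨ cong (_⊠ q ^ (L ℕ.∸ k)) (sym (^ᴾ≡^ (+ p) q k)) ⟩
    q ^ᴾ k ⊠ q ^ (L ℕ.∸ k)   ≈⟨ R.*-congʳ {q ^ (L ℕ.∸ k)} q^k≈0 ⟩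
    con 0ℤ ⊠ q ^ (L ℕ.∸ k)   ≈⟨ R.zeroˡ (q ^ (L ℕ.∸ k)) ⟩
    con 0ℤ                   ∎

^-divides-all⇒≡0 : ∀ {p} x → 2 ℕ.≤ p → (∀ n → + (p ℕ.^ n) ℤ∣.∣ x) → x ≡ 0ℤ
^-divides-all⇒≡0 {p} x 2≤p p^n∣x with ∣ x ∣ in eq
... | zero  = ℤ.∣i∣≡0⇒i≡0 eq
... | suc n = contradiction (subst (p ℕ.^ suc n ∣_) eq (ℤ∣.∣⇒∣ᵤ (p^n∣x (suc n))))
                (ℕ∣.>⇒∤ (n<m^n (suc n) 2≤p))

module NonZeroDivisor (k M M′ : ℕ) .{{_ : NonZero k}} {p : ℕ} (p-prime : Prime p)
                      (p∤k : p ∤ k) (p∤M : p ∤ M) (p∤M′ : p ∤ M′) where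

  open RadicalRing k M M′
  open Coordinates k M M′
  open Reduced k M M′ p-prime p∤k p∤M p∤M′
  open import Data.Integer.Base using (_*_; _^_; _+_; _-_; -_)

  IsNonZeroDivisor : Poly → Set
  IsNonZeroDivisor q = ∀ a → q ⊠ a ≈ con 0ℤ [ 0ℤ ] → a ≈ con 0ℤ [ 0ℤ ]

  ^ᴾ-cong : ∀ {d q r} n → q ≈ r [ d ] → q ^ᴾ n ≈ r ^ᴾ n [ d ]
  ^ᴾ-cong zero    q≈r = exact λ s i j → refl
  ^ᴾ-cong {d} (suc n) q≈r = CommutativeRing.*-cong (ring d) q≈r (^ᴾ-cong n q≈r)

  private
    P : ℤ
    P = + p

    P^≢0 : ∀ n → ℤ.NonZero (P ^ n)
    P^≢0 n = subst ℤ.NonZero (pos-^ p n) (ℕ.m^n≢0 p n {{prime⇒nonZero p-prime}})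

  multiple-^ : ∀ {d q q′} → q ≈ con d ⊠ q′ [ 0ℤ ] → ∀ {s} → Twisted s → ∀ i j →
               act (q ^ᴾ k) s i j ≡ d ^ k * act (q′ ^ᴾ k) s i j
  multiple-^ {d} {q} {q′} q≈dq′ {s} tw i j = trans
    (mod-0⇒≡ (agree (^ᴾ-cong k q≈dq′) tw i j)) (trans
    (mod-0⇒≡ (agree (⊠-^ 0ℤ (con d) q′ k) tw i j))
    (mod-0⇒≡ (agree (con-^ 0ℤ d k) (act-twisted (q′ ^ᴾ k) tw) i j)))

  module _ {c₁ c₂ : ℤ} (p∤c₁ : ¬ P ℤ∣.∣ c₁) (p∤c₂ : ¬ P ℤ∣.∣ c₂) {e : ℕ} (0<e : 0 ℕ.< e) (e<k : e ℕ.< k) where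

    Solution : Poly → Poly → Set
    Solution q r = ∀ {s} → Twisted s → ∀ i j →
      c₁ * (P ^ e * act (q ^ᴾ k) s i j) ≡ c₂ * act (r ^ᴾ k) s i j

    private
      g : ℕ
      g = k ℕ.∸ e

      P∣P^ : ∀ {n} → 0 ℕ.< n → P ℤ∣.∣ P ^ n
      P∣P^ {suc n} _ = ℤ∣.∣m⇒∣m*n (P ^ n) ℤ∣.∣-refl

      P^k≡ : P ^ k ≡ P ^ e * P ^ g
      P^k≡ = trans (cong (P ^_) (sym (ℕ.m+[n∸m]≡n (ℕ.<⇒≤ e<k)))) (ℤ.^-distribˡ-+-* P e g)

      prime-part : ∀ {c} → ¬ P ℤ∣.∣ c → ∀ q → (∀ {s} → Twisted s → ∀ i j → P ℤ∣.∣ c * act (q ^ᴾ k) s i j) →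
                   ∃[ q′ ] q ≈ con P ⊠ q′ [ 0ℤ ]
      prime-part {c} p∤c q p∣ = ≈-divide (reduced q (equal λ {s} tw i j →
        ∣⇒mod-0 ([ (λ p∣c → contradiction p∣c p∤c) , (λ p∣a → p∣a) ]′
          (euclidsLemmaℤ c (act (q ^ᴾ k) s i j) p-prime (p∣ tw i j)))))

    -- Reducedness is used once for each unknown. From p ∣ c₂ r^k, where e > 0, comes r = p r′;
    -- cancelling p^e leaves the factor p^(k-e) on the right, where e < k, so q = p q′; cancelling
    -- p^(k-e) restores the exponent e on the left.
    descend : ∀ {q r} → Solution q r →
              ∃[ q′ ] ∃[ r′ ] q ≈ con P ⊠ q′ [ 0ℤ ] × r ≈ con P ⊠ r′ [ 0ℤ ] × Solution q′ r′
    descend {q} {r} eq = q′ , r′ , q≈ , r≈ , eq″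
      where
      lemma : ∀ a b c d → a * (b * (c * d)) ≡ c * (a * (b * d))
      lemma = ℤSolver.solve-∀
      lemma′ : ∀ a b c d → a * (b * c * d) ≡ b * (a * (c * d))
      lemma′ = ℤSolver.solve-∀
      lemma″ : ∀ a b c d → a * (b * c * d) ≡ c * (a * (b * d))
      lemma″ = ℤSolver.solve-∀

      r-part = prime-part p∤c₂ r λ {s} tw i j → subst (P ℤ∣.∣_) (eq tw i j)
        (ℤ∣.∣n⇒∣m*n c₁ (ℤ∣.∣m⇒∣m*n (act (q ^ᴾ k) s i j) (P∣P^ 0<e)))
      r′ = proj₁ r-part
      r≈ = proj₂ r-part

      eq′ : ∀ {s} → Twisted s → ∀ i j → c₁ * act (q ^ᴾ k) s i j ≡ c₂ * (P ^ g * act (r′ ^ᴾ k) s i j)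
      eq′ {s} tw i j = ℤ.*-cancelˡ-≡ (P ^ e) (c₁ * act (q ^ᴾ k) s i j) (c₂ * (P ^ g * act (r′ ^ᴾ k) s i j)) {{P^≢0 e}} (begin
        P ^ e * (c₁ * a)              ≡⟨ swap (P ^ e) c₁ a ⟩
        c₁ * (P ^ e * a)              ≡⟨ eq tw i j ⟩
        c₂ * act (r ^ᴾ k) s i j       ≡⟨ cong (c₂ *_) (multiple-^ r≈ tw i j) ⟩
        c₂ * (P ^ k * b)              ≡⟨ cong (λ x → c₂ * (x * b)) P^k≡ ⟩
        c₂ * (P ^ e * P ^ g * b)      ≡⟨ lemma′ c₂ (P ^ e) (P ^ g) b ⟩
        P ^ e * (c₂ * (P ^ g * b))    ∎)
        where
        open ≡.≡-Reasoning
        a = act (q ^ᴾ k) s i j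
        b = act (r′ ^ᴾ k) s i j
        swap : ∀ a b c → a * (b * c) ≡ b * (a * c)
        swap = ℤSolver.solve-∀

      q-part = prime-part p∤c₁ q λ {s} tw i j → subst (P ℤ∣.∣_) (sym (eq′ tw i j))
        (ℤ∣.∣n⇒∣m*n c₂ (ℤ∣.∣m⇒∣m*n (act (r′ ^ᴾ k) s i j) (P∣P^ (ℕ.m<n⇒0<n∸m e<k))))
      q′ = proj₁ q-part
      q≈ = proj₂ q-part

      eq″ : Solution q′ r′
      eq″ {s} tw i j = ℤ.*-cancelˡ-≡ (P ^ g) (c₁ * (P ^ e * act (q′ ^ᴾ k) s i j)) (c₂ * act (r′ ^ᴾ k) s i j) {{P^≢0 g}} (begin
        P ^ g * (c₁ * (P ^ e * a))   ≡⟨ lemma″ c₁ (P ^ e) (P ^ g) a ⟨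
        c₁ * (P ^ e * P ^ g * a)     ≡⟨ cong (λ x → c₁ * (x * a)) P^k≡ ⟨
        c₁ * (P ^ k * a)             ≡⟨ cong (c₁ *_) (multiple-^ q≈ tw i j) ⟨
        c₁ * act (q ^ᴾ k) s i j      ≡⟨ eq′ tw i j ⟩
        c₂ * (P ^ g * b)             ≡⟨ swap c₂ (P ^ g) b ⟩
        P ^ g * (c₂ * b)             ∎)
        where
        open ≡.≡-Reasoning
        a = act (q′ ^ᴾ k) s i j
        b = act (r′ ^ᴾ k) s i j
        swap : ∀ a b c → a * (b * c) ≡ b * (a * c)
        swap = ℤSolver.solve-∀

    solution-divisible : ∀ n {q r} → Solution q r →
                         q ≈ con 0ℤ [ + (p ℕ.^ n) ] × r ≈ con 0ℤ [ + (p ℕ.^ n) ]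
    solution-divisible zero {q} {r} eq = trivial q , trivial r
      where
      trivial : ∀ q → q ≈ con 0ℤ [ 1ℤ ]
      trivial q = equal λ {s} tw i j → ∣⇒mod-0 {1ℤ} {act q s i j} (divides (act q s i j) (sym (ℤ.*-identityʳ (act q s i j))))
    solution-divisible (suc n) {q} {r} eq = lift (descend eq)
      where
      lift : ∃[ q′ ] ∃[ r′ ] q ≈ con P ⊠ q′ [ 0ℤ ] × r ≈ con P ⊠ r′ [ 0ℤ ] × Solution q′ r′ →
             q ≈ con 0ℤ [ + (p ℕ.^ suc n) ] × r ≈ con 0ℤ [ + (p ℕ.^ suc n) ]
      lift (q′ , r′ , q≈ , r≈ , eq′) =
        multiply q≈ (proj₁ (solution-divisible n eq′)) , multiply r≈ (proj₂ (solution-divisible n eq′))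
        where
        multiply : ∀ {q q′} → q ≈ con P ⊠ q′ [ 0ℤ ] → q′ ≈ con 0ℤ [ + (p ℕ.^ n) ] → q ≈ con 0ℤ [ + (p ℕ.^ suc n) ]
        multiply {q} {q′} q≈ q′≈0 = equal λ {s} tw i j → ∣⇒mod-0 {+ (p ℕ.^ suc n)} {act q s i j}
          (multiple-∣ (act q′ s i j) (act q s i j) (mod-0⇒≡ (agree q≈ tw i j)) (mod-0⇒∣ (agree q′≈0 tw i j)))
          where
          multiple-∣ : ∀ x y → y ≡ P * x → + (p ℕ.^ n) ℤ∣.∣ x → + (p ℕ.^ suc n) ℤ∣.∣ y
          multiple-∣ x y y≡Px (divides t x≡) = divides t (trans y≡Px (trans (cong (P *_) x≡)
            (trans (swap P t (+ (p ℕ.^ n))) (cong (t *_) (sym (ℤ.pos-* p (p ℕ.^ n)))))))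
            where
            swap : ∀ a b c → a * (b * c) ≡ b * (a * c)
            swap = ℤSolver.solve-∀

    -- Vanishing in A is tested on integers, and an integer divisible by every p^n is 0.
    solution-trivial : ∀ {q r} → Solution q r → q ≈ con 0ℤ [ 0ℤ ] × r ≈ con 0ℤ [ 0ℤ ]
    solution-trivial eq = vanish (λ n → proj₁ (solution-divisible n eq)) , vanish (λ n → proj₂ (solution-divisible n eq))
      where
      vanish : ∀ {q} → (∀ n → q ≈ con 0ℤ [ + (p ℕ.^ n) ]) → q ≈ con 0ℤ [ 0ℤ ]
      vanish {q} q≈0 = equal λ {s} tw i j → mod-reflexive
        (^-divides-all⇒≡0 (act q s i j) (prime⇒2≤ p-prime) λ n → mod-0⇒∣ (agree (q≈0 n) tw i j))

    -- If y a = 0 then y a^k = 0, because k ≥ 1, and this is the equation of the descent for the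
    -- unknowns U a and W a. Both vanish, so it suffices that one of U and W can be cancelled.
    difference-nonZeroDivisor : ∀ U W → IsNonZeroDivisor U ⊎ IsNonZeroDivisor W →
      IsNonZeroDivisor (con (c₁ * P ^ e) ⊠ U ^ᴾ k ⊞ con (- c₂) ⊠ W ^ᴾ k)
    difference-nonZeroDivisor U W nzd a ya≈0 =
      [ (λ nzdU → nzdU a (proj₁ (solution-trivial solution)))
      , (λ nzdW → nzdW a (proj₂ (solution-trivial solution))) ]′ nzd
      where
      y = con (c₁ * P ^ e) ⊠ U ^ᴾ k ⊞ con (- c₂) ⊠ W ^ᴾ k

      ya^k≈0 : ∀ n .{{_ : NonZero n}} {s} → Twisted s → ∀ i j → act (y ⊠ a ^ᴾ n) s i j ≡ 0ℤ
      ya^k≈0 (suc n) tw i j = mod-0⇒≡ (agree ya≈0 (act-twisted (a ^ᴾ n) tw) i j)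

      solution : Solution (U ⊠ a) (W ⊠ a)
      solution {s} tw i j = ℤ.i-j≡0⇒i≡j (c₁ * (P ^ e * act ((U ⊠ a) ^ᴾ k) s i j)) (c₂ * act ((W ⊠ a) ^ᴾ k) s i j) (begin
        c₁ * (P ^ e * act ((U ⊠ a) ^ᴾ k) s i j) - c₂ * act ((W ⊠ a) ^ᴾ k) s i j
          ≡⟨ cong₂ (λ u w → c₁ * (P ^ e * u) - c₂ * w)
               (mod-0⇒≡ (agree (⊠-^ 0ℤ U a k) tw i j)) (mod-0⇒≡ (agree (⊠-^ 0ℤ W a k) tw i j)) ⟩
        c₁ * (P ^ e * act (U ^ᴾ k ⊠ a ^ᴾ k) s i j) - c₂ * act (W ^ᴾ k ⊠ a ^ᴾ k) s i j
          ≡⟨ lemma c₁ (P ^ e) (act (U ^ᴾ k ⊠ a ^ᴾ k) s i j) c₂ (act (W ^ᴾ k ⊠ a ^ᴾ k) s i j) ⟩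
        act (y ⊠ a ^ᴾ k) s i j
          ≡⟨ ya^k≈0 k tw i j ⟩
        0ℤ ∎)
        where
        open ≡.≡-Reasoning
        lemma : ∀ a b x c y → a * (b * x) - c * y ≡ a * b * x + - c * y
        lemma = ℤSolver.solve-∀

abs-^ : ∀ x n → ∣ x ℤ.^ n ∣ ≡ ∣ x ∣ ℕ.^ n
abs-^ x zero    = refl
abs-^ x (suc n) = trans (ℤ.abs-* x (x ℤ.^ n)) (cong (∣ x ∣ ℕ.*_) (abs-^ x n))

-- The index of a principal ideal

module Evaluation (k M M′ : ℕ) .{{_ : NonZero k}} where

  open RadicalRing k M M′
  open Coordinates k M M′
  open import Data.Integer.Base using (_*_; _^_; _+_; _-_; -_)

  eval : Poly → ℤ → ℤ → ℤ
  eval (con c) x y = c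
  eval X       x y = x
  eval Y       x y = y
  eval (p ⊞ q) x y = eval p x y + eval q x y
  eval (p ⊠ q) x y = eval p x y * eval q x y

  eval-^ : ∀ p n x y → eval (p ^ᴾ n) x y ≡ eval p x y ^ n
  eval-^ p zero    x y = refl
  eval-^ p (suc n) x y = cong (eval p x y *_) (eval-^ p n x y)

  powers : ℤ → ℤ → Sequence
  powers x y i j = x ^ i * y ^ j

  -- The sequence x^i y^j is a common eigenvector of the two shifts, with eigenvalues x and y.
  act-powers : ∀ p x y i j → act p (powers x y) i j ≡ eval p x y * powers x y i j
  act-powers (con c) x y i j = refl
  act-powers X       x y i j = ℤ.*-assoc x (x ^ i) (y ^ j)
  act-powers Y       x y i j = lemma (x ^ i) y (y ^ j)
    where
    lemma : ∀ a b c → a * (b * c) ≡ b * (a * c)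
    lemma = ℤSolver.solve-∀
  act-powers (p ⊞ q) x y i j =
    trans (cong₂ _+_ (act-powers p x y i j) (act-powers q x y i j)) (sym (ℤ.*-distribʳ-+ _ (eval p x y) _))
  act-powers (p ⊠ q) x y i j = begin
    act p (act q (powers x y)) i j                      ≡⟨ act-cong p (act-powers q x y) i j ⟩
    act p (λ i j → eval q x y * powers x y i j) i j     ≡⟨ act-* p (eval q x y) (powers x y) i j ⟩
    eval q x y * act p (powers x y) i j                 ≡⟨ cong (eval q x y *_) (act-powers p x y i j) ⟩
    eval q x y * (eval p x y * powers x y i j)          ≡⟨ lemma (eval q x y) (eval p x y) _ ⟩
    eval p x y * eval q x y * powers x y i j            ∎
    where
    open ≡.≡-Reasoning
    lemma : ∀ a b c → a * (b * c) ≡ b * a * c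
    lemma = ℤSolver.solve-∀

  module _ {d x y : ℤ} (x^k≡M : x ^ k ≡ + M [mod d ]) (y^k≡M′ : y ^ k ≡ + M′ [mod d ]) where

    private
      power≡ : ∀ z m → z ^ k ≡ + m [mod d ] → ∀ i → (+ m) ^ (i / k) * z ^ (i % k) ≡ z ^ i [mod d ]
      power≡ z m z^k≡m i = mod-trans
        (mod-* {y = z ^ (i % k)} (mod-sym (mod-^ (i / k) z^k≡m)) mod-refl)
        (mod-reflexive (begin
          (z ^ k) ^ (i / k) * z ^ (i % k)       ≡⟨ cong (_* z ^ (i % k)) (ℤ.^-*-assoc z k (i / k)) ⟩
          z ^ (k ℕ.* (i / k)) * z ^ (i % k)     ≡⟨ ℤ.^-distribˡ-+-* z (k ℕ.* (i / k)) (i % k) ⟨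
          z ^ (k ℕ.* (i / k) ℕ.+ i % k)         ≡⟨ cong (z ^_) (sym (trans (ℕ.m≡m%n+[m/n]*n i k)
                                                     (trans (ℕ.+-comm (i % k) _) (cong (ℕ._+ i % k) (ℕ.*-comm (i / k) k))))) ⟩
          z ^ i ∎))
        where open ≡.≡-Reasoning

    extend-powers : ∀ i j → extend (powers x y) i j ≡ powers x y i j [mod d ]
    extend-powers i j = mod-trans
      (mod-reflexive (lemma ((+ M) ^ (i / k)) ((+ M′) ^ (j / k)) (x ^ (i % k)) (y ^ (j % k))))
      (mod-* (power≡ x M x^k≡M i) (power≡ y M′ y^k≡M′ j))
      where
      lemma : ∀ a b c e → a * (b * (c * e)) ≡ (a * c) * (b * e)
      lemma = ℤSolver.solve-∀

    private
      act-extend : ∀ p → act p (extend (powers x y)) 0 0 ≡ eval p x y [mod d ]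
      act-extend p = mod-trans (act-mod p extend-powers 0 0)
        (mod-reflexive (trans (act-powers p x y 0 0) (ℤ.*-identityʳ _)))

    -- Evaluation at (x, y) is a homomorphism from A to ℤ/d. Since x^i y^j satisfies the recurrences
    -- only modulo d, it is replaced by the congruent sequence `extend (powers x y)`, which
    -- satisfies them over ℤ.
    eval-cong : ∀ {p q} → p ≈ q [ 0ℤ ] → eval p x y ≡ eval q x y [mod d ]
    eval-cong {p} {q} p≈q = mod-trans (mod-sym (act-extend p))
      (mod-trans (mod-reflexive (mod-0⇒≡ (agree p≈q (extend-twisted (powers x y)) 0 0))) (act-extend q))

module Norm (k M M′ : ℕ) .{{_ : NonZero k}} (B : ℕ) .{{_ : NonZero B}} (M≤B : M ℕ.≤ B) (M′≤B : M′ ℕ.≤ B) where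

  open RadicalRing k M M′
  open Coordinates k M M′
  open ℤSum
  open import Data.Nat.Base using (_*_; _^_; _+_; _≤_)

  -- Controls growth: a sequence bounded by C B^(i+j) is mapped to one bounded by ‖p‖ C B^(i+j). It
  -- is multiplicative by definition and yet dominates every coordinate, because the `basis`
  -- sequences are bounded by B^(i+j).
  ‖_‖ : Poly → ℕ
  ‖ con c ‖ = ∣ c ∣
  ‖ X ‖     = B
  ‖ Y ‖     = B
  ‖ p ⊞ q ‖ = ‖ p ‖ + ‖ q ‖
  ‖ p ⊠ q ‖ = ‖ p ‖ * ‖ q ‖

  Bounded : ℕ → Sequence → Set
  Bounded C s = ∀ i j → ∣ s i j ∣ ≤ C * B ^ (i + j)

  act-bounded : ∀ p {C s} → Bounded C s → Bounded (‖ p ‖ * C) (act p s)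
  act-bounded (con c) {C} {s} s≤ i j = begin
    ∣ c ℤ.* s i j ∣             ≡⟨ ℤ.abs-* c (s i j) ⟩
    ∣ c ∣ * ∣ s i j ∣           ≤⟨ ℕ.*-monoʳ-≤ ∣ c ∣ (s≤ i j) ⟩
    ∣ c ∣ * (C * B ^ (i + j))   ≡⟨ ℕ.*-assoc ∣ c ∣ C _ ⟨
    ∣ c ∣ * C * B ^ (i + j)     ∎
    where open ℕ.≤-Reasoning
  act-bounded X {C} {s} s≤ i j = begin
    ∣ s (suc i) j ∣             ≤⟨ s≤ (suc i) j ⟩
    C * (B * B ^ (i + j))       ≡⟨ lemma C B (B ^ (i + j)) ⟩
    B * C * B ^ (i + j)         ∎
    where
    open ℕ.≤-Reasoning
    lemma : ∀ a b c → a * (b * c) ≡ b * a * c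
    lemma = ℕSolver.solve-∀
  act-bounded Y {C} {s} s≤ i j = begin
    ∣ s i (suc j) ∣             ≤⟨ s≤ i (suc j) ⟩
    C * B ^ (i + suc j)         ≡⟨ cong (λ n → C * B ^ n) (ℕ.+-suc i j) ⟩
    C * (B * B ^ (i + j))       ≡⟨ lemma C B (B ^ (i + j)) ⟩
    B * C * B ^ (i + j)         ∎
    where
    open ℕ.≤-Reasoning
    lemma : ∀ a b c → a * (b * c) ≡ b * a * c
    lemma = ℕSolver.solve-∀
  act-bounded (p ⊞ q) {C} {s} s≤ i j = begin
    ∣ act p s i j ℤ.+ act q s i j ∣          ≤⟨ ℤ.∣i+j∣≤∣i∣+∣j∣ (act p s i j) _ ⟩
    ∣ act p s i j ∣ + ∣ act q s i j ∣        ≤⟨ ℕ.+-mono-≤ (act-bounded p s≤ i j) (act-bounded q s≤ i j) ⟩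
    ‖ p ‖ * C * b + ‖ q ‖ * C * b            ≡⟨ lemma ‖ p ‖ ‖ q ‖ C b ⟩
    (‖ p ‖ + ‖ q ‖) * C * b                  ∎
    where
    open ℕ.≤-Reasoning
    b = B ^ (i + j)
    lemma : ∀ p q c b → p * c * b + q * c * b ≡ (p + q) * c * b
    lemma = ℕSolver.solve-∀
  act-bounded (p ⊠ q) {C} s≤ i j = ℕ.≤-trans (act-bounded p (act-bounded q s≤) i j)
    (ℕ.≤-reflexive (cong (_* B ^ (i + j)) (sym (ℕ.*-assoc ‖ p ‖ ‖ q ‖ C))))

  basis-bounded : ∀ c c′ → Bounded 1 (basis c c′)
  basis-bounded c c′ i j = begin
    ∣ (+ M) ℤ.^ (i / k) ℤ.* ((+ M′) ℤ.^ (j / k) ℤ.* (δ ℤ.* δ′)) ∣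
      ≡⟨ trans (ℤ.abs-* ((+ M) ℤ.^ (i / k)) _) (cong₂ _*_ (abs-^ (+ M) (i / k))
          (trans (ℤ.abs-* ((+ M′) ℤ.^ (j / k)) _) (cong₂ _*_ (abs-^ (+ M′) (j / k)) (ℤ.abs-* δ δ′)))) ⟩
    M ^ (i / k) * (M′ ^ (j / k) * (∣ δ ∣ * ∣ δ′ ∣))
      ≤⟨ ℕ.*-mono-≤ (power≤ M≤B i) (ℕ.*-mono-≤ (power≤ M′≤B j) (ℕ.*-mono-≤ (kronecker≤1 (toℕ c) (i % k)) (kronecker≤1 (toℕ c′) (j % k)))) ⟩
    B ^ i * (B ^ j * 1)
      ≡⟨ trans (cong (B ^ i *_) (ℕ.*-identityʳ (B ^ j))) (trans (sym (ℕ.^-distribˡ-+-* B i j)) (sym (ℕ.*-identityˡ _))) ⟩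
    1 * B ^ (i + j) ∎
    where
    open ℕ.≤-Reasoning
    δ = kronecker (toℕ c) (i % k)
    δ′ = kronecker (toℕ c′) (j % k)
    power≤ : ∀ {m} → m ≤ B → ∀ i → m ^ (i / k) ≤ B ^ i
    power≤ m≤B i = ℕ.≤-trans (ℕ.^-monoˡ-≤ (i / k) m≤B) (ℕ.^-monoʳ-≤ B (ℕ.m/n≤m i k))

  coordinate-bound : ∀ p c c′ → ∣ coordinate p c c′ ∣ ≤ ‖ p ‖
  coordinate-bound p c c′ = ℕ.≤-trans (act-bounded p (basis-bounded c c′) 0 0)
    (ℕ.≤-reflexive (trans (ℕ.*-identityʳ _) (ℕ.*-identityʳ _)))

  ‖^‖ : ∀ p n → ‖ p ^ᴾ n ‖ ≡ ‖ p ‖ ^ n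
  ‖^‖ p zero    = refl
  ‖^‖ p (suc n) = cong (‖ p ‖ *_) (‖^‖ p n)

  ‖⨁‖ : ∀ {n} (f : Fin n → Poly) {b} → (∀ i → ‖ f i ‖ ≤ b) → ‖ ⨁ f ‖ ≤ n * b
  ‖⨁‖ {zero}  f f≤b = z≤n
  ‖⨁‖ {suc n} f f≤b = ℕ.+-mono-≤ (f≤b Fin.zero) (‖⨁‖ (f ∘ Fin.suc) (f≤b ∘ Fin.suc))

  ‖fromCoefficients‖ : ∀ a {m} → (∀ c c′ → ∣ a c c′ ∣ ≤ m) →
                       ‖ fromCoefficients a ‖ ≤ k * (k * (m * (B ^ k * B ^ k)))
  ‖fromCoefficients‖ a a≤m = ‖⨁‖ (λ c → ⨁ (term a c)) λ c → ‖⨁‖ (term a c) λ c′ →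
    ℕ.*-mono-≤ (a≤m c c′) (ℕ.*-mono-≤ (power≤ X refl c) (power≤ Y refl c′))
    where
    power≤ : ∀ x → ‖ x ‖ ≡ B → (c : Fin k) → ‖ x ^ᴾ toℕ c ‖ ≤ B ^ k
    power≤ x ‖x‖≡B c = ℕ.≤-trans
      (ℕ.≤-reflexive (trans (‖^‖ x (toℕ c)) (cong (_^ toℕ c) ‖x‖≡B)))
      (ℕ.^-monoʳ-≤ B (ℕ.<⇒≤ (Fin.toℕ<n c)))

  -- Linear independence of the monomials: applied to the `basis` sequence of (c, c′), the sum keeps
  -- only the coefficient at (c, c′).
  fromCoefficients-injective : ∀ {a b} → fromCoefficients a ≈ fromCoefficients b [ 0ℤ ] → ∀ c c′ → a c c′ ≡ b c c′
  fromCoefficients-injective {a} {b} a≈b c c′ = trans (sym (coefficient a)) (trans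
    (mod-0⇒≡ (agree a≈b (extend-twisted δ) 0 0)) (coefficient b))
    where
    open ≡.≡-Reasoning
    δ : Sequence
    δ i j = kronecker (toℕ c) i ℤ.* kronecker (toℕ c′) j

    0+/ : ∀ (i : Fin k) → (toℕ i + 0) / k ≡ 0
    0+/ i = trans (cong (_/ k) (ℕ.+-identityʳ (toℕ i))) (ℕ.m<n⇒m/n≡0 (Fin.toℕ<n i))

    0+% : ∀ (i : Fin k) → (toℕ i + 0) % k ≡ toℕ i
    0+% i = trans (cong (_% k) (ℕ.+-identityʳ (toℕ i))) (ℕ.m<n⇒m%n≡m (Fin.toℕ<n i))

    lemma : ∀ x d d′ → x ℤ.* (1ℤ ℤ.* (1ℤ ℤ.* (d ℤ.* d′))) ≡ x ℤ.* d′ ℤ.* d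
    lemma = ℤSolver.solve-∀

    value : ∀ i j → extend δ (toℕ i + 0) (toℕ j + 0) ≡ 1ℤ ℤ.* (1ℤ ℤ.* δ (toℕ i) (toℕ j))
    value i j rewrite 0+/ i | 0+/ j | 0+% i | 0+% j = refl

    coefficient : ∀ a → act (fromCoefficients a) (extend δ) 0 0 ≡ a c c′
    coefficient a = begin
      act (fromCoefficients a) (extend δ) 0 0
        ≡⟨ act-fromCoefficients a (extend δ) 0 0 ⟩
      sum (λ i → sum (λ j → a i j ℤ.* extend δ (toℕ i + 0) (toℕ j + 0)))
        ≡⟨ sum-cong-≗ (λ i → trans (sum-cong-≗ λ j →
             trans (cong (a i j ℤ.*_) (value i j)) (lemma (a i j) (kronecker (toℕ c) (toℕ i)) (kronecker (toℕ c′) (toℕ j))))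
             (trans (sym (*-distribʳ-sum (kronecker (toℕ c) (toℕ i)) (λ j → a i j ℤ.* kronecker (toℕ c′) (toℕ j))))
             (cong (ℤ._* kronecker (toℕ c) (toℕ i)) (sum-kronecker-Fin (a i) c′)))) ⟩
      sum (λ i → a i c′ ℤ.* kronecker (toℕ c) (toℕ i))
        ≡⟨ sum-kronecker-Fin (λ i → a i c′) c ⟩
      a c c′ ∎

funToFin-cong : ∀ {m n} {f g : Fin m → Fin n} → f ≗ g → funToFin f ≡ funToFin g
funToFin-cong {zero}  f≗g = refl
funToFin-cong {suc m} f≗g = cong₂ combine (f≗g Fin.zero) (funToFin-cong (f≗g ∘ Fin.suc))

finToFun-injective : ∀ {m n} {i j : Fin (n ℕ.^ m)} → finToFun {n} {m} i ≗ finToFun j → i ≡ j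
finToFun-injective {m} {n} {i} {j} eq = trans (sym (Fin.funToFin-finToFin {m} {n} i))
  (trans (funToFin-cong eq) (Fin.funToFin-finToFin {m} {n} j))

∣-<⇒≡0 : ∀ {m} x → + m ℤ∣.∣ x → ∣ x ∣ ℕ.< m → x ≡ 0ℤ
∣-<⇒≡0 {m} x m∣x x<m with ∣ x ∣ in eq
... | zero  = ℤ.∣i∣≡0⇒i≡0 eq
... | suc n = contradiction (subst (m ∣_) eq (ℤ∣.∣⇒∣ᵤ m∣x)) (ℕ∣.>⇒∤ x<m)

toℕ-diff< : ∀ {m} (i j : Fin m) → ∣ + toℕ i ℤ.- + toℕ j ∣ ℕ.< m
toℕ-diff< i j = ℕ.≤-<-trans (ℕ.≤-trans
  (ℕ.≤-reflexive (cong ∣_∣ (ℤ.m-n≡m⊖n (toℕ i) (toℕ j))))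
  (ℤ.∣m⊝n∣≤m⊔n (toℕ i) (toℕ j)))
  (ℕ.⊔-lub (Fin.toℕ<n i) (Fin.toℕ<n j))

offset : ∀ {K} x → ∣ x ∣ ℕ.≤ K → ∃[ n ] n ℕ.< suc (K ℕ.+ K) × + n ≡ x ℤ.+ + K
offset {K} (+ n) n≤K = n ℕ.+ K , s≤s (ℕ.+-monoˡ-≤ K n≤K) , ℤ.pos-+ n K
offset {K} -[1+ n ] n<K = K ℕ.∸ suc n , s≤s (ℕ.≤-trans (ℕ.m∸n≤m K (suc n)) (ℕ.m≤m+n K K)) ,
  trans (sym (ℤ.⊖-≥ n<K)) (trans (sym (ℤ.m-n≡m⊖n K (suc n))) (ℤ.+-comm (+ K) -[1+ n ]))

offset-injective : ∀ {K} x y {x≤ : ∣ x ∣ ℕ.≤ K} {y≤ : ∣ y ∣ ℕ.≤ K} →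
                   proj₁ (offset x x≤) ≡ proj₁ (offset y y≤) → x ≡ y
offset-injective {K} x y {x≤} {y≤} eq = ∙-cancelʳ (+ K) x y (trans
  (sym (proj₂ (proj₂ (offset x x≤)))) (trans (cong +_ eq) (proj₂ (proj₂ (offset y y≤)))))

codes⇒≤ : ∀ {m N W k} (code : Fin m × Fin N → Fin k × Fin k → Fin W) →
          (∀ u v → code u ≗ code v → u ≡ v) → m ℕ.* N ℕ.≤ W ℕ.^ (k ℕ.* k)
codes⇒≤ {m} {N} {W} {k} code code-injective = Fin.injective⇒≤ encode-injective
  where
  encode : Fin (m ℕ.* N) → Fin (W ℕ.^ (k ℕ.* k))
  encode x = funToFin (code (remQuot N x) ∘ remQuot k)

  decode : ∀ x cc → finToFun {W} {k ℕ.* k} (encode x) (uncurry combine cc) ≡ code (remQuot N x) cc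
  decode x (c , c′) = trans
    (Fin.finToFun-funToFin (code (remQuot N x) ∘ remQuot k) (combine c c′))
    (cong (code (remQuot N x)) (Fin.remQuot-combine {k} c c′))

  encode-injective : Injective _≡_ _≡_ encode
  encode-injective {x} {x′} eq = trans (sym (Fin.combine-remQuot {m} N x))
    (trans (cong (uncurry combine) (code-injective (remQuot N x) (remQuot N x′) code≗))
    (Fin.combine-remQuot {m} N x′))
    where
    code≗ : code (remQuot N x) ≗ code (remQuot N x′)
    code≗ cc = trans (sym (decode x cc))
      (trans (cong (λ e → finToFun {W} {k ℕ.* k} e (uncurry combine cc)) eq) (decode x′ cc))

module Index (k M M′ : ℕ) .{{_ : NonZero k}} (B : ℕ) .{{_ : NonZero B}} (M≤B : M ℕ.≤ B) (M′≤B : M′ ℕ.≤ B) where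

  open RadicalRing k M M′
  open Coordinates k M M′
  open Norm k M M′ B M≤B M′≤B
  open import Data.Nat.Base using (_*_; _^_; _+_; _≤_)

  -- The elements y a + n, where a has coefficients in [0, m) and n ∈ [0, m),
  -- are distinct and have small coordinates.
  module _ (y : Poly) (y-nonZeroDivisor : ∀ a → y ⊠ a ≈ con 0ℤ [ 0ℤ ] → a ≈ con 0ℤ [ 0ℤ ])
           (m : ℕ) .{{_ : NonZero m}}
           (m∣ : ∀ a n → y ⊠ a ⊞ con n ≈ con 0ℤ [ 0ℤ ] → + m ℤ∣.∣ n) where

    private
      D : ℕ
      D = ‖ y ‖ * (k * (k * (B ^ k * B ^ k)))

      K : ℕ
      K = m * suc D

      coefficients : Fin (m ^ (k * k)) → Fin k → Fin k → ℤ
      coefficients g c c′ = + toℕ (finToFun {m} {k * k} g (combine c c′))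

      element : Fin m → Fin (m ^ (k * k)) → Poly
      element n g = y ⊠ fromCoefficients (coefficients g) ⊞ con (+ toℕ n)

      ‖element‖ : ∀ n g → ‖ element n g ‖ ≤ K
      ‖element‖ n g = begin
        ‖ y ‖ * ‖ fromCoefficients (coefficients g) ‖ + toℕ n
          ≤⟨ ℕ.+-mono-≤ (ℕ.*-monoʳ-≤ ‖ y ‖ (‖fromCoefficients‖ (coefficients g) {m} λ c c′ → ℕ.<⇒≤ (Fin.toℕ<n _)))
                        (ℕ.<⇒≤ (Fin.toℕ<n n)) ⟩
        ‖ y ‖ * (k * (k * (m * (B ^ k * B ^ k)))) + m
          ≡⟨ lemma ‖ y ‖ k m (B ^ k * B ^ k) ⟩
        m * suc D ∎
        where
        open ℕ.≤-Reasoning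
        lemma : ∀ y k m b → y * (k * (k * (m * b))) + m ≡ m * (1 + y * (k * (k * b)))
        lemma = ℕSolver.solve-∀

      bound : ∀ n g c c′ → ∣ coordinate (element n g) c c′ ∣ ≤ K
      bound n g c c′ = ℕ.≤-trans (coordinate-bound (element n g) c c′) (‖element‖ n g)

      code : Fin m × Fin (m ^ (k * k)) → Fin k × Fin k → Fin (suc (K + K))
      code (n , g) (c , c′) = fromℕ< (proj₁ (proj₂ (offset (coordinate (element n g) c c′) (bound n g c c′))))

      -- Equal coordinates give y (a - a′) + (n - n′) = 0. Hence m ∣ n - n′, which forces n = n′ by
      -- size, and then y can be cancelled.
      code-injective : ∀ u v → code u ≗ code v → u ≡ v
      code-injective (n , g) (n′ , g′) eq = cong₂ _,_ n≡n′ g≡g′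
        where
        element≈ : element n g ≈ element n′ g′ [ 0ℤ ]
        element≈ = ≈-fromCoordinates λ c c′ → mod-reflexive (offset-injective (coordinate (element n g) c c′) (coordinate (element n′ g′) c c′) {bound n g c c′} {bound n′ g′ c c′} (trans
          (sym (Fin.toℕ-fromℕ< (proj₁ (proj₂ (offset (coordinate (element n g) c c′) (bound n g c c′))))))
          (trans (cong toℕ (eq (c , c′)))
          (Fin.toℕ-fromℕ< (proj₁ (proj₂ (offset (coordinate (element n′ g′) c c′) (bound n′ g′ c c′))))))))

        a  = fromCoefficients (coefficients g)
        a′ = fromCoefficients (coefficients g′)
        δ  = + toℕ n ℤ.- + toℕ n′

        act-difference : ∀ s i j → act (y ⊠ (a ⊞ con -1ℤ ⊠ a′)) s i j ≡ act (y ⊠ a) s i j ℤ.+ -1ℤ ℤ.* act (y ⊠ a′) s i j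
        act-difference s i j = trans (act-+ y (act a s) _ i j)
          (cong (ℤ._+_ (act (y ⊠ a) s i j)) (act-* y -1ℤ (act a′ s) i j))

        difference≈0 : y ⊠ (a ⊞ con -1ℤ ⊠ a′) ⊞ con δ ≈ con 0ℤ [ 0ℤ ]
        difference≈0 = equal λ {s} tw i j → mod-reflexive (begin
          act (y ⊠ (a ⊞ con -1ℤ ⊠ a′)) s i j ℤ.+ δ ℤ.* s i j
            ≡⟨ cong (ℤ._+ δ ℤ.* s i j) (act-difference s i j) ⟩
          act (y ⊠ a) s i j ℤ.+ -1ℤ ℤ.* act (y ⊠ a′) s i j ℤ.+ δ ℤ.* s i j
            ≡⟨ lemma (act (y ⊠ a) s i j) (act (y ⊠ a′) s i j) (+ toℕ n) (+ toℕ n′) (s i j) ⟩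
          act (element n g) s i j ℤ.- act (element n′ g′) s i j
            ≡⟨ ℤ.i≡j⇒i-j≡0 {act (element n g) s i j} (mod-0⇒≡ (agree element≈ tw i j)) ⟩
          0ℤ ∎)
          where
          open ≡.≡-Reasoning
          lemma : ∀ u v n n′ s → u ℤ.+ -1ℤ ℤ.* v ℤ.+ (n ℤ.- n′) ℤ.* s ≡ (u ℤ.+ n ℤ.* s) ℤ.- (v ℤ.+ n′ ℤ.* s)
          lemma = ℤSolver.solve-∀

        δ≡0 : δ ≡ 0ℤ
        δ≡0 = ∣-<⇒≡0 δ (m∣ (a ⊞ con -1ℤ ⊠ a′) δ difference≈0) (toℕ-diff< n n′)

        n≡n′ : n ≡ n′
        n≡n′ = Fin.toℕ-injective (ℤ.+-injective (ℤ.i-j≡0⇒i≡j (+ toℕ n) (+ toℕ n′) δ≡0))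

        a-a′≈0 : a ⊞ con -1ℤ ⊠ a′ ≈ con 0ℤ [ 0ℤ ]
        a-a′≈0 = y-nonZeroDivisor (a ⊞ con -1ℤ ⊠ a′) (equal λ {s} tw i j → mod-trans (mod-reflexive
          (sym (trans (cong (λ δ → act (y ⊠ (a ⊞ con -1ℤ ⊠ a′)) s i j ℤ.+ δ ℤ.* s i j) δ≡0) (ℤ.+-identityʳ (act (y ⊠ (a ⊞ con -1ℤ ⊠ a′)) s i j)))))
          (agree difference≈0 tw i j))

        a≈a′ : a ≈ a′ [ 0ℤ ]
        a≈a′ = equal λ {s} tw i j → mod-reflexive (ℤ.i-j≡0⇒i≡j (act a s i j) (act a′ s i j) (trans
          (cong (ℤ._+_ (act a s i j)) (sym (ℤ.-1*i≡-i (act a′ s i j))))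
          (mod-0⇒≡ (agree a-a′≈0 tw i j))))

        g≡g′ : g ≡ g′
        g≡g′ = finToFun-injective {k * k} {m} λ i → subst (λ i → finToFun {m} {k * k} g i ≡ finToFun g′ i) (Fin.combine-remQuot {k} k i)
          (Fin.toℕ-injective (ℤ.+-injective
            (fromCoefficients-injective {coefficients g} {coefficients g′} a≈a′ (proj₁ (remQuot {k} k i)) (proj₂ (remQuot {k} k i)))))

    -- There are m · m^(k²) pairs (n, a) and at most (2K + 1)^(k²) coordinate vectors. K is
    -- proportional to m because `‖ y ‖` is multiplied by coefficients below m, so the power m^(k²)
    -- cancels and a bound for m itself is left.
    index-bound : m ≤ (3 + 2 * D) ^ (k * k)
    index-bound = ℕ.*-cancelʳ-≤ m _ (m ^ (k * k)) {{ℕ.m^n≢0 m (k * k)}} (begin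
      m * m ^ (k * k)                      ≤⟨ codes⇒≤ code code-injective ⟩
      suc (K + K) ^ (k * k)                ≤⟨ ℕ.^-monoˡ-≤ (k * k) 1+2K≤ ⟩
      ((3 + 2 * D) * m) ^ (k * k)          ≡⟨ ^-distribʳ-* (3 + 2 * D) m (k * k) ⟩
      (3 + 2 * D) ^ (k * k) * m ^ (k * k)  ∎)
      where
      open ℕ.≤-Reasoning
      1+2K≤ : suc (K + K) ≤ (3 + 2 * D) * m
      1+2K≤ = begin
        1 + (K + K)         ≤⟨ ℕ.+-monoˡ-≤ (K + K) (ℕ.>-nonZero⁻¹ m) ⟩
        m + (m * suc D + m * suc D) ≡⟨ lemma m D ⟩
        (3 + 2 * D) * m     ∎
        where
        lemma : ∀ m d → m + (m * (1 + d) + m * (1 + d)) ≡ (3 + 2 * d) * m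
        lemma = ℕSolver.solve-∀

-- Roots modulo q

module Lagrange where

  open import Data.Integer.Base using (_*_; _^_; _+_; _-_; -_)

  -- A form of "f is a monic polynomial of degree n" that suffices for
  -- counting roots: dividing by any x - a lowers the degree.
  Monic : ℕ → (ℤ → ℤ) → Set
  Monic zero    f = ∀ x → f x ≡ 1ℤ
  Monic (suc n) f = ∀ a → ∃[ g ] Monic n g × (∀ x → f x - f a ≡ (x - a) * g x)

  -- Needed for `monic-*`: the quotient of x f(x) - c by x - a is f + a g, where g, the quotient of
  -- f, has lower degree.
  monic-+ : ∀ n {f g} c → Monic (suc n) f → Monic n g → Monic (suc n) (λ x → f x + c * g x)
  monic-+ zero {f} {g} c f-monic g≡1 b with f′ , f′-monic , f≡ ← f-monic b =
    f′ , f′-monic , λ x → trans (cong₂ (λ u v → f x + c * u - (f b + c * v)) (g≡1 x) (g≡1 b))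
      (trans (lemma (f x) (f b) c) (f≡ x))
    where
    lemma : ∀ u v c → u + c * 1ℤ - (v + c * 1ℤ) ≡ u - v
    lemma = ℤSolver.solve-∀
  monic-+ (suc n) {f} {g} c f-monic g-monic b
    with f′ , f′-monic , f≡ ← f-monic b | g′ , g′-monic , g≡ ← g-monic b =
    (λ x → f′ x + c * g′ x) , monic-+ n {f′} {g′} c f′-monic g′-monic , λ x → trans (lemma (f x) (f b) (g x) (g b) c)
      (trans (cong₂ (λ u v → u + c * v) (f≡ x) (g≡ x)) (lemma′ (x - b) (f′ x) (g′ x) c))
    where
    lemma : ∀ u v r s c → u + c * r - (v + c * s) ≡ (u - v) + c * (r - s)
    lemma = ℤSolver.solve-∀
    lemma′ : ∀ d u v c → d * u + c * (d * v) ≡ d * (u + c * v)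
    lemma′ = ℤSolver.solve-∀

  monic-* : ∀ n {f} c → Monic n f → Monic (suc n) (λ x → x * f x - c)
  monic-* zero {f} c f≡1 a = f , f≡1 , λ x →
    trans (cong₂ (λ u v → x * u - c - (a * v - c)) (f≡1 x) (f≡1 a))
      (trans (lemma x a c) (cong ((x - a) *_) (sym (f≡1 x))))
    where
    lemma : ∀ x a c → x * 1ℤ - c - (a * 1ℤ - c) ≡ (x - a) * 1ℤ
    lemma = ℤSolver.solve-∀
  monic-* (suc n) {f} c f-monic a with g , g-monic , f≡ ← f-monic a =
    (λ x → f x + a * g x) , monic-+ n {f} {g} a f-monic g-monic , λ x → trans (lemma x a c (f x) (f a))
      (trans (cong (λ u → (x - a) * f x + a * u) (f≡ x)) (lemma′ (x - a) (f x) a (g x)))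
    where
    lemma : ∀ x a c u v → x * u - c - (a * v - c) ≡ (x - a) * u + a * (u - v)
    lemma = ℤSolver.solve-∀
    lemma′ : ∀ d u a v → d * u + a * (d * v) ≡ d * (u + a * v)
    lemma′ = ℤSolver.solve-∀

  monic-ext : ∀ n {f g} → (∀ x → f x ≡ g x) → Monic n f → Monic n g
  monic-ext zero    f≡g f-monic x = trans (sym (f≡g x)) (f-monic x)
  monic-ext (suc n) f≡g f-monic a with h , h-monic , f≡ ← f-monic a =
    h , h-monic , λ x → trans (sym (cong₂ _-_ (f≡g x) (f≡g a))) (f≡ x)

  monic-power : ∀ n → Monic n (_^ n)
  monic-power zero    x = refl
  monic-power (suc n) = monic-ext (suc n) (λ x → ℤ.+-identityʳ (x * x ^ n)) (monic-* n 0ℤ (monic-power n))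

  roots≤degree : ∀ {p} → Prime p → ∀ n {f xs} → Monic n f → AllPairs (λ x y → ¬ + p ℤ∣.∣ y - x) xs →
                 All (λ x → + p ℤ∣.∣ f x) xs → length xs ℕ.≤ n
  roots≤degree p-prime zero    f≡1 [] [] = z≤n
  roots≤degree p-prime zero    {f} {x ∷ _} f≡1 _ (p∣fx ∷ _) =
    contradiction (ℤ∣.∣⇒∣ᵤ (subst (+ _ ℤ∣.∣_) (f≡1 x) p∣fx)) (prime∤1 p-prime)
  roots≤degree p-prime (suc n) f-monic [] [] = z≤n
  roots≤degree {p} p-prime (suc n) {f} {a ∷ xs} f-monic (a≢xs ∷ distinct) (p∣fa ∷ p∣f)
    with g , g-monic , f≡ ← f-monic a =
    s≤s (roots≤degree p-prime n g-monic distinct (All.zipWith (λ {x} (p∤x-a , p∣fx) →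
      [ (λ p∣x-a → contradiction p∣x-a p∤x-a) , id ]′
        (euclidsLemmaℤ (x - a) (g x) p-prime (subst (+ p ℤ∣.∣_) (f≡ x) (ℤ∣.∣m∣n⇒∣m-n p∣fx p∣fa)))) (a≢xs , p∣f)))

open Lagrange

module Residues where

  open import Data.Integer.Base using (_*_; _^_; _+_; _-_; -_)

  toℤ : ∀ {q} → Fin q → ℤ
  toℤ b = + toℕ b

  %-≡⇒mod : ∀ {m n} q .{{_ : NonZero q}} → m % q ≡ n % q → + m ≡ + n [mod + q ]
  %-≡⇒mod {m} {n} q eq = mod-trans (m≡m%q m)
    (mod-trans (mod-reflexive (cong +_ eq)) (mod-sym (m≡m%q n)))
    where
    m≡m%q : ∀ m → + m ≡ + (m % q) [mod + q ]
    m≡m%q m = mod-diff (divides (+ (m / q)) (trans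
      (cong (λ x → + x - + (m % q)) (ℕ.m≡m%n+[m/n]*n m q))
      (trans (cong (_- + (m % q)) (trans (ℤ.pos-+ (m % q) (m / q ℕ.* q)) (cong (_+_ (+ (m % q))) (ℤ.pos-* (m / q) q))))
        (lemma (+ (m % q)) (+ (m / q) * + q)))))
      where
      lemma : ∀ a b → a + b - a ≡ b
      lemma = ℤSolver.solve-∀

  reduce-≡⇒mod : ∀ {q} (a b : Fin q) {m n} → reduce a m ≡ reduce b n → + m ≡ + n [mod + q ]
  reduce-≡⇒mod {q} a b {m} {n} eq = %-≡⇒mod q {{Fin.nonZeroIndex a}}
    (trans (sym (Fin.toℕ-fromℕ< (ℕ.m%n<n m q {{Fin.nonZeroIndex a}})))
    (trans (cong toℕ eq) (Fin.toℕ-fromℕ< (ℕ.m%n<n n q {{Fin.nonZeroIndex b}}))))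

  ⊕-≡⇒mod : ∀ {q} (a b c d : Fin q) → a ⊕ b ≡ c ⊕ d → toℤ a + toℤ b ≡ toℤ c + toℤ d [mod + q ]
  ⊕-≡⇒mod a b c d eq = mod-trans (mod-reflexive (sym (ℤ.pos-+ (toℕ a) (toℕ b))))
    (mod-trans (reduce-≡⇒mod a c eq) (mod-reflexive (ℤ.pos-+ (toℕ c) (toℕ d))))

  ^ᶠ-≡⇒mod : ∀ {q} (b j : Fin q) k n → b ^ᶠ k ≡ reduce j (n ℕ.* toℕ j) → toℤ b ^ k ≡ + n * toℤ j [mod + q ]
  ^ᶠ-≡⇒mod b j k n eq = mod-trans (mod-reflexive (sym (pos-^ (toℕ b) k)))
    (mod-trans (reduce-≡⇒mod b j eq) (mod-reflexive (ℤ.pos-* n (toℕ j))))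

  distinct-residues : ∀ {q} {a b : Fin q} → a ≢ b → ¬ + q ℤ∣.∣ toℤ b - toℤ a
  distinct-residues {q} {a} {b} a≢b q∣b-a = a≢b (sym (Fin.toℕ-injective (ℤ.+-injective
    (ℤ.i-j≡0⇒i≡j (toℤ b) (toℤ a) (∣-<⇒≡0 (toℤ b - toℤ a) q∣b-a (toℕ-diff< b a))))))

  kthRoots : ∀ {q} → ℕ → Fin q → List (Fin q)
  kthRoots {q} k v = filter (λ b → b ^ᶠ k Fin.≟ v) (allFin q)

  length-kthRoots : ∀ {q} → Prime q → ∀ k .{{_ : NonZero k}} (v : Fin q) → length (kthRoots k v) ℕ.≤ k
  length-kthRoots {q} q-prime k@(suc k-1) v = subst (ℕ._≤ k) (length-map toℤ (kthRoots k v))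
    (roots≤degree q-prime k {λ x → x ^ k - toℤ v} (monic-* k-1 (toℤ v) (monic-power k-1))
      (AllPairs.map⁺ (AllPairs.map distinct-residues (Unique.filter⁺ _ (Unique.allFin⁺ q))))
      (All.map⁺ (All.tabulate λ {b} b∈ → difference (is-root b (proj₂ (∈-filter⁻ (λ b → b ^ᶠ k Fin.≟ v) {xs = allFin q} b∈))))))
    where
    is-root : ∀ b → b ^ᶠ k ≡ v → toℤ b ^ k ≡ toℤ v [mod + q ]
    is-root b eq = mod-trans (mod-reflexive (sym (pos-^ (toℕ b) k)))
      (%-≡⇒mod q {{Fin.nonZeroIndex b}} (trans (sym (Fin.toℕ-fromℕ< (ℕ.m%n<n (toℕ b ℕ.^ k) q {{Fin.nonZeroIndex b}})))
        (trans (cong toℕ eq) (sym (ℕ.m<n⇒m%n≡m {{Fin.nonZeroIndex b}} (Fin.toℕ<n v))))))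

  inverse : ∀ {q j} → Prime q → q ∤ j → ∃[ j′ ] + j * j′ ≡ 1ℤ [mod + q ]
  inverse {q} {j} q-prime q∤j with coprime-Bézout (Coprimality.sym (prime∤⇒coprime q-prime q∤j))
  ... | Bézout.+- x y eq = - (+ y) , mod-diff (divides (- (+ x)) (trans (lemma (+ j) (+ y)) (trans
          (cong -_ (trans (cong (_+_ 1ℤ) (sym (ℤ.pos-* y j))) (trans (cong +_ eq) (ℤ.pos-* x q)))) (lemma′ (+ x) (+ q)))))
    where
    lemma : ∀ j y → j * - y - 1ℤ ≡ - (1ℤ + y * j)
    lemma = ℤSolver.solve-∀
    lemma′ : ∀ a b → - (a * b) ≡ - a * b
    lemma′ = ℤSolver.solve-∀
  ... | Bézout.-+ x y eq = + y , mod-diff (divides (+ x) (trans (cong (_- 1ℤ) (trans (ℤ.*-comm (+ j) (+ y))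
          (trans (sym (ℤ.pos-* y j)) (trans (cong +_ (sym eq)) (cong (_+_ 1ℤ) (ℤ.pos-* x q)))))) (lemma (+ x * + q))))
    where
    lemma : ∀ a → 1ℤ + a - 1ℤ ≡ a
    lemma = ℤSolver.solve-∀

open Residues

-- Primes q for which a given quadruple n is solvable

-- Powers of Q ≥ 2 collected with B = Q^k. The first bracket bounds `‖ z ‖`: two terms (a factor 2 ≤
-- Q), each a coefficient at most Q^k times the k-th power of a norm at most Q^(k+2). The second
-- bracket is for k · k · B^k · B^k, with k ≤ Q^k. In `exponent`, the 3 comes from 3 + 2D ≤ 8 Q^h ≤
-- Q^(3+h), and k · k is the rank of A.
coefficientExponent exponent : ℕ → ℕ
coefficientExponent k = (1 ℕ.+ (k ℕ.+ (k ℕ.+ 2) ℕ.* k)) ℕ.+ (k ℕ.+ (k ℕ.+ (k ℕ.* k ℕ.+ k ℕ.* k)))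
exponent k = (3 ℕ.+ coefficientExponent k) ℕ.* (k ℕ.* k)

module FewPrimes (k M M′ : ℕ) .{{_ : NonZero k}} {p : ℕ} (p-prime : Prime p)
                 (p∤k : p ∤ k) (p∤M : p ∤ M) (p∤M′ : p ∤ M′)
                 (Q : ℕ) .{{_ : NonZero Q}} (2≤Q : 2 ℕ.≤ Q) (M≤ : M ℕ.≤ Q ℕ.^ k) (M′≤ : M′ ℕ.≤ Q ℕ.^ k) where

  open RadicalRing k M M′
  open Coordinates k M M′
  open Reduced k M M′ p-prime p∤k p∤M p∤M′ using (X^k≈M; Y^k≈M′)
  open NonZeroDivisor k M M′ p-prime p∤k p∤M p∤M′
  open Evaluation k M M′

  private
    instance
      Q^k≢0 : NonZero (Q ℕ.^ k)
      Q^k≢0 = ℕ.m^n≢0 Q k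

  open Norm k M M′ (Q ℕ.^ k) M≤ M′≤ public

  one-nonZeroDivisor : IsNonZeroDivisor (con 1ℤ)
  one-nonZeroDivisor a 1a≈0 = equal λ {s} tw i j →
    mod-trans (mod-reflexive (sym (ℤ.*-identityˡ (act a s i j)))) (agree 1a≈0 tw i j)

  module _ where

    open import Data.Integer.Base using (_*_; _^_; _+_; _-_; -_)

    -- If (c + t G) a = 0, then t² = 1 gives G a = ρ a with ρ = -t c. Hence μ a = G^k a = ρ^k a, and
    -- μ ≠ ρ^k because the absolute value of ρ^k is m^k.
    linear-nonZeroDivisor : ∀ G {μ m} σ t → G ^ᴾ k ≈ con (+ μ) [ 0ℤ ] → μ ≢ m ℕ.^ k →
      ∣ σ ∣ ≡ 1 → t * t ≡ 1ℤ → IsNonZeroDivisor (con (σ * + m) ⊞ con t ⊠ G)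
    linear-nonZeroDivisor G {μ} {m} σ t G^k≈μ μ≢m^k ∣σ∣≡1 t²≡1 a Ua≈0 = equal λ {s} tw i j →
      mod-reflexive (vanish tw i j)
      where
      c ρ : ℤ
      c = σ * + m
      ρ = - (t * c)

      ∣t∣≡1 : ∣ t ∣ ≡ 1
      ∣t∣≡1 = ℕ.m*n≡1⇒m≡1 ∣ t ∣ ∣ t ∣ (trans (sym (ℤ.abs-* t t)) (cong ∣_∣ t²≡1))

      ∣ρ∣≡m : ∣ ρ ∣ ≡ m
      ∣ρ∣≡m = trans (ℤ.∣-i∣≡∣i∣ (t * c)) (trans (ℤ.abs-* t c) (trans
        (cong₂ ℕ._*_ ∣t∣≡1 (trans (ℤ.abs-* σ (+ m)) (cong (ℕ._* m) ∣σ∣≡1)))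
        (trans (ℕ.*-identityˡ (1 ℕ.* m)) (ℕ.*-identityˡ m))))

      module _ {s : Sequence} (tw : Twisted s) (i j : ℕ) where

        u : ℕ → ℤ
        u n = act (G ^ᴾ n) (act a s) i j

        relation : ∀ n → c * u n + t * u (suc n) ≡ 0ℤ
        relation n = trans (sym (cong₂ (λ x y → c * x + t * y)
          (act-comm a (G ^ᴾ n) s i j) (act-cong G (act-comm a (G ^ᴾ n) s) i j)))
          (mod-0⇒≡ (agree Ua≈0 (act-twisted (G ^ᴾ n) tw) i j))

        step : ∀ n → u (suc n) ≡ ρ * u n
        step n = begin
          u (suc n)                                   ≡⟨ ℤ.*-identityˡ (u (suc n)) ⟨
          1ℤ * u (suc n)                              ≡⟨ cong (_* u (suc n)) t²≡1 ⟨
          t * t * u (suc n)                           ≡⟨ lemma t c (u n) (u (suc n)) ⟩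
          t * (c * u n + t * u (suc n)) + ρ * u n     ≡⟨ cong (λ x → t * x + ρ * u n) (relation n) ⟩
          t * 0ℤ + ρ * u n                            ≡⟨ lemma′ t (ρ * u n) ⟩
          ρ * u n                                     ∎
          where
          open ≡.≡-Reasoning
          lemma : ∀ t c x y → t * t * y ≡ t * (c * x + t * y) + - (t * c) * x
          lemma = ℤSolver.solve-∀
          lemma′ : ∀ t x → t * 0ℤ + x ≡ x
          lemma′ = ℤSolver.solve-∀

        geometric : ∀ n → u n ≡ ρ ^ n * u 0
        geometric zero    = sym (ℤ.*-identityˡ (u 0))
        geometric (suc n) = trans (step n) (trans (cong (ρ *_) (geometric n)) (sym (ℤ.*-assoc ρ (ρ ^ n) (u 0))))

        u₀≡ : u 0 ≡ act a s i j
        u₀≡ = ℤ.*-identityˡ (act a s i j)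

        product≡0 : (+ μ - ρ ^ k) * act a s i j ≡ 0ℤ
        product≡0 = begin
          (+ μ - ρ ^ k) * act a s i j                 ≡⟨ lemma (+ μ) (ρ ^ k) (act a s i j) ⟩
          + μ * act a s i j - ρ ^ k * act a s i j     ≡⟨ cong₂ _-_ (sym (mod-0⇒≡ (agree G^k≈μ (act-twisted a tw) i j)))
                                                           (cong (ρ ^ k *_) (sym u₀≡)) ⟩
          u k - ρ ^ k * u 0                           ≡⟨ cong (_- ρ ^ k * u 0) (geometric k) ⟩
          ρ ^ k * u 0 - ρ ^ k * u 0                   ≡⟨ ℤ.+-inverseʳ (ρ ^ k * u 0) ⟩
          0ℤ                                          ∎
          where
          open ≡.≡-Reasoning
          lemma : ∀ a b c → (a - b) * c ≡ a * c - b * c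
          lemma = ℤSolver.solve-∀

        vanish : act a s i j ≡ 0ℤ
        vanish = [ (λ μ-ρ^k≡0 → contradiction (trans (cong ∣_∣ (ℤ.i-j≡0⇒i≡j (+ μ) (ρ ^ k) μ-ρ^k≡0))
                     (trans (abs-^ ρ k) (cong (ℕ._^ k) ∣ρ∣≡m))) μ≢m^k) , id ]′
                   (ℤ.i*j≡0⇒i≡0∨j≡0 (+ μ - ρ ^ k) product≡0)

    module _ {c₁ c₂ e : ℕ} (U W : Poly) (p∤c₁ : p ∤ c₁) (p∤c₂ : p ∤ c₂) (0<e : 0 ℕ.< e) (e<k : e ℕ.< k)
             (nonZeroDivisor : IsNonZeroDivisor U ⊎ IsNonZeroDivisor W)
             {qs : List ℕ} (unique : Unique qs) (primes : All Prime qs)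
             (solutions : All (λ q → ∃[ x ] ∃[ y ] x ^ k ≡ + M [mod + q ] × y ^ k ≡ + M′ [mod + q ] ×
                + (c₁ ℕ.* p ℕ.^ e) * eval U x y ^ k ≡ + c₂ * eval W x y ^ k [mod + q ]) qs) where

      private
        instance
          product-qs≢0 : NonZero (product qs)
          product-qs≢0 = product≢0 (All.map prime⇒nonZero primes)

        z : Poly
        z = con (+ c₁ * (+ p) ^ e) ⊠ U ^ᴾ k ⊞ con (- (+ c₂)) ⊠ W ^ᴾ k

        z-nonZeroDivisor : IsNonZeroDivisor z
        z-nonZeroDivisor = difference-nonZeroDivisor {+ c₁} {+ c₂}
          (λ p∣c₁ → p∤c₁ (ℤ∣.∣⇒∣ᵤ p∣c₁)) (λ p∣c₂ → p∤c₂ (ℤ∣.∣⇒∣ᵤ p∣c₂)) 0<e e<k U W nonZeroDivisor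

        coefficient≡ : + c₁ * (+ p) ^ e ≡ + (c₁ ℕ.* p ℕ.^ e)
        coefficient≡ = trans (cong (+ c₁ *_) (sym (pos-^ p e))) (sym (ℤ.pos-* c₁ (p ℕ.^ e)))

        eval-z : ∀ x y → eval z x y ≡ + (c₁ ℕ.* p ℕ.^ e) * eval U x y ^ k + - (+ c₂) * eval W x y ^ k
        eval-z x y = cong₂ _+_ (cong₂ _*_ coefficient≡ (eval-^ U k x y))
          (cong (- (+ c₂) *_) (eval-^ W k x y))

        z-vanishes : ∀ {q x y} → + (c₁ ℕ.* p ℕ.^ e) * eval U x y ^ k ≡ + c₂ * eval W x y ^ k [mod + q ] →
                     eval z x y ≡ 0ℤ [mod + q ]
        z-vanishes {q} {x} {y} eq = mod-trans (mod-reflexive (eval-z x y)) (mod-trans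
          (mod-+ {x = + (c₁ ℕ.* p ℕ.^ e) * eval U x y ^ k} {y = - (+ c₂) * eval W x y ^ k} eq mod-refl)
          (mod-reflexive (lemma (+ c₂) (eval W x y ^ k))))
          where
          lemma : ∀ a b → a * b + - a * b ≡ 0ℤ
          lemma = ℤSolver.solve-∀

        -- Evaluated at the solution (x, y) modulo q, z vanishes, so only q ∣ n remains of the
        -- relation; distinct primes q multiply.
        detects : ∀ a n → z ⊠ a ⊞ con n ≈ con 0ℤ [ 0ℤ ] → + product qs ℤ∣.∣ n
        detects a n za+n≈0 = ℤ∣.∣ᵤ⇒∣ (product-primes∣ unique primes
          (All.map (λ {q} (x , y , x^k≡M , y^k≡M′ , eq) → ℤ∣.∣⇒∣ᵤ (mod-0⇒∣ (mod-trans
            (mod-reflexive (sym (ℤ.+-identityˡ n))) (mod-trans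
            (mod-+ {x = 0ℤ} {y = n} (mod-sym (mod-* {y = eval a x y} (z-vanishes {q} {x} {y} eq) mod-refl)) mod-refl)
            (eval-cong x^k≡M y^k≡M′ za+n≈0))))) solutions))

      product-bound : product qs ℕ.≤ (3 ℕ.+ 2 ℕ.* (‖ z ‖ ℕ.* (k ℕ.* (k ℕ.* ((Q ℕ.^ k) ℕ.^ k ℕ.* (Q ℕ.^ k) ℕ.^ k))))) ℕ.^ (k ℕ.* k)
      product-bound = Index.index-bound k M M′ (Q ℕ.^ k) M≤ M′≤ z z-nonZeroDivisor (product qs) detects

      ‖z‖ : ‖ z ‖ ≡ c₁ ℕ.* p ℕ.^ e ℕ.* ‖ U ‖ ℕ.^ k ℕ.+ c₂ ℕ.* ‖ W ‖ ℕ.^ k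
      ‖z‖ = cong₂ ℕ._+_ (cong₂ ℕ._*_ (cong ∣_∣ coefficient≡) (‖^‖ U k))
        (cong₂ ℕ._*_ (ℤ.∣-i∣≡∣i∣ (+ c₂)) (‖^‖ W k))

  module _ where

    open import Data.Nat.Base using (_*_; _^_; _+_; _≤_)

    norm-product-bound : ∀ {x u w c c′} → x ≤ c * u ^ k + c′ * w ^ k →
      c ≤ Q ^ k → c′ ≤ Q ^ k → u ≤ Q ^ (k + 2) → w ≤ Q ^ (k + 2) →
      (3 + 2 * (x * (k * (k * ((Q ^ k) ^ k * (Q ^ k) ^ k))))) ^ (k * k) ≤ Q ^ exponent k
    norm-product-bound {x} {u} {w} {c} {c′} x≤ c≤ c′≤ u≤ w≤ = ℕ.≤-trans (ℕ.^-monoˡ-≤ (k * k) base)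
      (ℕ.≤-reflexive (ℕ.^-*-assoc Q (3 + coefficientExponent k) (k * k)))
      where
      open ℕ.≤-Reasoning
      y : ℕ
      y = x * (k * (k * ((Q ^ k) ^ k * (Q ^ k) ^ k)))

      2Q^≤ : ∀ n → 2 * Q ^ n ≤ Q ^ suc n
      2Q^≤ n = ℕ.*-monoˡ-≤ (Q ^ n) 2≤Q

      term≤ : ∀ {c u} → c ≤ Q ^ k → u ≤ Q ^ (k + 2) → c * u ^ k ≤ Q ^ (k + (k + 2) * k)
      term≤ {c} {u} c≤ u≤ = begin
        c * u ^ k                    ≤⟨ ℕ.*-mono-≤ c≤ (ℕ.^-monoˡ-≤ k u≤) ⟩
        Q ^ k * (Q ^ (k + 2)) ^ k    ≡⟨ cong (Q ^ k *_) (ℕ.^-*-assoc Q (k + 2) k) ⟩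
        Q ^ k * Q ^ ((k + 2) * k)    ≡⟨ ℕ.^-distribˡ-+-* Q k _ ⟨
        Q ^ (k + (k + 2) * k)        ∎

      x≤Q : x ≤ Q ^ (1 + (k + (k + 2) * k))
      x≤Q = begin
        x                            ≤⟨ x≤ ⟩
        c * u ^ k + c′ * w ^ k       ≤⟨ ℕ.+-mono-≤ (term≤ c≤ u≤) (term≤ c′≤ w≤) ⟩
        Q^n + Q^n                    ≡⟨ cong (_+_ Q^n) (sym (ℕ.+-identityʳ Q^n)) ⟩
        2 * Q^n                      ≤⟨ 2Q^≤ (k + (k + 2) * k) ⟩
        Q ^ (1 + (k + (k + 2) * k))  ∎
        where
        Q^n : ℕ
        Q^n = Q ^ (k + (k + 2) * k)

      k≤Q^k : k ≤ Q ^ k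
      k≤Q^k = ℕ.<⇒≤ (n<m^n k 2≤Q)

      y≤Q : y ≤ Q ^ coefficientExponent k
      y≤Q = begin
        y
          ≤⟨ ℕ.*-mono-≤ x≤Q (ℕ.*-mono-≤ k≤Q^k (ℕ.*-mono-≤ k≤Q^k (ℕ.≤-reflexive
               (trans (cong₂ _*_ (ℕ.^-*-assoc Q k k) (ℕ.^-*-assoc Q k k)) (sym (ℕ.^-distribˡ-+-* Q (k * k) (k * k))))))) ⟩
        Q ^ (1 + (k + (k + 2) * k)) * (Q ^ k * (Q ^ k * Q ^ (k * k + k * k)))
          ≡⟨ cong (Q ^ (1 + (k + (k + 2) * k)) *_) (trans (cong (Q ^ k *_) (sym (ℕ.^-distribˡ-+-* Q k _))) (sym (ℕ.^-distribˡ-+-* Q k _))) ⟩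
        Q ^ (1 + (k + (k + 2) * k)) * Q ^ (k + (k + (k * k + k * k)))
          ≡⟨ ℕ.^-distribˡ-+-* Q (1 + (k + (k + 2) * k)) _ ⟨
        Q ^ coefficientExponent k ∎

      base : 3 + 2 * y ≤ Q ^ (3 + coefficientExponent k)
      base = begin
        3 + 2 * y                  ≤⟨ ℕ.+-mono-≤ (ℕ.≤-trans (ℕ.n≤1+n 3) (ℕ.*-monoʳ-≤ 4 (ℕ.m^n>0 Q h))) (ℕ.*-monoʳ-≤ 2 y≤Q) ⟩
        4 * Q ^ h + 2 * Q ^ h      ≤⟨ ℕ.m≤m+n _ (2 * Q ^ h) ⟩
        4 * Q ^ h + 2 * Q ^ h + 2 * Q ^ h ≡⟨ lemma (Q ^ h) ⟩
        2 * (2 * (2 * Q ^ h))      ≤⟨ ℕ.*-monoʳ-≤ 2 (ℕ.*-monoʳ-≤ 2 (2Q^≤ h)) ⟩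
        2 * (2 * Q ^ (1 + h))      ≤⟨ ℕ.*-monoʳ-≤ 2 (2Q^≤ (1 + h)) ⟩
        2 * Q ^ (2 + h)            ≤⟨ 2Q^≤ (2 + h) ⟩
        Q ^ (3 + h)                ∎
        where
        h : ℕ
        h = coefficientExponent k
        lemma : ∀ a → 4 * a + 2 * a + 2 * a ≡ 2 * (2 * (2 * a))
        lemma = ℕSolver.solve-∀

    -- Each prime satisfies Q ≤ 2q ≤ q², so Q^(length qs) is at most the square of the product. This
    -- is the origin of the factor 2.
    length-bound : ∀ {qs} G → All Prime qs → All (λ q → Q ≤ 2 * q) qs → product qs ≤ Q ^ G → length qs ≤ G * 2
    length-bound {qs} G primes Q≤2q product≤ = ℕ.≮⇒≥ λ lt → ℕ.<⇒≱ (ℕ.^-monoʳ-< Q 2≤Q lt) (begin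
      Q ^ length qs        ≤⟨ go primes Q≤2q ⟩
      product qs ^ 2       ≤⟨ ℕ.^-monoˡ-≤ 2 product≤ ⟩
      (Q ^ G) ^ 2          ≡⟨ ℕ.^-*-assoc Q G 2 ⟩
      Q ^ (G * 2)          ∎)
      where
      open ℕ.≤-Reasoning
      go : ∀ {qs} → All Prime qs → All (λ q → Q ≤ 2 * q) qs → Q ^ length qs ≤ product qs ^ 2
      go [] [] = ℕ.≤-refl
      go {q ∷ qs} (q-prime ∷ primes) (Q≤2q ∷ Q≤2qs) = ℕ.≤-trans
        (ℕ.*-mono-≤ (ℕ.≤-trans Q≤2q (ℕ.*-monoˡ-≤ q (prime⇒2≤ q-prime))) (go primes Q≤2qs))
        (ℕ.≤-reflexive (lemma q (product qs)))
        where
        lemma : ∀ q r → q * q * (r * (r * 1)) ≡ q * r * (q * r * 1)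
        lemma = ℕSolver.solve-∀

-- From a solution modulo q to a point at which y vanishes

module Solvability where

  open import Data.Integer.Base using (_*_; _^_; _+_; _-_; -_)

  ^-distribʳ-*ℤ : ∀ a b n → (a * b) ^ n ≡ a ^ n * b ^ n
  ^-distribʳ-*ℤ a b zero    = refl
  ^-distribʳ-*ℤ a b (suc n) = trans (cong (a * b *_) (^-distribʳ-*ℤ a b n)) (lemma a b (a ^ n) (b ^ n))
    where
    lemma : ∀ a b c d → a * b * (c * d) ≡ a * c * (b * d)
    lemma = ℤSolver.solve-∀

  module _ {d : ℤ} where

    mod-*ˡ : ∀ c {x y} → x ≡ y [mod d ] → c * x ≡ c * y [mod d ]
    mod-*ˡ c x≡y = mod-* {x = c} mod-refl x≡y

    mod-*ʳ : ∀ c {x y} → x ≡ y [mod d ] → x * c ≡ y * c [mod d ]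
    mod-*ʳ c x≡y = mod-* {y = c} x≡y mod-refl

    one-^ : ∀ {x} n → x ≡ 1ℤ [mod d ] → x ^ n ≡ 1ℤ [mod d ]
    one-^ n x≡1 = mod-trans (mod-^ n x≡1) (mod-reflexive (ℤ.^-zeroˡ n))

    -- Multiplying by b^(k-1)/j turns the k-th power n j of b into the integer n.
    normalise : ∀ k-1 a b {j j′ n} → j * j′ ≡ 1ℤ [mod d ] → b ^ suc k-1 ≡ n * j [mod d ] →
                (a * b ^ k-1 * j′) ^ suc k-1 ≡ a ^ suc k-1 * j′ * n ^ k-1 [mod d ]
    normalise k-1 a b {j} {j′} {n} jj′≡1 b^k≡nj = begin
      (a * b ^ k-1 * j′) ^ k
        ≡⟨ trans (^-distribʳ-*ℤ (a * b ^ k-1) j′ k) (cong (_* j′ ^ k) (^-distribʳ-*ℤ a (b ^ k-1) k)) ⟩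
      a ^ k * (b ^ k-1) ^ k * j′ ^ k
        ≡⟨ cong (λ x → a ^ k * x * j′ ^ k) (trans (ℤ.^-*-assoc b k-1 k) (trans (cong (b ^_) (ℕ.*-comm k-1 k)) (sym (ℤ.^-*-assoc b k k-1)))) ⟩
      a ^ k * (b ^ k) ^ k-1 * j′ ^ k
        ≈⟨ mod-*ʳ (j′ ^ k) (mod-*ˡ (a ^ k) (mod-^ k-1 b^k≡nj)) ⟩
      a ^ k * (n * j) ^ k-1 * (j′ * j′ ^ k-1)
        ≡⟨ cong (λ x → a ^ k * x * (j′ * j′ ^ k-1)) (^-distribʳ-*ℤ n j k-1) ⟩
      a ^ k * (n ^ k-1 * j ^ k-1) * (j′ * j′ ^ k-1)
        ≡⟨ lemma (a ^ k) (n ^ k-1) (j ^ k-1) j′ (j′ ^ k-1) ⟩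
      (j ^ k-1 * j′ ^ k-1) * (a ^ k * j′ * n ^ k-1)
        ≡⟨ cong (_* (a ^ k * j′ * n ^ k-1)) (^-distribʳ-*ℤ j j′ k-1) ⟨
      (j * j′) ^ k-1 * (a ^ k * j′ * n ^ k-1)
        ≈⟨ mod-*ʳ (a ^ k * j′ * n ^ k-1) (one-^ k-1 jj′≡1) ⟩
      1ℤ * (a ^ k * j′ * n ^ k-1)
        ≡⟨ ℤ.*-identityˡ _ ⟩
      a ^ k * j′ * n ^ k-1 ∎
      where
      open SetoidReasoning (mod-setoid {d})
      k = suc k-1
      lemma : ∀ a n j j′ j″ → a * (n * j) * (j′ * j″) ≡ (j * j″) * (a * j′ * n)
      lemma = ℤSolver.solve-∀

    -- Only j is inverted, never b, so residues b = 0 need no separate treatment.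
    normalise-power : ∀ k-1 a b {j j′ m n} → j * j′ ≡ 1ℤ [mod d ] → b ^ suc k-1 ≡ n * j [mod d ] →
                      a ^ suc k-1 ≡ m * j [mod d ] →
                      (a * b ^ k-1 * j′) ^ suc k-1 ≡ m * n ^ k-1 [mod d ]
    normalise-power k-1 a b {j} {j′} {m} {n} jj′≡1 b^k≡nj a^k≡mj = begin
      (a * b ^ k-1 * j′) ^ suc k-1        ≈⟨ normalise k-1 a b {j} {j′} {n} jj′≡1 b^k≡nj ⟩
      a ^ suc k-1 * j′ * n ^ k-1          ≈⟨ mod-*ʳ (n ^ k-1) (mod-*ʳ j′ a^k≡mj) ⟩
      m * j * j′ * n ^ k-1                ≡⟨ lemma m j j′ (n ^ k-1) ⟩
      (j * j′) * (m * n ^ k-1)            ≈⟨ mod-*ʳ (m * n ^ k-1) jj′≡1 ⟩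
      1ℤ * (m * n ^ k-1)                  ≡⟨ ℤ.*-identityˡ _ ⟩
      m * n ^ k-1                         ∎
      where
      open SetoidReasoning (mod-setoid {d})
      lemma : ∀ m j j′ n → m * j * j′ * n ≡ (j * j′) * (m * n)
      lemma = ℤSolver.solve-∀

    -- For a = b the normalised value itself, and not only its k-th power, is an integer independent
    -- of q. It provides the constant terms of the linear forms `U` and `W`.
    normalise-self : ∀ k-1 b {j j′ n} → j * j′ ≡ 1ℤ [mod d ] → b ^ suc k-1 ≡ n * j [mod d ] →
                     n ≡ b * b ^ k-1 * j′ [mod d ]
    normalise-self k-1 b {j} {j′} {n} jj′≡1 b^k≡nj = begin
      n                    ≡⟨ ℤ.*-identityʳ n ⟨
      n * 1ℤ               ≈⟨ mod-*ˡ n (mod-sym jj′≡1) ⟩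
      n * (j * j′)         ≡⟨ ℤ.*-assoc n j j′ ⟨
      n * j * j′           ≈⟨ mod-*ʳ j′ (mod-sym b^k≡nj) ⟩
      b * b ^ k-1 * j′     ∎
      where open SetoidReasoning (mod-setoid {d})

  -- Arbitrary coefficients sᵢ in place of 1, 1, -1, -1 make the notion stable under permutations of
  -- the four unknowns, so that p may be assumed to divide the leading nᵢ.
  record Solvable (k : ℕ) (s₀ s₁ s₂ s₃ : ℤ) (n₀ n₁ n₂ n₃ q : ℕ) : Set where
    field
      j j′ b₀ b₁ b₂ b₃ : ℤ
      jj′≡1 : j * j′ ≡ 1ℤ [mod + q ]
      sum≡0 : s₀ * b₀ + s₁ * b₁ + s₂ * b₂ + s₃ * b₃ ≡ 0ℤ [mod + q ]
      power₀ : b₀ ^ k ≡ + n₀ * j [mod + q ]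
      power₁ : b₁ ^ k ≡ + n₁ * j [mod + q ]
      power₂ : b₂ ^ k ≡ + n₂ * j [mod + q ]
      power₃ : b₃ ^ k ≡ + n₃ * j [mod + q ]

  record IsSign (s : ℤ) : Set where
    constructor sign
    field square : s * s ≡ 1ℤ
  open IsSign

  sign-abs : ∀ {s} → IsSign s → ∣ s ∣ ≡ 1
  sign-abs {s} (sign s²≡1) = ℕ.m*n≡1⇒m≡1 ∣ s ∣ ∣ s ∣ (trans (sym (ℤ.abs-* s s)) (cong ∣_∣ s²≡1))

  sign-neg : ∀ {s} → IsSign s → IsSign (- s)
  sign-neg {s} (sign s²≡1) = sign (trans (lemma s) s²≡1)
    where
    lemma : ∀ s → - s * - s ≡ s * s
    lemma = ℤSolver.solve-∀

  sign-* : ∀ {s t} → IsSign s → IsSign t → IsSign (s * t)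
  sign-* {s} {t} (sign s²≡1) (sign t²≡1) = sign (trans (lemma s t) (cong₂ _*_ s²≡1 t²≡1))
    where
    lemma : ∀ s t → s * t * (s * t) ≡ (s * s) * (t * t)
    lemma = ℤSolver.solve-∀

  ∤-^ : ∀ {p m} n → Prime p → p ∤ m → p ∤ m ℕ.^ n
  ∤-^ n p-prime p∤m p∣ = p∤m (prime∣^⇒∣ n p-prime p∣)

  ∤-* : ∀ {p m n} → Prime p → p ∤ m → p ∤ n → p ∤ m ℕ.* n
  ∤-* {m = m} {n} p-prime p∤m p∤n p∣ = [ p∤m , p∤n ]′ (euclidsLemma m n p-prime p∣)

  pos-*-^ : ∀ m n e → + (m ℕ.* n ℕ.^ e) ≡ + m * (+ n) ^ e
  pos-*-^ m n e = trans (ℤ.pos-* m (n ℕ.^ e)) (cong (+ m *_) (pos-^ n e))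

  module Cases (k-1 : ℕ) (Q : ℕ) .{{_ : NonZero Q}} (2≤Q : 2 ℕ.≤ Q) where

    k : ℕ
    k = suc k-1

    private
      *-^≤ : ∀ {m n} → m ℕ.≤ Q → n ℕ.≤ Q → m ℕ.* n ℕ.^ k-1 ℕ.≤ Q ℕ.^ k
      *-^≤ m≤Q n≤Q = ℕ.*-mono-≤ m≤Q (ℕ.^-monoˡ-≤ k-1 n≤Q)

      4Q^k≤ : 4 ℕ.* Q ℕ.^ k ℕ.≤ Q ℕ.^ (k ℕ.+ 2)
      4Q^k≤ = ℕ.≤-trans (ℕ.*-monoˡ-≤ (Q ℕ.^ k) (ℕ.^-monoˡ-≤ 2 2≤Q))
        (ℕ.≤-reflexive (trans (ℕ.*-comm (Q ℕ.^ 2) (Q ℕ.^ k)) (sym (ℕ.^-distribˡ-+-* Q k 2))))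

      Q≤Q^k : Q ℕ.≤ Q ℕ.^ k
      Q≤Q^k = ℕ.m≤m*n Q (Q ℕ.^ k-1) {{ℕ.m^n≢0 Q k-1}}

    module _ {qs : List ℕ} (unique : Unique qs) (primes : All Prime qs) (Q≤2q : All (λ q → Q ℕ.≤ 2 ℕ.* q) qs) where

      -- Solve the linear relation for b₀ and multiply by b₁^(k-1)/j. The right side becomes W(x,
      -- y), and the k-th power of the left side is n₀ n₁^(k-1) = c₁ p^e. So U = 1, which can always
      -- be cancelled, and no distinctness of the nᵢ is required.
      singleton : ∀ {p e m₀ n₁ n₂ n₃ s₀ s₁ s₂ s₃} → Prime p → p ∤ k → 0 ℕ.< e → e ℕ.< k →
        p ∤ m₀ → p ∤ n₁ → p ∤ n₂ → p ∤ n₃ →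
        m₀ ℕ.* p ℕ.^ e ℕ.≤ Q → n₁ ℕ.≤ Q → n₂ ℕ.≤ Q → n₃ ℕ.≤ Q →
        IsSign s₀ → IsSign s₁ → IsSign s₂ → IsSign s₃ →
        All (Solvable k s₀ s₁ s₂ s₃ (m₀ ℕ.* p ℕ.^ e) n₁ n₂ n₃) qs → length qs ℕ.≤ exponent k ℕ.* 2
      singleton {p} {e} {m₀} {n₁} {n₂} {n₃} {s₀} {s₁} {s₂} {s₃} p-prime p∤k 0<e e<k p∤m₀ p∤n₁ p∤n₂ p∤n₃
        n₀≤Q n₁≤Q n₂≤Q n₃≤Q s₀-sign s₁-sign s₂-sign s₃-sign solvable =
        F.length-bound (exponent k) primes Q≤2q (ℕ.≤-trans
          (F.product-bound {c₁} {1} {e} (con 1ℤ) W p∤c₁ (prime∤1 p-prime) 0<e e<k (inj₁ F.one-nonZeroDivisor) unique primes solutions)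
          (F.norm-product-bound {_} {F.‖ con 1ℤ ‖} {F.‖ W ‖} {c₁ ℕ.* p ℕ.^ e} {1}
            (ℕ.≤-reflexive (F.‖z‖ {c₁} {1} {e} (con 1ℤ) W p∤c₁ (prime∤1 p-prime) 0<e e<k (inj₁ F.one-nonZeroDivisor) unique primes solutions))
            c₁p^e≤ (ℕ.m^n>0 Q k) (ℕ.m^n>0 Q (k ℕ.+ 2)) ‖W‖≤))
        where
        M M′ c₁ : ℕ
        M = n₂ ℕ.* n₁ ℕ.^ k-1
        M′ = n₃ ℕ.* n₁ ℕ.^ k-1
        c₁ = m₀ ℕ.* n₁ ℕ.^ k-1

        p∤c₁ : p ∤ c₁
        p∤c₁ = ∤-* p-prime p∤m₀ (∤-^ k-1 p-prime p∤n₁)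

        open RadicalRing k M M′ using (Poly; con; X; Y; _⊞_; _⊠_)
        open Evaluation k M M′ using (eval)
        module F = FewPrimes k M M′ p-prime p∤k (∤-* p-prime p∤n₂ (∤-^ k-1 p-prime p∤n₁)) (∤-* p-prime p∤n₃ (∤-^ k-1 p-prime p∤n₁))
                     Q 2≤Q (*-^≤ n₂≤Q n₁≤Q) (*-^≤ n₃≤Q n₁≤Q)

        σ₁ σ₂ σ₃ : ℤ
        σ₁ = - (s₀ * s₁)
        σ₂ = - (s₀ * s₂)
        σ₃ = - (s₀ * s₃)

        W : Poly
        W = con (σ₁ * + n₁) ⊞ con σ₂ ⊠ X ⊞ con σ₃ ⊠ Y

        c₁p^e≡ : c₁ ℕ.* p ℕ.^ e ≡ m₀ ℕ.* p ℕ.^ e ℕ.* n₁ ℕ.^ k-1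
        c₁p^e≡ = lemma m₀ (n₁ ℕ.^ k-1) (p ℕ.^ e)
          where
          lemma : ∀ a b c → a ℕ.* b ℕ.* c ≡ a ℕ.* c ℕ.* b
          lemma = ℕSolver.solve-∀

        c₁p^e≤ : c₁ ℕ.* p ℕ.^ e ℕ.≤ Q ℕ.^ k
        c₁p^e≤ = ℕ.≤-trans (ℕ.≤-reflexive c₁p^e≡) (*-^≤ n₀≤Q n₁≤Q)

        ‖W‖≤ : F.‖ W ‖ ℕ.≤ Q ℕ.^ (k ℕ.+ 2)
        ‖W‖≤ = begin
          ∣ σ₁ * + n₁ ∣ ℕ.+ ∣ σ₂ ∣ ℕ.* Q ℕ.^ k ℕ.+ ∣ σ₃ ∣ ℕ.* Q ℕ.^ k
            ≡⟨ cong₂ ℕ._+_ (cong₂ ℕ._+_ (trans (ℤ.abs-* σ₁ (+ n₁)) (cong (ℕ._* n₁) (sign-abs {σ₁} (sign-neg {s₀ * s₁} (sign-* s₀-sign s₁-sign)))))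
                 (cong (ℕ._* Q ℕ.^ k) (sign-abs {σ₂} (sign-neg {s₀ * s₂} (sign-* s₀-sign s₂-sign)))))
                 (cong (ℕ._* Q ℕ.^ k) (sign-abs {σ₃} (sign-neg {s₀ * s₃} (sign-* s₀-sign s₃-sign)))) ⟩
          1 ℕ.* n₁ ℕ.+ 1 ℕ.* Q ℕ.^ k ℕ.+ 1 ℕ.* Q ℕ.^ k
            ≤⟨ ℕ.+-monoˡ-≤ (1 ℕ.* Q ℕ.^ k) (ℕ.+-monoˡ-≤ (1 ℕ.* Q ℕ.^ k) (ℕ.*-monoʳ-≤ 1 (ℕ.≤-trans n₁≤Q Q≤Q^k))) ⟩
          1 ℕ.* Q ℕ.^ k ℕ.+ 1 ℕ.* Q ℕ.^ k ℕ.+ 1 ℕ.* Q ℕ.^ k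
            ≤⟨ ℕ.m≤m+n _ (Q ℕ.^ k) ⟩
          1 ℕ.* Q ℕ.^ k ℕ.+ 1 ℕ.* Q ℕ.^ k ℕ.+ 1 ℕ.* Q ℕ.^ k ℕ.+ Q ℕ.^ k
            ≡⟨ lemma (Q ℕ.^ k) ⟩
          4 ℕ.* Q ℕ.^ k
            ≤⟨ 4Q^k≤ ⟩
          Q ℕ.^ (k ℕ.+ 2) ∎
          where
          open ℕ.≤-Reasoning
          lemma : ∀ a → 1 ℕ.* a ℕ.+ 1 ℕ.* a ℕ.+ 1 ℕ.* a ℕ.+ a ≡ 4 ℕ.* a
          lemma = ℕSolver.solve-∀

        solution : ∀ {q} → Solvable k s₀ s₁ s₂ s₃ (m₀ ℕ.* p ℕ.^ e) n₁ n₂ n₃ q →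
          ∃[ x ] ∃[ y ] x ^ k ≡ + M [mod + q ] × y ^ k ≡ + M′ [mod + q ] ×
            + (c₁ ℕ.* p ℕ.^ e) * eval (con 1ℤ) x y ^ k ≡ + 1 * eval W x y ^ k [mod + q ]
        solution {q} S = x , y ,
          mod-trans (normalise-power k-1 b₂ b₁ {j} {j′} {+ n₂} {+ n₁} jj′≡1 power₁ power₂) (mod-reflexive (sym (pos-*-^ n₂ n₁ k-1))) ,
          mod-trans (normalise-power k-1 b₃ b₁ {j} {j′} {+ n₃} {+ n₁} jj′≡1 power₁ power₃) (mod-reflexive (sym (pos-*-^ n₃ n₁ k-1))) ,
          (begin
            + (c₁ ℕ.* p ℕ.^ e) * 1ℤ ^ k        ≡⟨ trans (cong (+ (c₁ ℕ.* p ℕ.^ e) *_) (ℤ.^-zeroˡ k)) (ℤ.*-identityʳ (+ (c₁ ℕ.* p ℕ.^ e))) ⟩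
            + (c₁ ℕ.* p ℕ.^ e)                 ≡⟨ trans (cong +_ c₁p^e≡) (pos-*-^ (m₀ ℕ.* p ℕ.^ e) n₁ k-1) ⟩
            + (m₀ ℕ.* p ℕ.^ e) * (+ n₁) ^ k-1  ≈⟨ mod-sym (normalise-power k-1 b₀ b₁ {j} {j′} {+ (m₀ ℕ.* p ℕ.^ e)} {+ n₁} jj′≡1 power₁ power₀) ⟩
            (b₀ * t * j′) ^ k                  ≈⟨ mod-^ k (mod-sym W≡) ⟩
            eval W x y ^ k                     ≡⟨ ℤ.*-identityˡ (eval W x y ^ k) ⟨
            + 1 * eval W x y ^ k               ∎)
          where
          open Solvable S
          open SetoidReasoning (mod-setoid {+ q})
          t x y : ℤ
          t = b₁ ^ k-1
          x = b₂ * t * j′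
          y = b₃ * t * j′

          lemma : ∀ σ₁ σ₂ σ₃ b₁ b₂ b₃ t j → σ₁ * (b₁ * t * j) + σ₂ * (b₂ * t * j) + σ₃ * (b₃ * t * j) ≡ (σ₁ * b₁ + σ₂ * b₂ + σ₃ * b₃) * (t * j)
          lemma = ℤSolver.solve-∀
          lemma₀ : ∀ s₀ s₁ s₂ s₃ b₀ b₁ b₂ b₃ → - (s₀ * s₁) * b₁ + - (s₀ * s₂) * b₂ + - (s₀ * s₃) * b₃ ≡
                   s₀ * s₀ * b₀ + - s₀ * (s₀ * b₀ + s₁ * b₁ + s₂ * b₂ + s₃ * b₃)
          lemma₀ = ℤSolver.solve-∀
          lemma₁ : ∀ s b → 1ℤ * b + - s * 0ℤ ≡ b
          lemma₁ = ℤSolver.solve-∀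

          W≡ : eval W x y ≡ b₀ * t * j′ [mod + q ]
          W≡ = begin
            σ₁ * + n₁ + σ₂ * x + σ₃ * y
              ≈⟨ mod-+ {y = σ₃ * y} (mod-+ {y = σ₂ * x} (mod-*ˡ σ₁ (normalise-self k-1 b₁ {j} {j′} {+ n₁} jj′≡1 power₁)) mod-refl) mod-refl ⟩
            σ₁ * (b₁ * t * j′) + σ₂ * x + σ₃ * y
              ≡⟨ lemma σ₁ σ₂ σ₃ b₁ b₂ b₃ t j′ ⟩
            (σ₁ * b₁ + σ₂ * b₂ + σ₃ * b₃) * (t * j′)
              ≡⟨ cong (_* (t * j′)) (lemma₀ s₀ s₁ s₂ s₃ b₀ b₁ b₂ b₃) ⟩
            (s₀ * s₀ * b₀ + - s₀ * (s₀ * b₀ + s₁ * b₁ + s₂ * b₂ + s₃ * b₃)) * (t * j′)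
              ≈⟨ mod-*ʳ (t * j′) (mod-+ {x = s₀ * s₀ * b₀} (mod-reflexive (cong (_* b₀) (square s₀-sign))) (mod-*ˡ (- s₀) sum≡0)) ⟩
            (1ℤ * b₀ + - s₀ * 0ℤ) * (t * j′)
              ≡⟨ cong (_* (t * j′)) (lemma₁ s₀ b₀) ⟩
            b₀ * (t * j′)
              ≡⟨ ℤ.*-assoc b₀ t j′ ⟨
            b₀ * t * j′ ∎

        solutions : All (λ q → ∃[ x ] ∃[ y ] x ^ k ≡ + M [mod + q ] × y ^ k ≡ + M′ [mod + q ] ×
            + (c₁ ℕ.* p ℕ.^ e) * eval (con 1ℤ) x y ^ k ≡ + 1 * eval W x y ^ k [mod + q ]) qs
        solutions = All.map solution solvable

      -- β = s₀b₀ + s₁b₁ = -(s₂b₂ + s₃b₃) is normalised twice, by b₀ on the left and by b₂ on the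
      -- right. On the left the result is also divided by p, as otherwise p would divide M; this
      -- needs q ≠ p. Then U^k = β^k m₀^(k-1)/(p j) and W^k = β^k n₂^(k-1)/j, so n₂^(k-1) p U^k =
      -- m₀^(k-1) W^k.
      pair : ∀ {p m₀ m₁ n₂ n₃ s₀ s₁ s₂ s₃} → Prime p → p ∤ k → 1 ℕ.< k →
        p ∤ m₀ → p ∤ m₁ → p ∤ n₂ → p ∤ n₃ →
        p ℕ.* m₀ ℕ.≤ Q → p ℕ.* m₁ ℕ.≤ Q → n₂ ℕ.≤ Q → n₃ ℕ.≤ Q →
        IsSign s₀ → IsSign s₁ → IsSign s₂ → IsSign s₃ → m₁ ≢ m₀ ⊎ n₃ ≢ n₂ →
        All (p ≢_) qs →
        All (Solvable k s₀ s₁ s₂ s₃ (p ℕ.* m₀) (p ℕ.* m₁) n₂ n₃) qs → length qs ℕ.≤ exponent k ℕ.* 2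
      pair {p} {m₀} {m₁} {n₂} {n₃} {s₀} {s₁} {s₂} {s₃} p-prime p∤k 1<k p∤m₀ p∤m₁ p∤n₂ p∤n₃
        pm₀≤Q pm₁≤Q n₂≤Q n₃≤Q s₀-sign s₁-sign s₂-sign s₃-sign distinct p≢qs solvable =
        F.length-bound (exponent k) primes Q≤2q (ℕ.≤-trans
          (F.product-bound {c₁} {c₂} {1} U W p∤c₁ p∤c₂ (s≤s z≤n) 1<k nonZeroDivisor unique primes solutions)
          (F.norm-product-bound {_} {F.‖ U ‖} {F.‖ W ‖} {c₁ ℕ.* p ℕ.^ 1} {c₂}
            (ℕ.≤-reflexive (F.‖z‖ {c₁} {c₂} {1} U W p∤c₁ p∤c₂ (s≤s z≤n) 1<k nonZeroDivisor unique primes solutions))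
            c₁p≤ c₂≤ (linear-norm s₀ s₁ s₀-sign s₁-sign m₀≤Q) (linear-norm (- s₂) (- s₃) (sign-neg s₂-sign) (sign-neg s₃-sign) n₂≤Q)))
        where
        M M′ c₁ c₂ : ℕ
        M = m₁ ℕ.* m₀ ℕ.^ k-1
        M′ = n₃ ℕ.* n₂ ℕ.^ k-1
        c₁ = n₂ ℕ.^ k-1
        c₂ = m₀ ℕ.^ k-1

        p∤c₁ : p ∤ c₁
        p∤c₁ = ∤-^ k-1 p-prime p∤n₂

        p∤c₂ : p ∤ c₂
        p∤c₂ = ∤-^ k-1 p-prime p∤m₀

        p∤M : p ∤ M
        p∤M = ∤-* p-prime p∤m₁ p∤c₂

        p∤M′ : p ∤ M′
        p∤M′ = ∤-* p-prime p∤n₃ p∤c₁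

        ∤⇒≢0 : ∀ {m} → p ∤ m → NonZero m
        ∤⇒≢0 p∤m = ℕ.≢-nonZero λ m≡0 → p∤m (subst (p ∣_) (sym m≡0) (p ℕ∣.∣0))

        m₀≤Q : m₀ ℕ.≤ Q
        m₀≤Q = ℕ.≤-trans (ℕ.m≤n*m m₀ p {{prime⇒nonZero p-prime}}) pm₀≤Q

        m₁≤Q : m₁ ℕ.≤ Q
        m₁≤Q = ℕ.≤-trans (ℕ.m≤n*m m₁ p {{prime⇒nonZero p-prime}}) pm₁≤Q

        c₁p≤ : c₁ ℕ.* p ℕ.^ 1 ℕ.≤ Q ℕ.^ k
        c₁p≤ = ℕ.≤-trans (ℕ.*-mono-≤ (ℕ.^-monoˡ-≤ k-1 n₂≤Q)
            (ℕ.≤-trans (ℕ.≤-reflexive (ℕ.*-identityʳ p)) (ℕ.≤-trans (ℕ.m≤m*n p m₀ {{∤⇒≢0 p∤m₀}}) pm₀≤Q)))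
          (ℕ.≤-reflexive (ℕ.*-comm (Q ℕ.^ k-1) Q))

        c₂≤ : c₂ ℕ.≤ Q ℕ.^ k
        c₂≤ = ℕ.≤-trans (ℕ.^-monoˡ-≤ k-1 m₀≤Q) (ℕ.m≤n*m (Q ℕ.^ k-1) Q)

        open RadicalRing k M M′ using (Poly; con; X; Y; _⊞_; _⊠_)
        open Evaluation k M M′ using (eval)
        open NonZeroDivisor k M M′ p-prime p∤k p∤M p∤M′ using (IsNonZeroDivisor)
        module F = FewPrimes k M M′ p-prime p∤k p∤M p∤M′ Q 2≤Q (*-^≤ m₁≤Q m₀≤Q) (*-^≤ n₃≤Q n₂≤Q)

        U W : Poly
        U = con (s₀ * + m₀) ⊞ con s₁ ⊠ X
        W = con (- s₂ * + n₂) ⊞ con (- s₃) ⊠ Y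

        linear-norm : ∀ s t {m} → IsSign s → IsSign t → m ℕ.≤ Q →
                      ∣ s * + m ∣ ℕ.+ ∣ t ∣ ℕ.* Q ℕ.^ k ℕ.≤ Q ℕ.^ (k ℕ.+ 2)
        linear-norm s t {m} s-sign t-sign m≤Q = begin
          ∣ s * + m ∣ ℕ.+ ∣ t ∣ ℕ.* Q ℕ.^ k
            ≡⟨ cong₂ ℕ._+_ (trans (ℤ.abs-* s (+ m)) (cong (ℕ._* m) (sign-abs s-sign))) (cong (ℕ._* Q ℕ.^ k) (sign-abs t-sign)) ⟩
          1 ℕ.* m ℕ.+ 1 ℕ.* Q ℕ.^ k
            ≤⟨ ℕ.+-monoˡ-≤ (1 ℕ.* Q ℕ.^ k) (ℕ.*-monoʳ-≤ 1 (ℕ.≤-trans m≤Q Q≤Q^k)) ⟩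
          1 ℕ.* Q ℕ.^ k ℕ.+ 1 ℕ.* Q ℕ.^ k
            ≤⟨ ℕ.m≤m+n _ (2 ℕ.* Q ℕ.^ k) ⟩
          1 ℕ.* Q ℕ.^ k ℕ.+ 1 ℕ.* Q ℕ.^ k ℕ.+ 2 ℕ.* Q ℕ.^ k
            ≡⟨ lemma (Q ℕ.^ k) ⟩
          4 ℕ.* Q ℕ.^ k
            ≤⟨ 4Q^k≤ ⟩
          Q ℕ.^ (k ℕ.+ 2) ∎
          where
          open ℕ.≤-Reasoning
          lemma : ∀ a → 1 ℕ.* a ℕ.+ 1 ℕ.* a ℕ.+ 2 ℕ.* a ≡ 4 ℕ.* a
          lemma = ℕSolver.solve-∀

        nonZeroDivisor : IsNonZeroDivisor U ⊎ IsNonZeroDivisor W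
        -- X^k = m₁ m₀^(k-1) differs from m₀^k precisely when m₁ ≠ m₀, and likewise for Y; this is
        -- how equality in pairs is avoided.
        nonZeroDivisor = Sum⊎.map
          (λ m₁≢m₀ → F.linear-nonZeroDivisor X {M} {m₀} s₀ s₁ (Reduced.X^k≈M k M M′ p-prime p∤k p∤M p∤M′)
            (λ eq → m₁≢m₀ (ℕ.*-cancelʳ-≡ m₁ m₀ (m₀ ℕ.^ k-1) {{∤⇒≢0 p∤c₂}} eq)) (sign-abs s₀-sign) (square s₁-sign))
          (λ n₃≢n₂ → F.linear-nonZeroDivisor Y {M′} {n₂} (- s₂) (- s₃) (Reduced.Y^k≈M′ k M M′ p-prime p∤k p∤M p∤M′)
            (λ eq → n₃≢n₂ (ℕ.*-cancelʳ-≡ n₃ n₂ (n₂ ℕ.^ k-1) {{∤⇒≢0 p∤c₁}} eq)) (sign-abs (sign-neg s₂-sign)) (square (sign-neg s₃-sign)))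
          distinct

        solution : ∀ {q} → Prime q → p ≢ q → Solvable k s₀ s₁ s₂ s₃ (p ℕ.* m₀) (p ℕ.* m₁) n₂ n₃ q →
          ∃[ x ] ∃[ y ] x ^ k ≡ + M [mod + q ] × y ^ k ≡ + M′ [mod + q ] ×
            + (c₁ ℕ.* p ℕ.^ 1) * eval U x y ^ k ≡ + c₂ * eval W x y ^ k [mod + q ]
        solution {q} q-prime p≢q S = x , y , x^k≡ ,
          mod-trans (normalise-power k-1 b₃ b₂ {j} {j′} {+ n₃} {+ n₂} jj′≡1 power₂ power₃) (mod-reflexive (sym (pos-*-^ n₃ n₂ k-1))) ,
          equation
          where
          open Solvable S
          open SetoidReasoning (mod-setoid {+ q})

          q∤p : q ∤ p
          q∤p q∣p = prime≢⇒∤^ 1 q-prime p-prime p≢q (subst (q ∣_) (sym (ℕ.*-identityʳ p)) q∣p)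

          P p′ β t u x y : ℤ
          P = + p
          p′ = proj₁ (inverse q-prime q∤p)
          β = s₀ * b₀ + s₁ * b₁
          t = b₀ ^ k-1
          u = b₂ ^ k-1
          x = p′ * (b₁ * t * j′)
          y = b₃ * u * j′

          pp′≡1 : P * p′ ≡ 1ℤ [mod + q ]
          pp′≡1 = proj₂ (inverse q-prime q∤p)

          pos-p^ : (+ (p ℕ.* m₀)) ^ k-1 ≡ P ^ k-1 * (+ m₀) ^ k-1
          pos-p^ = trans (cong (_^ k-1) (ℤ.pos-* p m₀)) (^-distribʳ-*ℤ P (+ m₀) k-1)

          x^k≡ : x ^ k ≡ + M [mod + q ]
          x^k≡ = begin
            (p′ * (b₁ * t * j′)) ^ k                    ≡⟨ ^-distribʳ-*ℤ p′ (b₁ * t * j′) k ⟩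
            p′ ^ k * (b₁ * t * j′) ^ k
              ≈⟨ mod-*ˡ (p′ ^ k) (normalise-power k-1 b₁ b₀ {j} {j′} {+ (p ℕ.* m₁)} {+ (p ℕ.* m₀)} jj′≡1 power₀ power₁) ⟩
            p′ ^ k * (+ (p ℕ.* m₁) * (+ (p ℕ.* m₀)) ^ k-1)
              ≡⟨ cong (p′ ^ k *_) (cong₂ _*_ (ℤ.pos-* p m₁) pos-p^) ⟩
            p′ ^ k * (P * + m₁ * (P ^ k-1 * (+ m₀) ^ k-1))
              ≡⟨ lemma (p′ ^ k) P (P ^ k-1) (+ m₁) ((+ m₀) ^ k-1) ⟩
            (P ^ k * p′ ^ k) * (+ m₁ * (+ m₀) ^ k-1)
              ≡⟨ cong (_* (+ m₁ * (+ m₀) ^ k-1)) (^-distribʳ-*ℤ P p′ k) ⟨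
            (P * p′) ^ k * (+ m₁ * (+ m₀) ^ k-1)
              ≈⟨ mod-*ʳ (+ m₁ * (+ m₀) ^ k-1) (one-^ k pp′≡1) ⟩
            1ℤ * (+ m₁ * (+ m₀) ^ k-1)
              ≡⟨ trans (ℤ.*-identityˡ (+ m₁ * (+ m₀) ^ k-1)) (sym (pos-*-^ m₁ m₀ k-1)) ⟩
            + M ∎
            where
            lemma : ∀ a b c d e → a * (b * d * (c * e)) ≡ (b * c * a) * (d * e)
            lemma = ℤSolver.solve-∀

          m₀≡ : + m₀ ≡ p′ * (b₀ * t * j′) [mod + q ]
          m₀≡ = begin
            + m₀                       ≡⟨ ℤ.*-identityˡ (+ m₀) ⟨
            1ℤ * + m₀                  ≈⟨ mod-*ʳ (+ m₀) (mod-sym pp′≡1) ⟩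
            P * p′ * + m₀              ≡⟨ trans (lemma P p′ (+ m₀)) (cong (p′ *_) (sym (ℤ.pos-* p m₀))) ⟩
            p′ * + (p ℕ.* m₀)          ≈⟨ mod-*ˡ p′ (normalise-self k-1 b₀ {j} {j′} {+ (p ℕ.* m₀)} jj′≡1 power₀) ⟩
            p′ * (b₀ * t * j′)         ∎
            where
            lemma : ∀ a b c → a * b * c ≡ b * (a * c)
            lemma = ℤSolver.solve-∀

          U≡ : eval U x y ≡ p′ * (β * t * j′) [mod + q ]
          U≡ = begin
            s₀ * + m₀ + s₁ * x                     ≈⟨ mod-+ {y = s₁ * x} (mod-*ˡ s₀ m₀≡) mod-refl ⟩
            s₀ * (p′ * (b₀ * t * j′)) + s₁ * x     ≡⟨ lemma s₀ s₁ p′ b₀ b₁ t j′ ⟩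
            p′ * (β * t * j′)                      ∎
            where
            lemma : ∀ s₀ s₁ p b₀ b₁ t j → s₀ * (p * (b₀ * t * j)) + s₁ * (p * (b₁ * t * j)) ≡ p * ((s₀ * b₀ + s₁ * b₁) * t * j)
            lemma = ℤSolver.solve-∀

          β≡ : - s₂ * b₂ + - s₃ * b₃ ≡ β [mod + q ]
          β≡ = begin
            - s₂ * b₂ + - s₃ * b₃      ≡⟨ lemma s₀ s₁ s₂ s₃ b₀ b₁ b₂ b₃ ⟩
            β + - (s₀ * b₀ + s₁ * b₁ + s₂ * b₂ + s₃ * b₃)
              ≡⟨ cong (_+_ β) (sym (ℤ.-1*i≡-i (s₀ * b₀ + s₁ * b₁ + s₂ * b₂ + s₃ * b₃))) ⟩
            β + -1ℤ * (s₀ * b₀ + s₁ * b₁ + s₂ * b₂ + s₃ * b₃)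
              ≈⟨ mod-+ {x = β} mod-refl (mod-*ˡ -1ℤ sum≡0) ⟩
            β + 0ℤ                     ≡⟨ ℤ.+-identityʳ β ⟩
            β                          ∎
            where
            lemma : ∀ s₀ s₁ s₂ s₃ b₀ b₁ b₂ b₃ → - s₂ * b₂ + - s₃ * b₃ ≡
                    (s₀ * b₀ + s₁ * b₁) + - (s₀ * b₀ + s₁ * b₁ + s₂ * b₂ + s₃ * b₃)
            lemma = ℤSolver.solve-∀

          W≡ : eval W x y ≡ β * u * j′ [mod + q ]
          W≡ = begin
            - s₂ * + n₂ + - s₃ * y                 ≈⟨ mod-+ {y = - s₃ * y} (mod-*ˡ (- s₂) (normalise-self k-1 b₂ {j} {j′} {+ n₂} jj′≡1 power₂)) mod-refl ⟩
            - s₂ * (b₂ * u * j′) + - s₃ * y        ≡⟨ lemma (- s₂) (- s₃) b₂ b₃ u j′ ⟩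
            (- s₂ * b₂ + - s₃ * b₃) * (u * j′)     ≈⟨ mod-*ʳ (u * j′) β≡ ⟩
            β * (u * j′)                           ≡⟨ ℤ.*-assoc β u j′ ⟨
            β * u * j′                             ∎
            where
            lemma : ∀ s r b c u j → s * (b * u * j) + r * (c * u * j) ≡ (s * b + r * c) * (u * j)
            lemma = ℤSolver.solve-∀

          equation : + (c₁ ℕ.* p ℕ.^ 1) * eval U x y ^ k ≡ + c₂ * eval W x y ^ k [mod + q ]
          equation = begin
            + (c₁ ℕ.* p ℕ.^ 1) * eval U x y ^ k
              ≡⟨ cong (_* eval U x y ^ k) (trans (cong (λ n → + (c₁ ℕ.* n)) (ℕ.*-identityʳ p)) (trans (ℤ.pos-* c₁ p) (cong (_* P) (pos-^ n₂ k-1)))) ⟩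
            (+ n₂) ^ k-1 * P * eval U x y ^ k
              ≈⟨ mod-*ˡ ((+ n₂) ^ k-1 * P) (mod-^ k U≡) ⟩
            (+ n₂) ^ k-1 * P * (p′ * (β * t * j′)) ^ k
              ≡⟨ cong ((+ n₂) ^ k-1 * P *_) (^-distribʳ-*ℤ p′ (β * t * j′) k) ⟩
            (+ n₂) ^ k-1 * P * (p′ ^ k * (β * t * j′) ^ k)
              ≈⟨ mod-*ˡ ((+ n₂) ^ k-1 * P) (mod-*ˡ (p′ ^ k) (normalise k-1 β b₀ {j} {j′} {+ (p ℕ.* m₀)} jj′≡1 power₀)) ⟩
            (+ n₂) ^ k-1 * P * (p′ ^ k * (β ^ k * j′ * (+ (p ℕ.* m₀)) ^ k-1))
              ≡⟨ cong (λ z → (+ n₂) ^ k-1 * P * (p′ ^ k * (β ^ k * j′ * z))) pos-p^ ⟩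
            (+ n₂) ^ k-1 * P * (p′ ^ k * (β ^ k * j′ * (P ^ k-1 * (+ m₀) ^ k-1)))
              ≡⟨ lemma ((+ n₂) ^ k-1) P (p′ ^ k) (β ^ k) j′ (P ^ k-1) ((+ m₀) ^ k-1) ⟩
            (P ^ k * p′ ^ k) * ((+ m₀) ^ k-1 * (β ^ k * j′ * (+ n₂) ^ k-1))
              ≡⟨ cong (_* ((+ m₀) ^ k-1 * (β ^ k * j′ * (+ n₂) ^ k-1))) (^-distribʳ-*ℤ P p′ k) ⟨
            (P * p′) ^ k * ((+ m₀) ^ k-1 * (β ^ k * j′ * (+ n₂) ^ k-1))
              ≈⟨ mod-*ʳ ((+ m₀) ^ k-1 * (β ^ k * j′ * (+ n₂) ^ k-1)) (one-^ k pp′≡1) ⟩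
            1ℤ * ((+ m₀) ^ k-1 * (β ^ k * j′ * (+ n₂) ^ k-1))
              ≡⟨ ℤ.*-identityˡ ((+ m₀) ^ k-1 * (β ^ k * j′ * (+ n₂) ^ k-1)) ⟩
            (+ m₀) ^ k-1 * (β ^ k * j′ * (+ n₂) ^ k-1)
              ≈⟨ mod-*ˡ ((+ m₀) ^ k-1) (mod-sym (normalise k-1 β b₂ {j} {j′} {+ n₂} jj′≡1 power₂)) ⟩
            (+ m₀) ^ k-1 * (β * u * j′) ^ k
              ≈⟨ mod-*ˡ ((+ m₀) ^ k-1) (mod-^ k (mod-sym W≡)) ⟩
            (+ m₀) ^ k-1 * eval W x y ^ k
              ≡⟨ cong (_* eval W x y ^ k) (pos-^ m₀ k-1) ⟨
            + c₂ * eval W x y ^ k ∎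
            where
            lemma : ∀ n p a b j c m → n * p * (a * (b * j * (c * m))) ≡ (p * c * a) * (m * (b * j * n))
            lemma = ℤSolver.solve-∀

        solutions : All (λ q → ∃[ x ] ∃[ y ] x ^ k ≡ + M [mod + q ] × y ^ k ≡ + M′ [mod + q ] ×
            + (c₁ ℕ.* p ℕ.^ 1) * eval U x y ^ k ≡ + c₂ * eval W x y ^ k [mod + q ]) qs
        solutions = All.zipWith (λ (q-prime , p≢q , S) → solution q-prime p≢q S)
          (primes , All.zipWith id (p≢qs , solvable))

open Solvability

-- Choosing p and moving its multiples to the front

module FewBadPrimes where

  module Transpositions where

    open import Data.Integer.Base using (_*_; _+_)

    module _ {k : ℕ} {s₀ s₁ s₂ s₃ : ℤ} {n₀ n₁ n₂ n₃ q : ℕ} (S : Solvable k s₀ s₁ s₂ s₃ n₀ n₁ n₂ n₃ q) where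

      open Solvable S

      private
        reorder : ∀ {x} → s₀ * b₀ + s₁ * b₁ + s₂ * b₂ + s₃ * b₃ ≡ x → x ≡ 0ℤ [mod + q ]
        reorder eq = mod-trans (mod-reflexive (sym eq)) sum≡0

      swap₀₁ : Solvable k s₁ s₀ s₂ s₃ n₁ n₀ n₂ n₃ q
      swap₀₁ = record
        { jj′≡1 = jj′≡1 ; power₀ = power₁ ; power₁ = power₀ ; power₂ = power₂ ; power₃ = power₃
        ; sum≡0 = reorder (lemma (s₀ * b₀) (s₁ * b₁) (s₂ * b₂) (s₃ * b₃)) }
        where
        lemma : ∀ a b c d → a + b + c + d ≡ b + a + c + d
        lemma = ℤSolver.solve-∀

      swap₀₂ : Solvable k s₂ s₁ s₀ s₃ n₂ n₁ n₀ n₃ q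
      swap₀₂ = record
        { jj′≡1 = jj′≡1 ; power₀ = power₂ ; power₁ = power₁ ; power₂ = power₀ ; power₃ = power₃
        ; sum≡0 = reorder (lemma (s₀ * b₀) (s₁ * b₁) (s₂ * b₂) (s₃ * b₃)) }
        where
        lemma : ∀ a b c d → a + b + c + d ≡ c + b + a + d
        lemma = ℤSolver.solve-∀

      swap₀₃ : Solvable k s₃ s₁ s₂ s₀ n₃ n₁ n₂ n₀ q
      swap₀₃ = record
        { jj′≡1 = jj′≡1 ; power₀ = power₃ ; power₁ = power₁ ; power₂ = power₂ ; power₃ = power₀
        ; sum≡0 = reorder (lemma (s₀ * b₀) (s₁ * b₁) (s₂ * b₂) (s₃ * b₃)) }
        where
        lemma : ∀ a b c d → a + b + c + d ≡ d + b + c + a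
        lemma = ℤSolver.solve-∀

      swap₁₂ : Solvable k s₀ s₂ s₁ s₃ n₀ n₂ n₁ n₃ q
      swap₁₂ = record
        { jj′≡1 = jj′≡1 ; power₀ = power₀ ; power₁ = power₂ ; power₂ = power₁ ; power₃ = power₃
        ; sum≡0 = reorder (lemma (s₀ * b₀) (s₁ * b₁) (s₂ * b₂) (s₃ * b₃)) }
        where
        lemma : ∀ a b c d → a + b + c + d ≡ a + c + b + d
        lemma = ℤSolver.solve-∀

      swap₁₃ : Solvable k s₀ s₃ s₂ s₁ n₀ n₃ n₂ n₁ q
      swap₁₃ = record
        { jj′≡1 = jj′≡1 ; power₀ = power₀ ; power₁ = power₃ ; power₂ = power₂ ; power₃ = power₁
        ; sum≡0 = reorder (lemma (s₀ * b₀) (s₁ * b₁) (s₂ * b₂) (s₃ * b₃)) }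
        where
        lemma : ∀ a b c d → a + b + c + d ≡ a + d + c + b
        lemma = ℤSolver.solve-∀

  open Transpositions
  open import Data.Nat.Base using (_+_; _*_; _^_; _≤_; _<_)

  full? : ∀ m p → Dec (Prime p → p ∣ m → p ^ 3 ∣ m)
  full? m p = prime? p →-dec (p ∣? m →-dec p ^ 3 ∣? m)

  -- A witness can be extracted from the negation because prime divisors of m are at most m and the
  -- condition at each of them is decidable.
  ¬cubeFull⇒ : ∀ m .{{_ : NonZero m}} → ¬ CubeFull m → ∃[ p ] Prime p × p ∣ m × p ^ 3 ∤ m
  ¬cubeFull⇒ m ¬full with all? (full? m) (upTo (suc m))
  ... | yes full = contradiction (λ {p} p-prime p∣m → All.lookup full (∈-upTo⁺ (s≤s (ℕ∣.∣⇒≤ p∣m))) p-prime p∣m) ¬full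
  ... | no ¬all = witness (Any.satisfied (All.¬All⇒Any¬ (full? m) (upTo (suc m)) ¬all))
    where
    witness : ∃[ p ] ¬ (Prime p → p ∣ m → p ^ 3 ∣ m) → ∃[ p ] Prime p × p ∣ m × p ^ 3 ∤ m
    witness (p , ¬full-p) with prime? p | p ∣? m
    ... | yes p-prime | yes p∣m = p , p-prime , p∣m , λ p^3∣m → ¬full-p λ _ _ → p^3∣m
    ... | no ¬p-prime | _       = contradiction (λ p-prime _ → contradiction p-prime ¬p-prime) ¬full-p
    ... | yes _       | no p∤m  = contradiction (λ _ p∣m → contradiction p∣m p∤m) ¬full-p

  Exact : ℕ → ℕ → ℕ → Set
  Exact p e n = ∃[ m ] n ≡ p ^ e * m × p ∤ m

  exact₀⇒∤ : ∀ {p n} → Exact p 0 n → p ∤ n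
  exact₀⇒∤ {p} (m , n≡m , p∤m) p∣n = p∤m (subst (p ∣_) (trans n≡m (ℕ.*-identityˡ m)) p∣n)

  exact-* : ∀ {p e e′ n n′} → Prime p → Exact p e n → Exact p e′ n′ → Exact p (e + e′) (n * n′)
  exact-* {p} {e} {e′} p-prime (m , refl , p∤m) (m′ , refl , p∤m′) = m * m′ ,
    trans (lemma (p ^ e) m (p ^ e′) m′) (cong (_* (m * m′)) (sym (ℕ.^-distribˡ-+-* p e e′))) , ∤-* p-prime p∤m p∤m′
    where
    lemma : ∀ a b c d → a * b * (c * d) ≡ a * c * (b * d)
    lemma = ℕSolver.solve-∀

  data Shape : ℕ → ℕ → ℕ → ℕ → Set where
    single₀ : ∀ {e} → 0 < e → e ≤ 2 → Shape e 0 0 0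
    single₁ : ∀ {e} → 0 < e → e ≤ 2 → Shape 0 e 0 0
    single₂ : ∀ {e} → 0 < e → e ≤ 2 → Shape 0 0 e 0
    single₃ : ∀ {e} → 0 < e → e ≤ 2 → Shape 0 0 0 e
    pair₀₁  : Shape 1 1 0 0
    pair₀₂  : Shape 1 0 1 0
    pair₀₃  : Shape 1 0 0 1
    pair₁₂  : Shape 0 1 1 0
    pair₁₃  : Shape 0 1 0 1
    pair₂₃  : Shape 0 0 1 1

  shape : ∀ a b c d → 0 < a + (b + (c + d)) → a + (b + (c + d)) ≤ 2 → Shape a b c d
  shape 0 0 0 d 0<e e≤2 = single₃ 0<e e≤2
  shape 0 0 1 0 0<e e≤2 = single₂ 0<e e≤2
  shape 0 0 1 1 0<e e≤2 = pair₂₃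
  shape 0 0 1 (suc (suc d)) 0<e (s≤s (s≤s ()))
  shape 0 0 2 0 0<e e≤2 = single₂ 0<e e≤2
  shape 0 0 2 (suc d) 0<e (s≤s (s≤s ()))
  shape 0 0 (suc (suc (suc c))) d 0<e (s≤s (s≤s ()))
  shape 0 1 0 0 0<e e≤2 = single₁ 0<e e≤2
  shape 0 1 0 1 0<e e≤2 = pair₁₃
  shape 0 1 0 (suc (suc d)) 0<e (s≤s (s≤s ()))
  shape 0 1 1 0 0<e e≤2 = pair₁₂
  shape 0 1 1 (suc d) 0<e (s≤s (s≤s ()))
  shape 0 1 (suc (suc c)) d 0<e (s≤s (s≤s ()))
  shape 0 2 0 0 0<e e≤2 = single₁ 0<e e≤2
  shape 0 2 0 (suc d) 0<e (s≤s (s≤s ()))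
  shape 0 2 (suc c) d 0<e (s≤s (s≤s ()))
  shape 0 (suc (suc (suc b))) c d 0<e (s≤s (s≤s ()))
  shape 1 0 0 0 0<e e≤2 = single₀ 0<e e≤2
  shape 1 0 0 1 0<e e≤2 = pair₀₃
  shape 1 0 0 (suc (suc d)) 0<e (s≤s (s≤s ()))
  shape 1 0 1 0 0<e e≤2 = pair₀₂
  shape 1 0 1 (suc d) 0<e (s≤s (s≤s ()))
  shape 1 0 (suc (suc c)) d 0<e (s≤s (s≤s ()))
  shape 1 1 0 0 0<e e≤2 = pair₀₁
  shape 1 1 0 (suc d) 0<e (s≤s (s≤s ()))
  shape 1 1 (suc c) d 0<e (s≤s (s≤s ()))
  shape 1 (suc (suc b)) c d 0<e (s≤s (s≤s ()))
  shape 2 0 0 0 0<e e≤2 = single₀ 0<e e≤2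
  shape 2 0 0 (suc d) 0<e (s≤s (s≤s ()))
  shape 2 0 (suc c) d 0<e (s≤s (s≤s ()))
  shape 2 (suc b) c d 0<e (s≤s (s≤s ()))
  shape (suc (suc (suc a))) b c d 0<e (s≤s (s≤s ()))

  module _ (k-1 : ℕ) (3≤k : 3 ≤ suc k-1) (Q : ℕ) .{{_ : NonZero Q}} (2≤Q : 2 ≤ Q)
           {qs : List ℕ} (unique : Unique qs) (primes : All Prime qs) (Q≤2q : All (λ q → Q ≤ 2 * q) qs) where

    open Cases k-1 Q 2≤Q

    private
      bound : ℕ
      bound = suc (exponent k * 2)

    isolated : ∀ {p e n₀ n₁ n₂ n₃ s₀ s₁ s₂ s₃} → Prime p → p ∤ k → 0 < e → e ≤ 2 →
      Exact p e n₀ → p ∤ n₁ → p ∤ n₂ → p ∤ n₃ → n₀ ≤ Q → n₁ ≤ Q → n₂ ≤ Q → n₃ ≤ Q →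
      IsSign s₀ → IsSign s₁ → IsSign s₂ → IsSign s₃ →
      All (Solvable k s₀ s₁ s₂ s₃ n₀ n₁ n₂ n₃) qs → length qs ≤ bound
    isolated {p} {e} {n₁ = n₁} {n₂} {n₃} {s₀} {s₁} {s₂} {s₃} p-prime p∤k 0<e e≤2 (m , n₀≡ , p∤m) p∤n₁ p∤n₂ p∤n₃ n₀≤Q n₁≤Q n₂≤Q n₃≤Q
      sign₀ sign₁ sign₂ sign₃ solvable = ℕ.m≤n⇒m≤1+n
        (singleton unique primes Q≤2q p-prime p∤k 0<e (ℕ.<-≤-trans (s≤s e≤2) 3≤k) p∤m p∤n₁ p∤n₂ p∤n₃
          (subst (_≤ Q) n₀≡′ n₀≤Q) n₁≤Q n₂≤Q n₃≤Q sign₀ sign₁ sign₂ sign₃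
          (subst (λ n → All (Solvable k s₀ s₁ s₂ s₃ n n₁ n₂ n₃) qs) n₀≡′ solvable))
      where
      n₀≡′ = trans n₀≡ (ℕ.*-comm (p ^ e) m)

    -- The prime p may itself occur in `qs`, where it cannot be inverted. It is removed beforehand
    -- and accounted for by the extra one in `bound`.
    paired : ∀ {p n₀ n₁ n₂ n₃ s₀ s₁ s₂ s₃} → Prime p → p ∤ k →
      Exact p 1 n₀ → Exact p 1 n₁ → p ∤ n₂ → p ∤ n₃ → n₀ ≤ Q → n₁ ≤ Q → n₂ ≤ Q → n₃ ≤ Q →
      IsSign s₀ → IsSign s₁ → IsSign s₂ → IsSign s₃ → ¬ (n₀ ≡ n₁ × n₂ ≡ n₃) →
      All (Solvable k s₀ s₁ s₂ s₃ n₀ n₁ n₂ n₃) qs → length qs ≤ bound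
    paired {p} {n₀} {n₁} {n₂} {n₃} {s₀} {s₁} {s₂} {s₃} p-prime p∤k (m₀ , n₀≡ , p∤m₀) (m₁ , n₁≡ , p∤m₁) p∤n₂ p∤n₃ n₀≤Q n₁≤Q n₂≤Q n₃≤Q
      sign₀ sign₁ sign₂ sign₃ distinct solvable = ℕ.≤-trans length-qs≤ (s≤s
        (pair {filter p≢? qs} (Unique.filter⁺ p≢? unique) (All.filter⁺ p≢? primes) (All.filter⁺ p≢? Q≤2q)
          p-prime p∤k (ℕ.<-≤-trans (s≤s (s≤s z≤n)) 3≤k) p∤m₀ p∤m₁ p∤n₂ p∤n₃
          (subst (_≤ Q) n₀≡′ n₀≤Q) (subst (_≤ Q) n₁≡′ n₁≤Q) n₂≤Q n₃≤Q sign₀ sign₁ sign₂ sign₃ distinct′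
          (All.all-filter p≢? qs)
          (All.filter⁺ p≢? (subst (λ n → All (Solvable k s₀ s₁ s₂ s₃ (p * m₀) n n₂ n₃) qs) n₁≡′
            (subst (λ n → All (Solvable k s₀ s₁ s₂ s₃ n n₁ n₂ n₃) qs) n₀≡′ solvable)))))
      where
      p≢? : ∀ q → Dec (p ≢ q)
      p≢? q = ¬? (p ℕ.≟ q)

      n₀≡′ : n₀ ≡ p * m₀
      n₀≡′ = trans n₀≡ (cong (_* m₀) (ℕ.*-identityʳ p))
      n₁≡′ : n₁ ≡ p * m₁
      n₁≡′ = trans n₁≡ (cong (_* m₁) (ℕ.*-identityʳ p))

      distinct′ : m₁ ≢ m₀ ⊎ n₃ ≢ n₂
      distinct′ with m₁ ℕ.≟ m₀ | n₃ ℕ.≟ n₂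
      ... | no m₁≢m₀  | _         = inj₁ m₁≢m₀
      ... | yes _     | no n₃≢n₂  = inj₂ n₃≢n₂
      ... | yes m₁≡m₀ | yes n₃≡n₂ = contradiction (trans n₀≡′ (trans (cong (p *_) (sym m₁≡m₀)) (sym n₁≡′)) , sym n₃≡n₂) distinct

      length-qs≤ : length qs ≤ suc (length (filter p≢? qs))
      length-qs≤ = unique-⊆⇒length≤ unique cover
        where
        cover : ∀ {q} → q ∈ qs → q ∈ p ∷ filter p≢? qs
        cover {q} q∈ with p ℕ.≟ q
        ... | yes p≡q = here (sym p≡q)
        ... | no  p≢q = there (∈-filter⁺ p≢? q∈ p≢q)

    few-solvable-primes : ∀ {n₀ n₁ n₂ n₃} .{{_ : NonZero n₀}} .{{_ : NonZero n₁}} .{{_ : NonZero n₂}} .{{_ : NonZero n₃}} →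
      n₀ ≤ Q → n₁ ≤ Q → n₂ ≤ Q → n₃ ≤ Q → ¬ CubeFull (k ^ 3 * (n₀ * (n₁ * (n₂ * n₃)))) →
      ¬ (n₀ ≡ n₁ × n₂ ≡ n₃) → ¬ (n₀ ≡ n₂ × n₁ ≡ n₃) → ¬ (n₀ ≡ n₃ × n₁ ≡ n₂) →
      All (Solvable k 1ℤ 1ℤ -1ℤ -1ℤ n₀ n₁ n₂ n₃) qs → length qs ≤ bound
    few-solvable-primes {n₀} {n₁} {n₂} {n₃} {{n₀≢0}} {{n₁≢0}} {{n₂≢0}} {{n₃≢0}} n₀≤Q n₁≤Q n₂≤Q n₃≤Q ¬full ¬₀₁ ¬₀₂ ¬₀₃ solvable =
      by-shape (shape e₀ e₁ e₂ e₃ 0<e e≤2) (proj₂ x₀) (proj₂ x₁) (proj₂ x₂) (proj₂ x₃)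
      where
      Π : ℕ
      Π = n₀ * (n₁ * (n₂ * n₃))

      k^3≢0 : NonZero (k ^ 3)
      k^3≢0 = ℕ.m^n≢0 k 3

      Π≢0 : NonZero Π
      Π≢0 = ℕ.m*n≢0 n₀ (n₁ * (n₂ * n₃)) {{n₀≢0}} {{ℕ.m*n≢0 n₁ (n₂ * n₃) {{n₁≢0}} {{ℕ.m*n≢0 n₂ n₃ {{n₂≢0}} {{n₃≢0}}}}}}

      deficient : ∃[ p ] Prime p × p ∣ k ^ 3 * Π × p ^ 3 ∤ k ^ 3 * Π
      deficient = ¬cubeFull⇒ (k ^ 3 * Π) {{ℕ.m*n≢0 (k ^ 3) Π {{k^3≢0}} {{Π≢0}}}} ¬full

      p : ℕ
      p = proj₁ deficient

      p-prime : Prime p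
      p-prime = proj₁ (proj₂ deficient)

      p^3∤ : p ^ 3 ∤ k ^ 3 * Π
      p^3∤ = proj₂ (proj₂ (proj₂ deficient))

      -- The purpose of the factor k³: a prime divisor of k occurs in the product at least three
      -- times, so it cannot be the deficient prime.
      p∤k : p ∤ k
      p∤k (ℕ∣.divides t k≡tp) = p^3∤ (ℕ∣.∣m⇒∣m*n Π (ℕ∣.divides (t ^ 3) (trans (cong (_^ 3) k≡tp) (^-distribʳ-* t p 3))))

      p∣Π : p ∣ Π
      p∣Π = [ (λ p∣k^3 → contradiction (prime∣^⇒∣ 3 p-prime p∣k^3) p∤k) , id ]′
        (euclidsLemma (k ^ 3) Π p-prime (proj₁ (proj₂ (proj₂ deficient))))

      exact : ∀ n .{{_ : NonZero n}} → ∃[ e ] Exact p e n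
      exact n with e , m , n≡ , p∤m , _ ← extract-power p n (prime⇒2≤ p-prime) = e , m , n≡ , p∤m

      x₀ = exact n₀
      x₁ = exact n₁
      x₂ = exact n₂
      x₃ = exact n₃
      e₀ = proj₁ x₀
      e₁ = proj₁ x₁
      e₂ = proj₁ x₂
      e₃ = proj₁ x₃

      exactΠ : Exact p (e₀ + (e₁ + (e₂ + e₃))) Π
      exactΠ = exact-* {p} {e₀} p-prime (proj₂ x₀) (exact-* {p} {e₁} p-prime (proj₂ x₁) (exact-* {p} {e₂} p-prime (proj₂ x₂) (proj₂ x₃)))

      0<e : 0 < e₀ + (e₁ + (e₂ + e₃))
      0<e = ℕ.≮⇒≥ λ e<1 → exact₀⇒∤ (subst (λ e → Exact p e Π) (ℕ.n<1⇒n≡0 e<1) exactΠ) p∣Π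

      e≤2 : e₀ + (e₁ + (e₂ + e₃)) ≤ 2
      e≤2 = ℕ.≮⇒≥ λ 3≤e → p^3∤ (ℕ∣.∣n⇒∣m*n (k ^ 3) (subst (p ^ 3 ∣_) (sym (proj₁ (proj₂ exactΠ)))
        (ℕ∣.∣m⇒∣m*n (proj₁ exactΠ) (^-monoʳ-∣ p 3≤e))))

      pos : IsSign 1ℤ
      pos = sign refl

      neg : IsSign -1ℤ
      neg = sign refl

      -- Transpositions bring the multiples of p to the front, carrying the signs along. For a pair
      -- only one coincidence has to be excluded, the one matching the two multiples of p with each
      -- other; any other pairing would equate a multiple of p with a non-multiple.
      by-shape : ∀ {e₀ e₁ e₂ e₃} → Shape e₀ e₁ e₂ e₃ → Exact p e₀ n₀ → Exact p e₁ n₁ → Exact p e₂ n₂ → Exact p e₃ n₃ →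
                 length qs ≤ bound
      by-shape (single₀ 0<e e≤2) y₀ y₁ y₂ y₃ = isolated p-prime p∤k 0<e e≤2 y₀ (exact₀⇒∤ y₁) (exact₀⇒∤ y₂) (exact₀⇒∤ y₃)
        n₀≤Q n₁≤Q n₂≤Q n₃≤Q pos pos neg neg solvable
      by-shape (single₁ 0<e e≤2) y₀ y₁ y₂ y₃ = isolated p-prime p∤k 0<e e≤2 y₁ (exact₀⇒∤ y₀) (exact₀⇒∤ y₂) (exact₀⇒∤ y₃)
        n₁≤Q n₀≤Q n₂≤Q n₃≤Q pos pos neg neg (All.map swap₀₁ solvable)
      by-shape (single₂ 0<e e≤2) y₀ y₁ y₂ y₃ = isolated p-prime p∤k 0<e e≤2 y₂ (exact₀⇒∤ y₁) (exact₀⇒∤ y₀) (exact₀⇒∤ y₃)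
        n₂≤Q n₁≤Q n₀≤Q n₃≤Q neg pos pos neg (All.map swap₀₂ solvable)
      by-shape (single₃ 0<e e≤2) y₀ y₁ y₂ y₃ = isolated p-prime p∤k 0<e e≤2 y₃ (exact₀⇒∤ y₁) (exact₀⇒∤ y₂) (exact₀⇒∤ y₀)
        n₃≤Q n₁≤Q n₂≤Q n₀≤Q neg pos neg pos (All.map swap₀₃ solvable)
      by-shape pair₀₁ y₀ y₁ y₂ y₃ = paired p-prime p∤k y₀ y₁ (exact₀⇒∤ y₂) (exact₀⇒∤ y₃)
        n₀≤Q n₁≤Q n₂≤Q n₃≤Q pos pos neg neg ¬₀₁ solvable
      by-shape pair₀₂ y₀ y₁ y₂ y₃ = paired p-prime p∤k y₀ y₂ (exact₀⇒∤ y₁) (exact₀⇒∤ y₃)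
        n₀≤Q n₂≤Q n₁≤Q n₃≤Q pos neg pos neg ¬₀₂ (All.map swap₁₂ solvable)
      by-shape pair₀₃ y₀ y₁ y₂ y₃ = paired p-prime p∤k y₀ y₃ (exact₀⇒∤ y₂) (exact₀⇒∤ y₁)
        n₀≤Q n₃≤Q n₂≤Q n₁≤Q pos neg neg pos (λ (eq , eq′) → ¬₀₃ (eq , sym eq′)) (All.map swap₁₃ solvable)
      by-shape pair₁₂ y₀ y₁ y₂ y₃ = paired p-prime p∤k y₂ y₁ (exact₀⇒∤ y₀) (exact₀⇒∤ y₃)
        n₂≤Q n₁≤Q n₀≤Q n₃≤Q neg pos pos neg (λ (eq , eq′) → ¬₀₃ (eq′ , sym eq)) (All.map swap₀₂ solvable)
      by-shape pair₁₃ y₀ y₁ y₂ y₃ = paired p-prime p∤k y₃ y₁ (exact₀⇒∤ y₂) (exact₀⇒∤ y₀)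
        n₃≤Q n₁≤Q n₂≤Q n₀≤Q neg pos neg pos (λ (eq , eq′) → ¬₀₂ (sym eq′ , sym eq)) (All.map swap₀₃ solvable)
      by-shape pair₂₃ y₀ y₁ y₂ y₃ = paired p-prime p∤k y₂ y₃ (exact₀⇒∤ y₀) (exact₀⇒∤ y₁)
        n₂≤Q n₃≤Q n₀≤Q n₁≤Q neg neg pos pos (λ (eq , eq′) → ¬₀₁ (eq′ , eq)) (All.map swap₁₃ (All.map swap₀₂ solvable))

open FewBadPrimes

-- The energy on average over q

module ListSums where

  open import Data.Nat.ListAction using (sum)
  open import Data.Nat.Base using (_+_; _*_; _≤_)

  ∑ : ∀ {A : Set} → List A → (A → ℕ) → ℕ
  ∑ xs f = sum (map f xs)

  module _ {A : Set} where

    ∑-mono : ∀ (xs : List A) {f g} → (∀ {x} → x ∈ xs → f x ≤ g x) → ∑ xs f ≤ ∑ xs g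
    ∑-mono []       f≤g = z≤n
    ∑-mono (x ∷ xs) f≤g = ℕ.+-mono-≤ (f≤g (here refl)) (∑-mono xs (f≤g ∘ there))

    ∑-bound : ∀ (xs : List A) {f b} → (∀ {x} → x ∈ xs → f x ≤ b) → ∑ xs f ≤ length xs * b
    ∑-bound []       f≤b = z≤n
    ∑-bound (x ∷ xs) f≤b = ℕ.+-mono-≤ (f≤b (here refl)) (∑-bound xs (f≤b ∘ there))

    ∑-+ : ∀ (xs : List A) (f g : A → ℕ) → ∑ xs (λ x → f x + g x) ≡ ∑ xs f + ∑ xs g
    ∑-+ []       f g = refl
    ∑-+ (x ∷ xs) f g = trans (cong (_+_ (f x + g x)) (∑-+ xs f g)) (lemma (f x) (g x) (∑ xs f) (∑ xs g))
      where
      lemma : ∀ a b c d → a + b + (c + d) ≡ a + c + (b + d)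
      lemma = ℕSolver.solve-∀

    ∑-zero : ∀ (xs : List A) → ∑ xs (λ _ → 0) ≡ 0
    ∑-zero []       = refl
    ∑-zero (x ∷ xs) = ∑-zero xs

    ∑-split : ∀ {P : A → Set} (P? : Decidable P) (xs : List A) {f a b} →
              (∀ {x} → x ∈ xs → P x → f x ≤ b) → (∀ {x} → x ∈ xs → ¬ P x → f x ≤ a) →
              ∑ xs f ≤ length xs * a + length (filter P? xs) * b
    ∑-split P? [] _ _ = z≤n
    ∑-split P? (x ∷ xs) {f} {a} {b} f≤b f≤a with P? x
    ... | yes Px = ℕ.≤-trans (ℕ.+-mono-≤ (f≤b (here refl) Px) (∑-split P? xs (f≤b ∘ there) (f≤a ∘ there)))
      (ℕ.≤-trans (ℕ.m≤n+m _ a) (ℕ.≤-reflexive (lemma a b (length xs * a) (length (filter P? xs) * b))))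
      where
      lemma : ∀ a b c d → a + (b + (c + d)) ≡ a + c + (b + d)
      lemma = ℕSolver.solve-∀
    ... | no ¬Px = ℕ.≤-trans (ℕ.+-mono-≤ (f≤a (here refl) ¬Px) (∑-split P? xs (f≤b ∘ there) (f≤a ∘ there)))
      (ℕ.≤-reflexive (sym (ℕ.+-assoc a (length xs * a) _)))

    length-concatMap : ∀ {B : Set} (f : A → List B) xs → length (concatMap f xs) ≡ ∑ xs (length ∘ f)
    length-concatMap f []       = refl
    length-concatMap f (x ∷ xs) = trans (length-++ (f x)) (cong (_+_ (length (f x))) (length-concatMap f xs))

  ∑-swap : ∀ {A B : Set} (xs : List A) (ys : List B) (f : A → B → ℕ) →
           ∑ xs (λ x → ∑ ys (f x)) ≡ ∑ ys (λ y → ∑ xs (λ x → f x y))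
  ∑-swap []       ys f = sym (∑-zero ys)
  ∑-swap (x ∷ xs) ys f = trans (cong (_+_ (∑ ys (f x))) (∑-swap xs ys f))
    (sym (∑-+ ys (f x) (λ y → ∑ xs (λ x → f x y))))

open ListSums

module Boxes where

  Box : Set
  Box = ℕ × ℕ × ℕ × ℕ

  box : ℕ → List Box
  box N = fourfold (map suc (upTo N))

  ∈-fourfold⁻ : ∀ (xs : List ℕ) {a b c d} → (a , b , c , d) ∈ fourfold xs → a ∈ xs × b ∈ xs × c ∈ xs × d ∈ xs
  ∈-fourfold⁻ xs ∈₁ = proj₁ split₁ , proj₁ split₂ , split₃
    where
    split₁ = ∈-cartesianProduct⁻ xs (cartesianProduct xs (cartesianProduct xs xs)) ∈₁
    split₂ = ∈-cartesianProduct⁻ xs (cartesianProduct xs xs) (proj₂ split₁)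
    split₃ = ∈-cartesianProduct⁻ xs xs (proj₂ split₂)

open Boxes

module Exceptional (k : ℕ) .{{_ : NonZero k}} where

  open import Data.Nat.Base using (_+_; _*_; _^_; _≤_; _<_)

  exceptionalConstant : ℕ
  exceptionalConstant = proj₁ (cubeFull-bound k) * k ^ 3 + 3

  exceptional : ∀ N → ∃[ L ] length L ≤ exceptionalConstant * N ^ 2 ×
    (∀ {n₁ n₂ n₃ n₄} → (n₁ , n₂ , n₃ , n₄) ∈ box N →
      CubeFull (k ^ 3 * (n₁ * (n₂ * (n₃ * n₄)))) ⊎ (n₁ ≡ n₂ × n₃ ≡ n₄) ⊎ (n₁ ≡ n₃ × n₂ ≡ n₄) ⊎ (n₁ ≡ n₄ × n₂ ≡ n₃) →
      (n₁ , n₂ , n₃ , n₄) ∈ L)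
  exceptional N = L ++ map diag₁ R² ++ map diag₂ R² ++ map diag₃ R² , length≤ , cover
    where
    L : List Box
    L = proj₁ (cubeFullQuadruples k N)
    length-L = proj₁ (proj₂ (cubeFullQuadruples k N))
    L-cover = proj₂ (proj₂ (cubeFullQuadruples k N))
    R : List ℕ
    R = map suc (upTo N)
    R² : List (ℕ × ℕ)
    R² = cartesianProduct R R
    diag₁ diag₂ diag₃ : ℕ × ℕ → Box
    diag₁ (a , b) = a , a , b , b
    diag₂ (a , b) = a , b , a , b
    diag₃ (a , b) = a , b , b , a

    length-R² : ∀ f → length (map {B = Box} f R²) ≡ N ^ 2
    length-R² f = trans (length-map f R²) (trans (length-cartesianProductWith _,_ R R)
      (cong₂ _*_ length-R (trans length-R (sym (ℕ.*-identityʳ N)))))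
      where
      length-R : length R ≡ N
      length-R = trans (length-map suc (upTo N)) (length-upTo N)

    length≤ : length (L ++ map diag₁ R² ++ map diag₂ R² ++ map diag₃ R²) ≤ exceptionalConstant * N ^ 2
    length≤ = begin
      length (L ++ map diag₁ R² ++ map diag₂ R² ++ map diag₃ R²)
        ≡⟨ trans (length-++ L) (cong (_+_ (length L)) (trans (length-++ (map diag₁ R²)) (cong₂ _+_ (length-R² diag₁)
             (trans (length-++ (map diag₂ R²)) (cong₂ _+_ (length-R² diag₂) (length-R² diag₃)))))) ⟩
      length L + (N ^ 2 + (N ^ 2 + N ^ 2))
        ≤⟨ ℕ.+-monoˡ-≤ (N ^ 2 + (N ^ 2 + N ^ 2)) length-L ⟩
      κ * k ^ 3 * N ^ 2 + (N ^ 2 + (N ^ 2 + N ^ 2))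
        ≡⟨ lemma (κ * k ^ 3) (N ^ 2) ⟩
      exceptionalConstant * N ^ 2 ∎
      where
      open ℕ.≤-Reasoning
      κ = proj₁ (cubeFull-bound k)
      lemma : ∀ c n → c * n + (n + (n + n)) ≡ (c + 3) * n
      lemma = ℕSolver.solve-∀

    ∈R : ∀ {n} → n ∈ R → NonZero n × n ≤ N
    ∈R n∈ with i , i∈ , refl ← ∈-map⁻ suc n∈ = _ , ∈-upTo⁻ i∈

    cover : ∀ {n₁ n₂ n₃ n₄} → (n₁ , n₂ , n₃ , n₄) ∈ box N →
      CubeFull (k ^ 3 * (n₁ * (n₂ * (n₃ * n₄)))) ⊎ (n₁ ≡ n₂ × n₃ ≡ n₄) ⊎ (n₁ ≡ n₃ × n₂ ≡ n₄) ⊎ (n₁ ≡ n₄ × n₂ ≡ n₃) →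
      (n₁ , n₂ , n₃ , n₄) ∈ L ++ map diag₁ R² ++ map diag₂ R² ++ map diag₃ R²
    cover n∈ e with ∈-fourfold⁻ R n∈
    cover n∈ (inj₁ full) | n₁∈ , n₂∈ , n₃∈ , n₄∈ =
      ∈-++⁺ˡ (L-cover {{proj₁ (∈R n₁∈)}} {{proj₁ (∈R n₂∈)}} {{proj₁ (∈R n₃∈)}} {{proj₁ (∈R n₄∈)}}
        (proj₂ (∈R n₁∈)) (proj₂ (∈R n₂∈)) (proj₂ (∈R n₃∈)) (proj₂ (∈R n₄∈)) full)
    cover n∈ (inj₂ (inj₁ (refl , refl))) | n₁∈ , n₂∈ , n₃∈ , n₄∈ =
      ∈-++⁺ʳ L (∈-++⁺ˡ (∈-map⁺ diag₁ (∈-cartesianProduct⁺ n₁∈ n₃∈)))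
    cover n∈ (inj₂ (inj₂ (inj₁ (refl , refl)))) | n₁∈ , n₂∈ , n₃∈ , n₄∈ =
      ∈-++⁺ʳ L (∈-++⁺ʳ (map diag₁ R²) (∈-++⁺ˡ (∈-map⁺ diag₂ (∈-cartesianProduct⁺ n₁∈ n₂∈))))
    cover n∈ (inj₂ (inj₂ (inj₂ (refl , refl)))) | n₁∈ , n₂∈ , n₃∈ , n₄∈ =
      ∈-++⁺ʳ L (∈-++⁺ʳ (map diag₁ R²) (∈-++⁺ʳ (map diag₂ R²) (∈-map⁺ diag₃ (∈-cartesianProduct⁺ n₁∈ n₂∈))))

module Energy (k-1 : ℕ) (3≤k : 3 ℕ.≤ suc k-1) where

  open import Data.Nat.Base using (_+_; _*_; _^_; _≤_; _<_)

  private
    k : ℕ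
    k = suc k-1

  open Exceptional k

  roots : ∀ {q} → Fin q → ℕ → List (Fin q)
  roots j n = kthRoots k (reduce j (n * toℕ j))

  Balanced : ∀ {q} → Quadruple q → Set
  Balanced (b₁ , b₂ , b₃ , b₄) = b₁ ⊕ b₂ ≡ b₃ ⊕ b₄

  balanced? : ∀ {q} (b : Quadruple q) → Dec (Balanced b)
  balanced? (b₁ , b₂ , b₃ , b₄) = b₁ ⊕ b₂ Fin.≟ b₃ ⊕ b₄

  candidates fibre : ∀ {q} → Fin q → Box → List (Quadruple q)
  candidates j (n₁ , n₂ , n₃ , n₄) =
    cartesianProduct (roots j n₁) (cartesianProduct (roots j n₂) (cartesianProduct (roots j n₃) (roots j n₄)))
  fibre j n = filter balanced? (candidates j n)

  ∈-roots⁻ : ∀ {q} {j b : Fin q} {n} → b ∈ roots j n → b ^ᶠ k ≡ reduce j (n * toℕ j)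
  ∈-roots⁻ {q} {j} {n = n} b∈ = proj₂ (∈-filter⁻ (λ b → b ^ᶠ k Fin.≟ reduce j (n * toℕ j)) {xs = allFin q} b∈)

  -- In general only an inequality: N may exceed q, and then one residue is n j for several n.
  E≤∑fibre : ∀ N {q} (j : Fin q) → E k N j ≤ ∑ (box N) (λ n → length (fibre j n))
  E≤∑fibre N {q} j = ℕ.≤-trans
    (unique-⊆⇒length≤ (Unique.filter⁺ (counted? k N j) (Unique.cartesianProduct⁺ F! (Unique.cartesianProduct⁺ F! (Unique.cartesianProduct⁺ F! F!)))) cover)
    (ℕ.≤-reflexive (length-concatMap (fibre j) (box N)))
    where
    F! : Unique (allFin q)
    F! = Unique.allFin⁺ q

    locate-root : ∀ {b} → b ^ᶠ k ∈ multiples N j → ∃[ n ] n ∈ map suc (upTo N) × b ∈ roots j n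
    locate-root {b} b∈ with i , i∈ , eq ← ∈-map⁻ (λ n → reduce j (suc n * toℕ j)) b∈ =
      suc i , ∈-map⁺ suc i∈ , ∈-filter⁺ (λ b → b ^ᶠ k Fin.≟ reduce j (suc i * toℕ j)) (∈-allFin b) eq

    locate : ∀ b → Counted k N j b → b ∈ concatMap (fibre j) (box N)
    locate (b₁ , b₂ , b₃ , b₄) (balanced , c₁ ∷ c₂ ∷ c₃ ∷ c₄ ∷ [])
      with n₁ , n₁∈ , b₁∈ ← locate-root c₁ | n₂ , n₂∈ , b₂∈ ← locate-root c₂ | n₃ , n₃∈ , b₃∈ ← locate-root c₃ | n₄ , n₄∈ , b₄∈ ← locate-root c₄ =
      ∈-concatMap⁺ (fibre j) (lose (∈-fourfold⁺ n₁∈ n₂∈ n₃∈ n₄∈)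
        (∈-filter⁺ balanced? (∈-cartesianProduct⁺ b₁∈ (∈-cartesianProduct⁺ b₂∈ (∈-cartesianProduct⁺ b₃∈ b₄∈))) balanced))

    cover : ∀ {b} → b ∈ filter (counted? k N j) (quadruples q) → b ∈ concatMap (fibre j) (box N)
    cover {b} b∈ = locate b (proj₂ (∈-filter⁻ (counted? k N j) {xs = quadruples q} b∈))

  length-fibre : ∀ {q} → Prime q → (j : Fin q) (n : Box) → length (fibre j n) ≤ k ^ 4
  length-fibre q-prime j n@(n₁ , n₂ , n₃ , n₄) = ℕ.≤-trans (length-filter balanced? (candidates j n)) (ℕ.≤-trans
    (ℕ.≤-reflexive (trans (length-cartesianProductWith _,_ (roots j n₁) _) (cong (length (roots j n₁) *_)
      (trans (length-cartesianProductWith _,_ (roots j n₂) _) (cong (length (roots j n₂) *_)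
        (length-cartesianProductWith _,_ (roots j n₃) (roots j n₄)))))))
    (ℕ.*-mono-≤ (≤k n₁) (ℕ.*-mono-≤ (≤k n₂) (ℕ.*-mono-≤ (≤k n₃) (ℕ.≤-trans (≤k n₄) (ℕ.≤-reflexive (sym (ℕ.*-identityʳ k))))))))
    where
    ≤k : ∀ n → length (roots j n) ≤ k
    ≤k n = length-kthRoots q-prime k (reduce j (n * toℕ j))

  SolvableAt : ℕ → Box → Set
  SolvableAt q (n₁ , n₂ , n₃ , n₄) = Solvable k 1ℤ 1ℤ -1ℤ -1ℤ n₁ n₂ n₃ n₄ q

  fibre⇒solvable : ∀ {q} → Prime q → (j : Fin q) → toℕ j ≢ 0 → (n : Box) → 0 < length (fibre j n) → SolvableAt q n
  fibre⇒solvable {q} q-prime j j≢0 n@(n₁ , n₂ , n₃ , n₄) 0<length = nonempty (fibre j n) id 0<length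
    where
    build : ∀ b → b ∈ candidates j n → Balanced b → SolvableAt q n
    build b@(b₁ , b₂ , b₃ , b₄) b∈ balanced
      with b₁∈ , b∈′ ← ∈-cartesianProduct⁻ (roots j n₁) _ b∈
      with b₂∈ , b∈″ ← ∈-cartesianProduct⁻ (roots j n₂) _ b∈′
      with b₃∈ , b₄∈ ← ∈-cartesianProduct⁻ (roots j n₃) (roots j n₄) b∈″ = record
        { j = toℤ j ; j′ = proj₁ inv ; b₀ = toℤ b₁ ; b₁ = toℤ b₂ ; b₂ = toℤ b₃ ; b₃ = toℤ b₄
        ; jj′≡1 = proj₂ inv
        ; sum≡0 = mod-trans (mod-reflexive (lemma (toℤ b₁) (toℤ b₂) (toℤ b₃) (toℤ b₄)))
                    (mod-diff (subst (ℤ.+ q ℤ∣.∣_) (sym (ℤ.+-identityʳ _)) (difference (⊕-≡⇒mod b₁ b₂ b₃ b₄ balanced))))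
        ; power₀ = ^ᶠ-≡⇒mod b₁ j k n₁ (∈-roots⁻ {j = j} {n = n₁} b₁∈)
        ; power₁ = ^ᶠ-≡⇒mod b₂ j k n₂ (∈-roots⁻ {j = j} {n = n₂} b₂∈)
        ; power₂ = ^ᶠ-≡⇒mod b₃ j k n₃ (∈-roots⁻ {j = j} {n = n₃} b₃∈)
        ; power₃ = ^ᶠ-≡⇒mod b₄ j k n₄ (∈-roots⁻ {j = j} {n = n₄} b₄∈) }
      where
      inv = inverse q-prime (ℕ∣.>⇒∤ {{ℕ.≢-nonZero j≢0}} (Fin.toℕ<n j))
      lemma : ∀ a b c d → 1ℤ ℤ.* a ℤ.+ 1ℤ ℤ.* b ℤ.+ -1ℤ ℤ.* c ℤ.+ -1ℤ ℤ.* d ≡ (a ℤ.+ b) ℤ.- (c ℤ.+ d)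
      lemma = ℤSolver.solve-∀

    nonempty : ∀ xs → (∀ {b} → b ∈ xs → b ∈ fibre j n) → 0 < length xs → SolvableAt q n
    nonempty (b ∷ _) xs⊆ _ with b∈ , balanced ← ∈-filter⁻ balanced? {xs = candidates j n} (xs⊆ (here refl)) =
      build b b∈ balanced

  -- Fixing a maximising j for each q replaces the maximum by a sum over n, after which the
  -- summations over q and n can be exchanged. Whether the fibre over n is non-empty is then a
  -- question about n and q alone.
  record Weight (N q : ℕ) : Set where
    field
      weight   : Box → ℕ
      maxE≤    : maxE k N q ≤ ∑ (box N) weight
      weight≤  : Prime q → ∀ n → weight n ≤ k ^ 4
      solvable : Prime q → ∀ n → 0 < weight n → SolvableAt q n
  open Weight

  weights : ∀ N q → Weight N q
  weights N q with argmax-sel id 0 (map (E k N) (units q))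
  -- The maximum is the base value 0, possibly without any maximising j; zero weights suffice.
  ... | inj₁ max≡0 = record
    { weight = λ _ → 0 ; maxE≤ = ℕ.≤-trans (ℕ.≤-reflexive max≡0) z≤n
    ; weight≤ = λ _ _ → z≤n ; solvable = λ _ _ () }
  ... | inj₂ max∈ with j , j∈ , max≡ ← ∈-map⁻ (E k N) max∈ = record
    { weight = λ n → length (fibre j n)
    ; maxE≤ = ℕ.≤-trans (ℕ.≤-reflexive max≡) (E≤∑fibre N j)
    ; weight≤ = λ q-prime → length-fibre q-prime j
    ; solvable = λ q-prime → fibre⇒solvable q-prime j (proj₂ (∈-filter⁻ (λ j → ¬? (toℕ j ℕ.≟ 0)) {xs = allFin q} j∈)) }

  primeBound : ℕ
  primeBound = suc (exponent k * 2)

  sumMaxE≤ : ∀ Q N .{{_ : NonZero Q}} → N ≤ Q →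
    sumMaxE k N Q ≤ N ^ 4 * (k ^ 4 * primeBound) + exceptionalConstant * N ^ 2 * (length (dyadicPrimes Q) * k ^ 4)
  sumMaxE≤ Q N N≤Q = begin
    ∑ D (maxE k N)                                              ≤⟨ ∑-mono D (λ {q} _ → maxE≤ (weights N q)) ⟩
    ∑ D (λ q → ∑ (box N) (w q))                                 ≡⟨ ∑-swap D (box N) w ⟩
    ∑ (box N) (λ n → ∑ D (λ q → w q n))                         ≤⟨ ∑-split (_∈? L) (box N) (λ {n} _ _ → all-primes n) (λ {n} → generic n) ⟩
    length (box N) * (k ^ 4 * primeBound) + length (filter (_∈? L) (box N)) * (length D * k ^ 4)
      ≤⟨ ℕ.+-mono-≤ (ℕ.≤-reflexive (cong (_* (k ^ 4 * primeBound)) length-box)) (ℕ.*-monoˡ-≤ (length D * k ^ 4) (ℕ.≤-trans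
           (unique-⊆⇒length≤ (Unique.filter⁺ (_∈? L) box-unique) (λ n∈ → proj₂ (∈-filter⁻ (_∈? L) {xs = box N} n∈))) length-L)) ⟩
    N ^ 4 * (k ^ 4 * primeBound) + exceptionalConstant * N ^ 2 * (length D * k ^ 4) ∎
    where
    open ℕ.≤-Reasoning
    open DecMembership (Product.≡-dec ℕ._≟_ (Product.≡-dec ℕ._≟_ (Product.≡-dec ℕ._≟_ ℕ._≟_))) using (_∈?_)

    L : List Box
    L = proj₁ (exceptional N)
    length-L = proj₁ (proj₂ (exceptional N))
    L-cover = proj₂ (proj₂ (exceptional N))

    D : List ℕ
    D = dyadicPrimes Q

    w : ℕ → Box → ℕ
    w q = weight (weights N q)

    length-box : length (box N) ≡ N ^ 4
    length-box = trans (length-fourfold (map suc (upTo N))) (cong (_^ 4) (trans (length-map suc (upTo N)) (length-upTo N)))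

    box-unique : Unique (box N)
    box-unique = Unique.cartesianProduct⁺ R! (Unique.cartesianProduct⁺ R! (Unique.cartesianProduct⁺ R! R!))
      where
      R! : Unique (map suc (upTo N))
      R! = Unique.map⁺ ℕ.suc-injective (Unique.upTo⁺ N)

    prime-D : ∀ {q} → q ∈ D → Prime q
    prime-D q∈ = proj₂ (proj₂ (∈-dyadicPrimes⁻ {Q} q∈))

    all-primes : ∀ n → ∑ D (λ q → w q n) ≤ length D * k ^ 4
    all-primes n = ∑-bound D λ {q} q∈ → weight≤ (weights N q) (prime-D q∈) n

    generic : ∀ n → n ∈ box N → ¬ n ∈ L → ∑ D (λ q → w q n) ≤ k ^ 4 * primeBound
    generic n@(n₁ , n₂ , n₃ , n₄) n∈ n∉L = begin
      ∑ D (λ q → w q n)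
        ≤⟨ ∑-split positive? D {f = λ q → w q n} {0} {k ^ 4} (λ {q} q∈ _ → weight≤ (weights N q) (prime-D q∈) n) (λ _ w≯0 → ℕ.≮⇒≥ w≯0) ⟩
      length D * 0 + length (filter positive? D) * k ^ 4
        ≡⟨ cong (_+ length (filter positive? D) * k ^ 4) (ℕ.*-zeroʳ (length D)) ⟩
      length (filter positive? D) * k ^ 4
        ≤⟨ ℕ.*-monoˡ-≤ (k ^ 4) (few (filter positive? D) refl) ⟩
      primeBound * k ^ 4
        ≡⟨ ℕ.*-comm primeBound (k ^ 4) ⟩
      k ^ 4 * primeBound ∎
      where
      positive? : ∀ q → Dec (0 < w q n)
      positive? q = 0 ℕ.<? w q n

      member : ∀ {q} → q ∈ filter positive? D → q ∈ D × 0 < w q n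
      member q∈ = ∈-filter⁻ positive? {xs = D} q∈

      in-box : ∀ {m} → m ∈ map suc (upTo N) → NonZero m × m ≤ Q
      in-box m∈ with i , i∈ , refl ← ∈-map⁻ suc m∈ = _ , ℕ.≤-trans (∈-upTo⁻ i∈) N≤Q

      coordinates = ∈-fourfold⁻ (map suc (upTo N)) n∈
      n₁∈ = in-box (proj₁ coordinates)
      n₂∈ = in-box (proj₁ (proj₂ coordinates))
      n₃∈ = in-box (proj₁ (proj₂ (proj₂ coordinates)))
      n₄∈ = in-box (proj₂ (proj₂ (proj₂ coordinates)))

      few : ∀ qs → filter positive? D ≡ qs → length qs ≤ primeBound
      few []       _  = z≤n
      -- A prime in the list supplies 2 ≤ q < Q, hence the hypothesis 2 ≤ Q; the empty list covers Q
      -- = 1.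
      few (q ∷ qs) eq = few-solvable-primes k-1 3≤k Q 2≤Q
        (subst Unique eq (Unique.filter⁺ positive? (dyadicPrimes-unique Q)))
        (All.tabulate λ q∈ → prime-D (proj₁ (at q∈)))
        (All.tabulate λ q∈ → proj₁ (proj₂ (∈-dyadicPrimes⁻ {Q} (proj₁ (at q∈)))))
        {{proj₁ n₁∈}} {{proj₁ n₂∈}} {{proj₁ n₃∈}} {{proj₁ n₄∈}}
        (proj₂ n₁∈) (proj₂ n₂∈) (proj₂ n₃∈) (proj₂ n₄∈)
        (λ full → n∉L (L-cover n∈ (inj₁ full)))
        (λ eqs → n∉L (L-cover n∈ (inj₂ (inj₁ eqs))))
        (λ eqs → n∉L (L-cover n∈ (inj₂ (inj₂ (inj₁ eqs)))))
        (λ eqs → n∉L (L-cover n∈ (inj₂ (inj₂ (inj₂ eqs)))))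
        (All.tabulate λ {q} q∈ → solvable (weights N q) (prime-D (proj₁ (at q∈))) n (proj₂ (at q∈)))
        where
        at : ∀ {p} → p ∈ q ∷ qs → p ∈ D × 0 < w p n
        at p∈ = member (subst (_ ∈_) (sym eq) p∈)
        2≤Q : 2 ≤ Q
        2≤Q = ℕ.≤-trans (prime⇒2≤ (prime-D (proj₁ (at (here refl))))) (ℕ.<⇒≤ (proj₁ (∈-dyadicPrimes⁻ {Q} (proj₁ (at (here refl))))))

  -- The factor 2 + ⌊log₂ Q⌋ is multiplied in before dividing by Q. For exceptional n it is absorbed
  -- by Chebyshev's bound, with 5Q in its place; for the other n the number of primes is already
  -- O(1), so it stays.
  energy-bound : ∃[ c ] ∀ Q N .{{_ : NonZero Q}} → N ≤ Q →
    (2 + proj₁ (log₂ Q)) * sumMaxE k N Q ≤ c * (N ^ 2 * Q + N ^ 4 * (2 + proj₁ (log₂ Q)))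
  energy-bound = a + b , λ Q N N≤Q → let r = 2 + proj₁ (log₂ Q) in begin
    r * sumMaxE k N Q
      ≤⟨ ℕ.*-monoʳ-≤ r (sumMaxE≤ Q N N≤Q) ⟩
    r * (N ^ 4 * (k ^ 4 * primeBound) + exceptionalConstant * N ^ 2 * (length (dyadicPrimes Q) * k ^ 4))
      ≡⟨ lemma r (N ^ 4) (k ^ 4) primeBound exceptionalConstant (N ^ 2) (length (dyadicPrimes Q)) ⟩
    a * (N ^ 4 * r) + exceptionalConstant * N ^ 2 * k ^ 4 * (r * length (dyadicPrimes Q))
      ≤⟨ ℕ.+-monoʳ-≤ (a * (N ^ 4 * r)) (ℕ.*-monoʳ-≤ (exceptionalConstant * N ^ 2 * k ^ 4) (length-dyadicPrimes Q)) ⟩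
    a * (N ^ 4 * r) + exceptionalConstant * N ^ 2 * k ^ 4 * (5 * Q)
      ≤⟨ ℕ.m≤m+n _ (a * (N ^ 2 * Q) + b * (N ^ 4 * r)) ⟩
    a * (N ^ 4 * r) + exceptionalConstant * N ^ 2 * k ^ 4 * (5 * Q) + (a * (N ^ 2 * Q) + b * (N ^ 4 * r))
      ≡⟨ lemma′ a (N ^ 4 * r) exceptionalConstant (N ^ 2) (k ^ 4) Q ⟩
    (a + b) * (N ^ 2 * Q + N ^ 4 * r) ∎
    where
    open ℕ.≤-Reasoning
    a b : ℕ
    a = k ^ 4 * primeBound
    b = exceptionalConstant * k ^ 4 * 5
    lemma : ∀ r n k p x m l → r * (n * (k * p) + x * m * (l * k)) ≡ (k * p) * (n * r) + x * m * k * (r * l)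
    lemma = ℕSolver.solve-∀
    lemma′ : ∀ a n x m k q → a * n + x * m * k * (5 * q) + (a * (m * q) + x * k * 5 * n) ≡ (a + x * k * 5) * (m * q + n)
    lemma′ = ℕSolver.solve-∀

-- Logarithms and rational bounds

module RationalBounds where

  open import Data.Rational.Base using (ℚ; 0ℚ; 1ℚ; _+_; _*_; _-_; -_; _≤_; _<_)
  open import Data.Integer.Base using (+_)

  toℚᵘ-fromℕ : ∀ n → ℚ.toℚᵘ (fromℕ n) ℚᵘ.≃ mkℚᵘ (+ n) 0
  toℚᵘ-fromℕ n = ℚ.toℚᵘ-fromℚᵘ (mkℚᵘ (+ n) 0)

  fromℕ-+ : ∀ m n → fromℕ (m ℕ.+ n) ≡ fromℕ m + fromℕ n
  fromℕ-+ m n = ℚ.toℚᵘ-injective (begin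
    ℚ.toℚᵘ (fromℕ (m ℕ.+ n))                    ≈⟨ toℚᵘ-fromℕ (m ℕ.+ n) ⟩
    mkℚᵘ (+ (m ℕ.+ n)) 0                        ≈⟨ *≡* (cong (ℤ._* + 1) (trans (ℤ.pos-+ m n) (sym (cong₂ ℤ._+_ (ℤ.*-identityʳ (+ m)) (ℤ.*-identityʳ (+ n)))))) ⟩
    mkℚᵘ (+ m) 0 ℚᵘ.+ mkℚᵘ (+ n) 0              ≈⟨ ℚᵘ.+-cong (ℚᵘ.≃-sym (toℚᵘ-fromℕ m)) (ℚᵘ.≃-sym (toℚᵘ-fromℕ n)) ⟩
    ℚ.toℚᵘ (fromℕ m) ℚᵘ.+ ℚ.toℚᵘ (fromℕ n)      ≈⟨ ℚᵘ.≃-sym (ℚ.toℚᵘ-homo-+ (fromℕ m) (fromℕ n)) ⟩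
    ℚ.toℚᵘ (fromℕ m + fromℕ n)                  ∎)
    where open ℚᵘ.≃-Reasoning

  fromℕ-* : ∀ m n → fromℕ (m ℕ.* n) ≡ fromℕ m * fromℕ n
  fromℕ-* m n = ℚ.toℚᵘ-injective (begin
    ℚ.toℚᵘ (fromℕ (m ℕ.* n))                    ≈⟨ toℚᵘ-fromℕ (m ℕ.* n) ⟩
    mkℚᵘ (+ (m ℕ.* n)) 0                        ≈⟨ *≡* (cong (ℤ._* + 1) (ℤ.pos-* m n)) ⟩
    mkℚᵘ (+ m) 0 ℚᵘ.* mkℚᵘ (+ n) 0              ≈⟨ ℚᵘ.*-cong (ℚᵘ.≃-sym (toℚᵘ-fromℕ m)) (ℚᵘ.≃-sym (toℚᵘ-fromℕ n)) ⟩
    ℚ.toℚᵘ (fromℕ m) ℚᵘ.* ℚ.toℚᵘ (fromℕ n)      ≈⟨ ℚᵘ.≃-sym (ℚ.toℚᵘ-homo-* (fromℕ m) (fromℕ n)) ⟩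
    ℚ.toℚᵘ (fromℕ m * fromℕ n)                  ∎)
    where open ℚᵘ.≃-Reasoning

  fromℕ-^ : ∀ m n → fromℕ (m ℕ.^ n) ≡ fromℕ m ^ℚ n
  fromℕ-^ m zero    = refl
  fromℕ-^ m (suc n) = trans (fromℕ-* m (m ℕ.^ n)) (cong (fromℕ m *_) (fromℕ-^ m n))

  recip-* : ∀ n .{{_ : NonZero n}} → recip n * fromℕ n ≡ 1ℚ
  recip-* (suc n) = ℚ.toℚᵘ-injective (begin
    ℚ.toℚᵘ (recip (suc n) * fromℕ (suc n))      ≈⟨ ℚ.toℚᵘ-homo-* (recip (suc n)) (fromℕ (suc n)) ⟩
    ℚ.toℚᵘ (recip (suc n)) ℚᵘ.* ℚ.toℚᵘ (fromℕ (suc n))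
      ≈⟨ ℚᵘ.*-cong (ℚ.toℚᵘ-fromℚᵘ (mkℚᵘ (+ 1) n)) (toℚᵘ-fromℕ (suc n)) ⟩
    mkℚᵘ (+ 1) n ℚᵘ.* mkℚᵘ (+ suc n) 0          ≈⟨ *≡* (trans (ℤ.*-identityʳ _) (trans (ℤ.*-identityˡ (+ suc n)) (sym (trans (ℤ.*-identityˡ (+ (suc n ℕ.* 1))) (cong +_ (ℕ.*-identityʳ (suc n))))))) ⟩
    ℚ.toℚᵘ 1ℚ                                   ∎)
    where open ℚᵘ.≃-Reasoning

  0≤fromℕ : ∀ n → 0ℚ ≤ fromℕ n
  0≤fromℕ n = ℚ.nonNegative⁻¹ (fromℕ n) {{ℚ.normalize-nonNeg n 1}}

  0≤recip : ∀ n .{{_ : NonZero n}} → 0ℚ ≤ recip n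
  0≤recip n = ℚ.nonNegative⁻¹ (recip n) {{ℚ.normalize-nonNeg 1 n}}

  *-monoˡ : ∀ {r p q} → 0ℚ ≤ r → p ≤ q → r * p ≤ r * q
  *-monoˡ {r} 0≤r = ℚ.*-monoˡ-≤-nonNeg r {{ℚ.nonNegative 0≤r}}

  *-monoʳ : ∀ {r p q} → 0ℚ ≤ r → p ≤ q → p * r ≤ q * r
  *-monoʳ {r} 0≤r = ℚ.*-monoʳ-≤-nonNeg r {{ℚ.nonNegative 0≤r}}

  0≤-* : ∀ {p q} → 0ℚ ≤ p → 0ℚ ≤ q → 0ℚ ≤ p * q
  0≤-* {p} {q} 0≤p 0≤q = subst (_≤ p * q) (ℚ.*-zeroʳ p) (*-monoˡ 0≤p 0≤q)

  p≤p+q : ∀ {p q} → 0ℚ ≤ q → p ≤ p + q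
  p≤p+q {p} {q} 0≤q = subst (_≤ p + q) (ℚ.+-identityʳ p) (ℚ.+-monoʳ-≤ p 0≤q)

  fromℕ-mono-≤ : ∀ {m n} → m ℕ.≤ n → fromℕ m ≤ fromℕ n
  fromℕ-mono-≤ {m} {n} m≤n = subst (fromℕ m ≤_)
    (trans (sym (fromℕ-+ m (n ℕ.∸ m))) (cong fromℕ (ℕ.m+[n∸m]≡n m≤n))) (p≤p+q (0≤fromℕ (n ℕ.∸ m)))

  recip-antimono-≤ : ∀ {m n} .{{_ : NonZero m}} .{{_ : NonZero n}} → m ℕ.≤ n → recip n ≤ recip m
  recip-antimono-≤ {m} {n} m≤n = begin
    recip n                          ≡⟨ ℚ.*-identityʳ (recip n) ⟨
    recip n * 1ℚ                     ≡⟨ cong (recip n *_) (recip-* m) ⟨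
    recip n * (recip m * fromℕ m)    ≤⟨ *-monoˡ (0≤recip n) (*-monoˡ (0≤recip m) (fromℕ-mono-≤ m≤n)) ⟩
    recip n * (recip m * fromℕ n)    ≡⟨ lemma (recip n) (recip m) (fromℕ n) ⟩
    recip m * (recip n * fromℕ n)    ≡⟨ cong (recip m *_) (recip-* n) ⟩
    recip m * 1ℚ                     ≡⟨ ℚ.*-identityʳ (recip m) ⟩
    recip m                          ∎
    where
    open ℚ.≤-Reasoning
    lemma : ∀ a b c → a * (b * c) ≡ b * (a * c)
    lemma = solve 3 (λ a b c → a :* (b :* c) := b :* (a :* c)) refl
      where open ℚSolver.+-*-Solver

  module _ (Q : ℕ) .{{_ : NonZero Q}} where

    private
      x : ℚ
      x = 1ℚ - recip Q

      1≤Q : 1 ℕ.≤ Q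
      1≤Q = ℕ.>-nonZero⁻¹ Q

      0≤x : 0ℚ ≤ x
      0≤x = subst (_≤ x) (ℚ.+-inverseʳ (recip Q)) (ℚ.+-monoˡ-≤ (- recip Q) (recip-antimono-≤ {1} {Q} 1≤Q))

      x≤1 : x ≤ 1ℚ
      x≤1 = subst (x ≤_) (ℚ.+-identityʳ 1ℚ) (ℚ.+-monoʳ-≤ 1ℚ (ℚ.neg-antimono-≤ (0≤recip Q)))

      0≤x^ : ∀ n → 0ℚ ≤ x ^ℚ n
      0≤x^ zero    = 0≤fromℕ 1
      0≤x^ (suc n) = 0≤-* 0≤x (0≤x^ n)

      x^≤1 : ∀ n → x ^ℚ n ≤ 1ℚ
      x^≤1 zero    = ℚ.≤-refl
      x^≤1 (suc n) = ℚ.≤-trans (*-monoˡ 0≤x (x^≤1 n)) (subst (_≤ 1ℚ) (sym (ℚ.*-identityʳ x)) x≤1)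

      x^[m+n]≤x^n : ∀ m n → x ^ℚ (m ℕ.+ n) ≤ x ^ℚ n
      x^[m+n]≤x^n zero    n = ℚ.≤-refl
      x^[m+n]≤x^n (suc m) n = ℚ.≤-trans (*-monoʳ (0≤x^ (m ℕ.+ n)) x≤1)
        (subst (_≤ x ^ℚ n) (sym (ℚ.*-identityˡ (x ^ℚ (m ℕ.+ n)))) (x^[m+n]≤x^n m n))

      L : ℕ → ℚ
      L = logPartialSum Q

      L-mono : ∀ m n → L m ≤ L (n ℕ.+ m)
      L-mono m zero    = ℚ.≤-refl
      L-mono m (suc n) = ℚ.≤-trans (L-mono m n) (p≤p+q (0≤-* (0≤recip (suc (n ℕ.+ m))) (0≤x^ (suc (n ℕ.+ m)))))

      block : ∀ d .{{_ : NonZero d}} m t → d ℕ.≤ suc m → L (t ℕ.+ m) ≤ L m + fromℕ t * recip d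
      block d m zero    d≤ = p≤p+q (0≤-* (0≤fromℕ 0) (0≤recip d))
      block d m (suc t) d≤ = begin
        L (t ℕ.+ m) + recip (suc (t ℕ.+ m)) * x ^ℚ suc (t ℕ.+ m)
          ≤⟨ ℚ.+-mono-≤ (block d m t d≤) (ℚ.≤-trans (*-monoˡ (0≤recip (suc (t ℕ.+ m))) (x^≤1 (suc (t ℕ.+ m))))
               (ℚ.≤-trans (ℚ.≤-reflexive (ℚ.*-identityʳ (recip (suc (t ℕ.+ m)))))
               (recip-antimono-≤ (ℕ.≤-trans d≤ (s≤s (ℕ.m≤n+m m t)))))) ⟩
        L m + fromℕ t * recip d + recip d
          ≡⟨ lemma (L m) (fromℕ t) (recip d) ⟩
        L m + (1ℚ + fromℕ t) * recip d
          ≡⟨ cong (λ y → L m + y * recip d) (fromℕ-+ 1 t) ⟨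
        L m + fromℕ (suc t) * recip d ∎
        where
        open ℚ.≤-Reasoning
        lemma : ∀ a b c → a + b * c + c ≡ a + (1ℚ + b) * c
        lemma = solve 3 (λ a b c → a :+ b :* c :+ c := a :+ (con 1ℚ :+ b) :* c) refl
          where open ℚSolver.+-*-Solver

      -- Powers of x are bounded by 1. Each dyadic block of the harmonic series, with 2^j terms of
      -- size at most 2^(-j), then adds at most 1.
      dyadic : ∀ j n → n ℕ.< 2 ℕ.^ j → L n ≤ fromℕ j
      dyadic zero zero _ = 0≤fromℕ 0
      dyadic zero (suc n) (s≤s ())
      dyadic (suc j) n n<2^1+j = half (n ℕ.<? D)
        where
        open ℚ.≤-Reasoning
        D : ℕ
        D = 2 ℕ.^ j
        instance
          D≢0 : NonZero D
          D≢0 = ℕ.m^n≢0 2 j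
        m : ℕ
        m = ℕ.pred D
        1+m≡D : suc m ≡ D
        1+m≡D = ℕ.suc-pred D
        half : Dec (n ℕ.< D) → L n ≤ fromℕ (suc j)
        half (yes n<D) = ℚ.≤-trans (dyadic j n n<D) (fromℕ-mono-≤ (ℕ.n≤1+n j))
        half (no n≮D) = begin
          L n                             ≡⟨ cong L (ℕ.m∸n+n≡m m≤n) ⟨
          L (n ℕ.∸ m ℕ.+ m)               ≤⟨ block D m (n ℕ.∸ m) (ℕ.≤-reflexive (sym 1+m≡D)) ⟩
          L m + fromℕ (n ℕ.∸ m) * recip D ≤⟨ ℚ.+-mono-≤ (dyadic j m (ℕ.≤-reflexive 1+m≡D)) (*-monoʳ (0≤recip D) (fromℕ-mono-≤ t≤D)) ⟩
          fromℕ j + fromℕ D * recip D     ≡⟨ cong (_+_ (fromℕ j)) (trans (ℚ.*-comm (fromℕ D) (recip D)) (recip-* D)) ⟩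
          fromℕ j + fromℕ 1               ≡⟨ fromℕ-+ j 1 ⟨
          fromℕ (j ℕ.+ 1)                 ≡⟨ cong fromℕ (ℕ.+-comm j 1) ⟩
          fromℕ (suc j)                   ∎
          where
          m≤n : m ℕ.≤ n
          m≤n = ℕ.≤-trans (ℕ.pred[n]≤n {D}) (ℕ.≮⇒≥ n≮D)
          t≤D : n ℕ.∸ m ℕ.≤ D
          t≤D = ℕ.m≤n+o⇒m∸n≤o n m (ℕ.s≤s⁻¹ (ℕ.≤-trans n<2^1+j (ℕ.≤-reflexive
            (trans (cong (D ℕ.+_) (ℕ.+-identityʳ D)) (cong (ℕ._+ D) (sym 1+m≡D))))))

      -- Beyond Q the denominators are at least Q and 1/Q = 1 - x, so the terms are at most (1 - x)
      -- x^t and telescope. The summand x^t on the left is what remains of the geometric series.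
      tail : ∀ m t → Q ℕ.≤ suc m → L (t ℕ.+ m) + x ^ℚ t ≤ L m + 1ℚ
      tail m zero    Q≤ = ℚ.≤-refl
      tail m (suc t) Q≤ = begin
        L (t ℕ.+ m) + recip (suc (t ℕ.+ m)) * x ^ℚ suc (t ℕ.+ m) + x * x ^ℚ t
          ≤⟨ ℚ.+-monoˡ-≤ (x * x ^ℚ t) (ℚ.+-monoʳ-≤ (L (t ℕ.+ m)) (ℚ.≤-trans
               (*-monoʳ (0≤x^ (suc (t ℕ.+ m))) (recip-antimono-≤ {Q} (ℕ.≤-trans Q≤ (s≤s (ℕ.m≤n+m m t)))))
               (*-monoˡ (0≤recip Q) (subst (λ n → x ^ℚ suc n ≤ x ^ℚ t) (ℕ.+-comm m t) (x^[m+n]≤x^n (suc m) t))))) ⟩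
        L (t ℕ.+ m) + recip Q * x ^ℚ t + x * x ^ℚ t
          ≡⟨ lemma (L (t ℕ.+ m)) (recip Q) (x ^ℚ t) ⟩
        L (t ℕ.+ m) + x ^ℚ t
          ≤⟨ tail m t Q≤ ⟩
        L m + 1ℚ ∎
        where
        open ℚ.≤-Reasoning
        lemma : ∀ a b c → a + b * c + (1ℚ - b) * c ≡ a + c
        lemma = solve 3 (λ a b c → a :+ b :* c :+ (con 1ℚ :- b) :* c := a :+ c) refl
          where open ℚSolver.+-*-Solver

    -- The terms up to index Q give at most j + 1, all later ones together at most 1.
    logPartialSum≤ : ∀ j n → Q ℕ.< 2 ℕ.^ suc j → logPartialSum Q n ≤ fromℕ (2 ℕ.+ j)
    logPartialSum≤ j n Q<2^1+j = begin
      L n                   ≤⟨ L-mono n m ⟩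
      L (m ℕ.+ n)           ≡⟨ cong L (ℕ.+-comm m n) ⟩
      L (n ℕ.+ m)           ≤⟨ p≤p+q (0≤x^ n) ⟩
      L (n ℕ.+ m) + x ^ℚ n  ≤⟨ tail m n (ℕ.n≤1+n Q) ⟩
      L m + 1ℚ              ≤⟨ ℚ.+-monoˡ-≤ 1ℚ (dyadic (suc j) m Q<2^1+j) ⟩
      fromℕ (suc j) + fromℕ 1 ≡⟨ fromℕ-+ (suc j) 1 ⟨
      fromℕ (suc j ℕ.+ 1)   ≡⟨ cong fromℕ (ℕ.+-comm (suc j) 1) ⟩
      fromℕ (2 ℕ.+ j)       ∎
      where
      open ℚ.≤-Reasoning
      m : ℕ
      m = Q

  -- An integer majorant of log V. The value at 0 is a convention, Q being positive in the theorem.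
  logBound : ℕ → ℕ
  logBound zero      = 0
  logBound V@(suc _) = 2 ℕ.+ proj₁ (log₂ V)

  logBound≡ : ∀ Q .{{_ : NonZero Q}} → logBound Q ≡ 2 ℕ.+ proj₁ (log₂ Q)
  logBound≡ (suc _) = refl

  <log⇒≤ : ∀ {r} Q .{{_ : NonZero Q}} → r <log Q → r ≤ fromℕ (logBound Q)
  <log⇒≤ {r} Q (n , r<) = ℚ.≤-trans (ℚ.<⇒≤ r<) (subst (λ l → logPartialSum Q n ≤ fromℕ l) (sym (logBound≡ Q))
    (logPartialSum≤ Q (proj₁ (log₂ Q)) n (proj₂ (proj₂ (log₂ Q)))))

  logBound^≤ : ∀ b .{{_ : NonZero b}} → ∃[ V₀ ] ∀ V → V₀ ℕ.≤ V → logBound V ℕ.^ b ℕ.≤ V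
  logBound^≤ b = V₀ , bound
    where
    K V₀ : ℕ
    -- The power 2b instead of b gives (2 + j)^(2b) ≤ K^K 2^(j+1) = V₀ 2^j ≤ V²: one factor V
    -- absorbs the constant, and a square root is taken at the end.
    K = b ℕ.* 2
    V₀ = K ℕ.^ K ℕ.* 2

    instance
      K≢0 : NonZero K
      K≢0 = ℕ.m*n≢0 b 2

    bound : ∀ V → V₀ ℕ.≤ V → logBound V ℕ.^ b ℕ.≤ V
    bound zero      _ = ℕ.≤-reflexive (zero^ b)
      where
      zero^ : ∀ b .{{_ : NonZero b}} → 0 ℕ.^ b ≡ 0
      zero^ (suc b) = refl
    bound V@(suc _) V₀≤V = ^-cancelˡ-≤ 2 (begin
      ((2 ℕ.+ j) ℕ.^ b) ℕ.^ 2          ≡⟨ ℕ.^-*-assoc (2 ℕ.+ j) b 2 ⟩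
      (2 ℕ.+ j) ℕ.^ K                  ≤⟨ polynomial≤exponential K (suc j) ⟩
      K ℕ.^ K ℕ.* (2 ℕ.* 2 ℕ.^ j)      ≡⟨ ℕ.*-assoc (K ℕ.^ K) 2 (2 ℕ.^ j) ⟨
      V₀ ℕ.* 2 ℕ.^ j                   ≤⟨ ℕ.*-mono-≤ V₀≤V (proj₁ (proj₂ (log₂ V))) ⟩
      V ℕ.* V                          ≡⟨ cong (V ℕ.*_) (ℕ.*-identityʳ V) ⟨
      V ℕ.^ 2                          ∎)
      where
      open ℕ.≤-Reasoning
      j : ℕ
      j = proj₁ (log₂ V)

open RationalBounds
open Energy using (energy-bound)

open import Data.Rational.Base as ℚ using (ℚ; 0ℚ; _+_; _*_; _≤_; _<_)

-- For ε = (a+1)/b the case ε = 1/b is already enough, since V ≤ V^(a+1).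
logBound-isPowerO1 : IsPowerO1 (λ V → fromℕ (logBound V))
logBound-isPowerO1 ε@(ℚ.mkℚ (+ zero) _ _) 0<ε with () ← ℚ.positive 0<ε
logBound-isPowerO1 ε@(ℚ.mkℚ -[1+ _ ] _ _) 0<ε with () ← ℚ.positive 0<ε
logBound-isPowerO1 (ℚ.mkℚ +[1+ a ] b-1 _) _ = proj₁ (logBound^≤ b) , λ V V₀≤V → begin
  ℚ.∣ fromℕ (logBound V) ∣ ^ℚ b    ≡⟨ cong (_^ℚ b) (ℚ.0≤p⇒∣p∣≡p (0≤fromℕ (logBound V))) ⟩
  fromℕ (logBound V) ^ℚ b          ≡⟨ fromℕ-^ (logBound V) b ⟨
  fromℕ (logBound V ℕ.^ b)         ≤⟨ fromℕ-mono-≤ (proj₂ (logBound^≤ b) V V₀≤V) ⟩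
  fromℕ V                          ≤⟨ fromℕ-mono-≤ (V≤V^ V) ⟩
  fromℕ (V ℕ.^ suc a)              ≡⟨ fromℕ-^ V (suc a) ⟩
  fromℕ V ^ℚ suc a                 ∎
  where
  open ℚ.≤-Reasoning
  b : ℕ
  b = suc b-1
  V≤V^ : ∀ V → V ℕ.≤ V ℕ.^ suc a
  V≤V^ zero      = z≤n
  V≤V^ V@(suc _) = ℕ.m≤m*n V (V ℕ.^ a) {{ℕ.m^n≢0 V a}}

theorem1p3 : ∀ (k : ℕ) → 3 ℕ.≤ k →
    ∃[ c ] ∃[ U ] 0ℚ < c × IsPowerO1 U ×
    (∀ (Q N : ℕ) .{{_ : NonZero Q}} .{{_ : NonZero N}} → N ℕ.≤ Q →
    ∀ (r : ℚ) → r <log Q →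
    (r * recip Q) * fromℕ (sumMaxE k N Q)
    ≤ c * (fromℕ N ^ℚ 2 + fromℕ N ^ℚ 4 * (recip Q * U Q)))
-- `suc c` in place of `c` makes the constant positive without inspecting it; U is the majorant of
-- the logarithm.
theorem1p3 (suc k-1) 3≤k = fromℕ (suc c) , (λ V → fromℕ (logBound V)) ,
  ℚ.positive⁻¹ (fromℕ (suc c)) {{ℚ.normalize-pos (suc c) 1}} , logBound-isPowerO1 , main
  where
  c : ℕ
  c = proj₁ (energy-bound k-1 3≤k)

  main : ∀ (Q N : ℕ) .{{_ : NonZero Q}} .{{_ : NonZero N}} → N ℕ.≤ Q → ∀ (r : ℚ) → r <log Q →
    (r * recip Q) * fromℕ (sumMaxE (suc k-1) N Q)
    ≤ fromℕ (suc c) * (fromℕ N ^ℚ 2 + fromℕ N ^ℚ 4 * (recip Q * fromℕ (logBound Q)))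
  main Q N N≤Q r r<log = begin
    (r * recip Q) * fromℕ S
      ≤⟨ *-monoʳ (0≤fromℕ S) (*-monoʳ (0≤recip Q) (<log⇒≤ Q r<log)) ⟩
    (fromℕ R * recip Q) * fromℕ S
      ≡⟨ lemma (fromℕ R) (recip Q) (fromℕ S) ⟩
    recip Q * (fromℕ R * fromℕ S)
      ≡⟨ cong (recip Q *_) (fromℕ-* R S) ⟨
    recip Q * fromℕ (R ℕ.* S)
      ≤⟨ *-monoˡ (0≤recip Q) (fromℕ-mono-≤ natural-bound) ⟩
    recip Q * fromℕ (suc c ℕ.* (N ℕ.^ 2 ℕ.* Q ℕ.+ N ℕ.^ 4 ℕ.* R))
      ≡⟨ cong (recip Q *_) (trans (fromℕ-* (suc c) (N ℕ.^ 2 ℕ.* Q ℕ.+ N ℕ.^ 4 ℕ.* R)) (cong (fromℕ (suc c) *_)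
           (trans (fromℕ-+ (N ℕ.^ 2 ℕ.* Q) (N ℕ.^ 4 ℕ.* R)) (cong₂ _+_ (trans (fromℕ-* (N ℕ.^ 2) Q) (cong (_* fromℕ Q) (fromℕ-^ N 2)))
             (trans (fromℕ-* (N ℕ.^ 4) R) (cong (_* fromℕ R) (fromℕ-^ N 4))))))) ⟩
    recip Q * (fromℕ (suc c) * (fromℕ N ^ℚ 2 * fromℕ Q + fromℕ N ^ℚ 4 * fromℕ R))
      ≡⟨ lemma′ (recip Q) (fromℕ (suc c)) (fromℕ N ^ℚ 2) (fromℕ Q) (fromℕ N ^ℚ 4) (fromℕ R) ⟩
    fromℕ (suc c) * (fromℕ N ^ℚ 2 * (recip Q * fromℕ Q) + fromℕ N ^ℚ 4 * (recip Q * fromℕ R))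
      ≡⟨ cong (λ x → fromℕ (suc c) * (x + fromℕ N ^ℚ 4 * (recip Q * fromℕ R)))
           (trans (cong (fromℕ N ^ℚ 2 *_) (recip-* Q)) (ℚ.*-identityʳ (fromℕ N ^ℚ 2))) ⟩
    fromℕ (suc c) * (fromℕ N ^ℚ 2 + fromℕ N ^ℚ 4 * (recip Q * fromℕ R)) ∎
    where
    open ℚ.≤-Reasoning
    R S : ℕ
    R = logBound Q
    S = sumMaxE (suc k-1) N Q

    natural-bound : R ℕ.* S ℕ.≤ suc c ℕ.* (N ℕ.^ 2 ℕ.* Q ℕ.+ N ℕ.^ 4 ℕ.* R)
    natural-bound = ℕ.≤-trans (subst (λ R → R ℕ.* S ℕ.≤ c ℕ.* (N ℕ.^ 2 ℕ.* Q ℕ.+ N ℕ.^ 4 ℕ.* R)) (sym (logBound≡ Q))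
      (proj₂ (energy-bound k-1 3≤k) Q N N≤Q)) (ℕ.*-monoˡ-≤ (N ℕ.^ 2 ℕ.* Q ℕ.+ N ℕ.^ 4 ℕ.* R) (ℕ.n≤1+n c))

    lemma : ∀ a b c → (a * b) * c ≡ b * (a * c)
    lemma = solve 3 (λ a b c → (a :* b) :* c := b :* (a :* c)) refl
      where open ℚSolver.+-*-Solver
    lemma′ : ∀ i c m q n r → i * (c * (m * q + n * r)) ≡ c * (m * (i * q) + n * (i * r))
    lemma′ = solve 6 (λ i c m q n r → i :* (c :* (m :* q :+ n :* r)) := c :* (m :* (i :* q) :+ n :* (i :* r))) refl
      where open ℚSolver.+-*-Solver
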